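{- Let $n\ge1$ and let $r$ be an even integer with $0\le r\le n-1$. For $T>0$ let $$N_{n,r}(T)=\#\{A\in\mathrm{M}_n(\mathbb{Z})_{\mathrm{alt}}:\ \operatorname{rank}A=r\text{ and }|A|<T\},$$ where $|A|=(\sum_{i,j}a_{ij}^2)^{1/2}$. Then $N_{n,r}(T)\asymp_n T^{nr/2}$ for all sufficiently large real $T$.
   Context: $\mathrm{M}_n(\mathbb{Z})_{\mathrm{alt}}$ is the set of $n\times n$ integer matrices $A$ with $A^T=-A$ and zero diagonal. $f\asymp_n g$ means $f$ and $g$ are each bounded by a positive constant depending only on $n$ times the other.
   Formalization: The bounds are stated for all sufficiently large rational T, with rational constants, rather than for all sufficiently large real T; the real case follows since N_{n,r}(T) is monotone in T. -}

module Defs where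

open import Data.Nat using (ℕ; zero; suc)
open import Data.Fin using (Fin)
open import Data.Integer as ℤ using (ℤ; +_)
open import Data.Vec using (Vec; lookup)
open import Data.Vec.Functional using (Vector)
open import Data.List using (List; map; foldr; allFin)
open import Data.Product using (Σ; _×_; ∃)
open import Function using (Injective)
open import Relation.Binary.PropositionalEquality using (_≡_)
open import Data.Rational as ℚ using (ℚ; 1ℚ)

Mat : ℕ → Set
Mat n = Vec (Vec ℤ n) n

entry : ∀ {n} → Mat n → Fin n → Fin n → ℤ
entry A i j = lookup (lookup A i) j

IsAlt : ∀ {n} → Mat n → Set
IsAlt {n} A = (∀ (i j : Fin n) → entry A j i ≡ ℤ.- entry A i j)
            × (∀ (i : Fin n) → entry A i i ≡ + 0)

ΣFin : (n : ℕ) → (Fin n → ℤ) → ℤ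
ΣFin n f = foldr ℤ._+_ (+ 0) (map f (allFin n))

combo : ∀ {n k} → Mat n → (Fin k → Fin n) → (Fin k → ℤ) → Fin n → ℤ
combo {n} {k} A cols c i = ΣFin k (λ j → c j ℤ.* entry A i (cols j))

-- the columns of A indexed by cols are linearly independent
-- (over ℤ, equivalently over ℚ by clearing denominators)
ColsIndependent : ∀ {n k} → Mat n → (Fin k → Fin n) → Set
ColsIndependent {n} {k} A cols =
  ∀ (c : Fin k → ℤ) → (∀ i → combo A cols c i ≡ + 0) → ∀ j → c j ≡ + 0

HasRank : ∀ {n} → Mat n → ℕ → Set
HasRank {n} A r =
  (Σ (Fin r → Fin n) λ cols → Injective _≡_ _≡_ cols × ColsIndependent A cols)
  × (∀ (cols : Fin (suc r) → Fin n) → Injective _≡_ _≡_ cols → ColsIndependent A cols → Data.Empty.⊥)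
  where import Data.Empty

normSq : ∀ {n} → Mat n → ℤ
normSq {n} A = ΣFin n (λ i → ΣFin n (λ j → entry A i j ℤ.* entry A i j))

_^ℚ_ : ℚ → ℕ → ℚ
x ^ℚ zero = 1ℚ
x ^ℚ suc k = x ℚ.* (x ^ℚ k)

-- membership in the set counted by N_{n,r}(T), for T > 0:
-- A alternating, rank A = r, |A| < T  (i.e. |A|^2 < T^2)
InN : (n r : ℕ) → ℚ → Mat n → Set
InN n r T A = IsAlt A × HasRank A r × (normSq A ℚ./ 1 ℚ.< T ℚ.* T)

{-# OPTIONS --safe #-}
module Submission where

-- Write r = 2m.  The key fact is that an alternating integer matrix A of rank at most 2m is a sum
-- of m decomposables u ∧ v = u vᵀ - v uᵀ with u, v integral and |u| |v| ≪ |A|.  Indeed A = B a Bᵀ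
-- for an alternating integral a of size 2m; by Hermite reduction the lattice spanned by the columns
-- of B has a basis whose first vector b satisfies x₀ |b| ≪ |B x| for all coordinate vectors x.
-- Splitting off b ∧ B a e₀ costs a bounded factor in the norm, and leaves a form on an odd number
-- of vectors, whose radical allows one more vector to be dropped.
--
-- Upper bound: the number of u ∧ v with |u| |v| ≤ s is O(sⁿ), because for |u| ≤ |v| the vector v
-- only matters modulo u; hence there are O(T^(nm)) sums of m of them.
--
-- Lower bound: for n = 2m + 1 almost every alternating matrix will do, and a congruence modulo 2
-- forces rank 2m.  Passing from n to n + 1, a border Σ (x u + y v) keeps the rank, and the
-- coefficients with |x| ≤ T / |u|, |y| ≤ T / |v| supply T^m choices, since |u| |v| ≪ T.

open import Defs

-- The upper bound has no room for a logarithm. Counted directly, the pairs with |u| |v| ≤ s number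
-- about sⁿ for each dyadic size of |u|, hence sⁿ log s in all. After reduction modulo u, the entry
-- c of v beside the largest entry a of u runs only through 0 ≤ c < a. The pairs (a, c) with a² ≤ s
-- number at most s, and each of the other n - 1 coordinates has about a · s / a = s choices for its
-- two entries, whatever a is. The product is sⁿ. In the lower bound, distinct coefficients give
-- distinct borders because rank exactly 2m makes the 2m vectors u, v independent. Lengths are
-- compared through their squares, and kernel vectors take the place of determinants, so that
-- reduction and counting stay within ℤ.

module AlternatingMatrices where
  open import Data.Nat.Base as ℕ using (ℕ; zero; suc)
  import Data.Nat.Properties as ℕP
  import Data.Nat.DivMod as ℕD
  import Data.Nat.Coprimality as Coprime
  open import Data.Nat.Induction using (<-wellFounded)
  open import Data.Nat.Tactic.RingSolver using () renaming (solve-∀ to solveℕ-∀)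
  open import Data.Fin.Base using (Fin; zero; suc; toℕ; fromℕ<; inject≤; inject₁; combine; remQuot; punchIn; punchOut)
  open import Data.Fin.Properties using (combine-injective; combine-remQuot; fromℕ<-injective; inject≤-injective; inject₁-injective; injective⇒≤; punchIn-punchOut; toℕ<n; toℕ-injective) renaming (_≟_ to _≟F_; suc-injective to Fin-suc-injective)
  open import Data.Integer.Base as ℤ using (ℤ; +_; -[1+_]; -_; _+_; _*_; ∣_∣; _≤_; _<_; NonZero; ≢-nonZero; +≤+; nonNegative; positive)
  open import Data.Integer.Properties as ℤP
  import Data.Integer.DivMod as DM
  open import Data.Integer.Tactic.RingSolver using (solve-∀)
  open import Data.Rational.Base as ℚ using (ℚ; mkℚ; 0ℚ; 1ℚ; *≤*; *<*)
  import Data.Rational.Properties as ℚP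
  open import Data.Vec.Functional using (tail) renaming (_∷_ to _◅_)
  open import Data.Vec.Base using (Vec; []; _∷_; replicate; lookup; tabulate)
  open import Data.Vec.Properties using (lookup∘tabulate; tabulate∘lookup; tabulate-cong)
  open import Data.Vec.Relation.Unary.All as All using (All; []; _∷_)
  open import Data.List.Base as List using (List; []; _∷_; length)
  open import Data.List.Properties using (map-tabulate)
  open import Data.List.Relation.Unary.Unique.Propositional using (Unique)
  open import Data.List.Relation.Unary.AllPairs using ([]; _∷_)
  import Data.List.Relation.Unary.All as ListAll
  import Data.List.Relation.Unary.Any as Any
  open import Data.List.Relation.Unary.Any.Properties using (lookup-index)
  open import Data.List.Membership.Propositional using (_∈_)
  open import Data.List.Membership.Propositional.Properties using (∈-lookup)
  open import Data.Product using (Σ; ∃; _×_; _,_; proj₁; proj₂)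
  open import Data.Sum using (_⊎_; inj₁; inj₂)
  open import Data.Empty using (⊥-elim)
  open import Function using (Injective)
  open import Function.Bundles using (_⇔_; Equivalence)
  open import Induction.WellFounded using (Acc; acc)
  open import Relation.Nullary using (¬_; yes; no)
  open import Relation.Binary.Definitions using (tri<; tri≈; tri>)
  open import Relation.Binary.PropositionalEquality

  -- Integer vectors and linear maps

  V : ℕ → Set
  V n = Fin n → ℤ

  +-congˡ : ∀ (a : ℤ) {b c} → b ≡ c → a + b ≡ a + c
  +-congˡ a = cong (λ z → a + z)

  infix 7 _∙_
  _∙_ : ∀ {n} → V n → V n → ℤ
  _∙_ {zero} x y = + 0
  _∙_ {suc n} x y = x zero * y zero + tail x ∙ tail y

  infixl 6 _⊕_
  _⊕_ : ∀ {n} → V n → V n → V n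
  (x ⊕ y) i = x i + y i

  infixr 7 _⊙_
  _⊙_ : ∀ {n} → ℤ → V n → V n
  (c ⊙ x) i = c * x i

  0v : ∀ {n} → V n
  0v _ = + 0

  e : ∀ {n} → Fin n → V n
  e zero zero = + 1
  e zero (suc j) = + 0
  e (suc i) zero = + 0
  e (suc i) (suc j) = e i j

  NZ : ∀ {n} → V n → Set
  NZ x = ∃ λ i → x i ≢ + 0

  zero-or-NZ : ∀ {n} (x : V n) → (x ≗ 0v) ⊎ NZ x
  zero-or-NZ {zero} x = inj₁ λ ()
  zero-or-NZ {suc n} x with x zero ≟ + 0 | zero-or-NZ (tail x)
  ... | no q | _ = inj₂ (zero , q)
  ... | yes _ | inj₂ (i , q) = inj₂ (suc i , q)
  ... | yes p | inj₁ ps = inj₁ λ { zero → p ; (suc i) → ps i }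

  ∙-cong : ∀ {n} {x x' y y' : V n} → x ≗ x' → y ≗ y' → x ∙ y ≡ x' ∙ y'
  ∙-cong {zero} h k = refl
  ∙-cong {suc n} h k =
    cong₂ _+_ (cong₂ _*_ (h zero) (k zero)) (∙-cong (λ i → h (suc i)) (λ i → k (suc i)))

  ∙-congˡ : ∀ {n} (x : V n) {y y' : V n} → y ≗ y' → x ∙ y ≡ x ∙ y'
  ∙-congˡ x k = ∙-cong (λ _ → refl) k

  ∙-congʳ : ∀ {n} {x x' : V n} (y : V n) → x ≗ x' → x ∙ y ≡ x' ∙ y
  ∙-congʳ y h = ∙-cong h (λ _ → refl)

  ∙-comm : ∀ {n} (x y : V n) → x ∙ y ≡ y ∙ x
  ∙-comm {zero} x y = refl
  ∙-comm {suc n} x y = cong₂ _+_ (*-comm (x zero) (y zero)) (∙-comm (tail x) (tail y))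

  ∙-⊕ʳ : ∀ {n} (x y z : V n) → x ∙ (y ⊕ z) ≡ x ∙ y + x ∙ z
  ∙-⊕ʳ {zero} x y z = refl
  ∙-⊕ʳ {suc n} x y z =
    trans (+-congˡ (x zero * (y zero + z zero)) (∙-⊕ʳ (tail x) (tail y) (tail z)))
          (lem (x zero) (y zero) (z zero) _ _)
    where
    lem : ∀ a b c u v → a * (b + c) + (u + v) ≡ (a * b + u) + (a * c + v)
    lem = solve-∀

  ∙-⊙ʳ : ∀ {n} (c : ℤ) (x y : V n) → x ∙ (c ⊙ y) ≡ c * (x ∙ y)
  ∙-⊙ʳ {zero} c x y = sym (*-zeroʳ c)
  ∙-⊙ʳ {suc n} c x y =
    trans (+-congˡ (x zero * (c * y zero)) (∙-⊙ʳ c (tail x) (tail y))) (lem c (x zero) (y zero) _)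
    where
    lem : ∀ c a b u → a * (c * b) + c * u ≡ c * (a * b + u)
    lem = solve-∀

  ∙-⊕ˡ : ∀ {n} (x y z : V n) → (x ⊕ y) ∙ z ≡ x ∙ z + y ∙ z
  ∙-⊕ˡ x y z = trans (∙-comm (x ⊕ y) z)
    (trans (∙-⊕ʳ z x y) (cong₂ _+_ (∙-comm z x) (∙-comm z y)))

  ∙-⊙ˡ : ∀ {n} (c : ℤ) (x y : V n) → (c ⊙ x) ∙ y ≡ c * (x ∙ y)
  ∙-⊙ˡ c x y = trans (∙-comm (c ⊙ x) y)
    (trans (∙-⊙ʳ c y x) (cong (c *_) (∙-comm y x)))

  ∙-0ʳ : ∀ {n} (x : V n) → x ∙ 0v ≡ + 0
  ∙-0ʳ {zero} x = refl
  ∙-0ʳ {suc n} x = trans (cong₂ _+_ (*-zeroʳ (x zero)) (∙-0ʳ (tail x))) refl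

  ∙-≗0ʳ : ∀ {n} (x : V n) {y : V n} → y ≗ 0v → x ∙ y ≡ + 0
  ∙-≗0ʳ x h = trans (∙-congˡ x h) (∙-0ʳ x)

  ∙-e : ∀ {n} (x : V n) (i : Fin n) → x ∙ e i ≡ x i
  ∙-e {suc n} x zero = trans (cong₂ _+_ (*-identityʳ (x zero)) (∙-0ʳ (tail x))) (+-identityʳ _)
  ∙-e {suc n} x (suc i) = trans (cong₂ _+_ (*-zeroʳ (x zero)) (∙-e (tail x) i)) (+-identityˡ _)

  NZ-e : ∀ {n} (i : Fin n) → NZ (e i)
  NZ-e zero = zero , λ ()
  NZ-e (suc i) = let (j , q) = NZ-e i in suc j , q

  -- A linear map carried together with its transpose; linearity follows from adjointness.
  record Lin (m n : ℕ) : Set where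
    field
      ap : V m → V n
      ap* : V n → V m
      adj : ∀ x y → ap x ∙ y ≡ x ∙ ap* y
  open Lin public

  infix 9 _ᵀ
  _ᵀ : ∀ {m n} → Lin m n → Lin n m
  L ᵀ = record { ap = ap* L ; ap* = ap L
               ; adj = λ x y → trans (∙-comm _ y) (trans (sym (adj L y x)) (∙-comm _ x)) }

  ap-coord : ∀ {m n} (L : Lin m n) x i → ap L x i ≡ x ∙ ap* L (e i)
  ap-coord L x i = trans (sym (∙-e (ap L x) i)) (adj L x (e i))

  ap-cong : ∀ {m n} (L : Lin m n) {x y} → x ≗ y → ap L x ≗ ap L y
  ap-cong L {x} {y} h i =
    trans (ap-coord L x i) (trans (∙-congʳ _ h) (sym (ap-coord L y i)))

  ap-⊕ : ∀ {m n} (L : Lin m n) x y → ap L (x ⊕ y) ≗ ap L x ⊕ ap L y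
  ap-⊕ L x y i = trans (ap-coord L (x ⊕ y) i)
    (trans (∙-⊕ˡ x y _) (cong₂ _+_ (sym (ap-coord L x i)) (sym (ap-coord L y i))))

  ap-⊙ : ∀ {m n} (L : Lin m n) c x → ap L (c ⊙ x) ≗ c ⊙ ap L x
  ap-⊙ L c x i = trans (ap-coord L (c ⊙ x) i)
    (trans (∙-⊙ˡ c x _) (cong (c *_) (sym (ap-coord L x i))))

  ap-0 : ∀ {m n} (L : Lin m n) {x} → x ≗ 0v → ap L x ≗ 0v
  ap-0 L {x} h i = trans (ap-coord L x i) (trans (∙-comm x _) (∙-≗0ʳ _ h))

  idL : ∀ {n} → Lin n n
  idL = record { ap = λ x → x ; ap* = λ x → x ; adj = λ _ _ → refl }

  infixr 8 _∘L_
  _∘L_ : ∀ {l m n} → Lin m n → Lin l m → Lin l n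
  L ∘L K = record { ap = λ x → ap L (ap K x) ; ap* = λ y → ap* K (ap* L y)
                  ; adj = λ x y → trans (adj L (ap K x) y) (adj K x (ap* L y)) }

  inclL : ∀ {k} → Lin k (suc k)
  inclL = record { ap = + 0 ◅_ ; ap* = tail ; adj = λ x y → +-identityˡ _ }

  blockL : ∀ {m n} → Lin m n → Lin (suc m) (suc n)
  blockL L = record
    { ap = λ x → x zero ◅ ap L (tail x)
    ; ap* = λ y → y zero ◅ ap* L (tail y)
    ; adj = λ x y → +-congˡ (x zero * y zero) (adj L (tail x) (tail y)) }

  infixr 7 _▹_
  _▹_ : ∀ {k n} → V n → Lin k n → Lin (suc k) n
  t ▹ L = record
    { ap = λ x → x zero ⊙ t ⊕ ap L (tail x)
    ; ap* = λ y → t ∙ y ◅ ap* L y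
    ; adj = λ x y → trans (∙-⊕ˡ (x zero ⊙ t) _ y)
                      (cong₂ _+_ (∙-⊙ˡ (x zero) t y) (adj L (tail x) y)) }

  rowL : ∀ {k n} → V k → Lin k n → Lin k (suc n)
  rowL w L = (w ▹ L ᵀ) ᵀ

  matL : ∀ {m n} → (Fin m → Fin n → ℤ) → Lin n m
  matL {zero} A = record { ap = λ _ () ; ap* = λ _ → 0v ; adj = λ x y → sym (∙-0ʳ x) }
  matL {suc m} A = rowL (A zero) (matL (λ i → A (suc i)))

  matL-ap : ∀ {m n} (A : Fin m → Fin n → ℤ) x i → ap (matL A) x i ≡ A i ∙ x
  matL-ap A x zero = refl
  matL-ap A x (suc i) = matL-ap (λ i → A (suc i)) x i

  -- Unimodular maps and kernels

  record GL (k : ℕ) : Set where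
    field
      to from : Lin k k
      to-from : ∀ x → ap to (ap from x) ≗ x
      from-to : ∀ x → ap from (ap to x) ≗ x
  open GL public

  idG : ∀ {k} → GL k
  idG = record { to = idL ; from = idL ; to-from = λ _ _ → refl ; from-to = λ _ _ → refl }

  infixr 8 _∘G_
  _∘G_ : ∀ {k} → GL k → GL k → GL k
  G ∘G H = record
    { to = to G ∘L to H ; from = from H ∘L from G
    ; to-from = λ x i → trans (ap-cong (to G) (to-from H (ap (from G) x)) i) (to-from G x i)
    ; from-to = λ x i → trans (ap-cong (from H) (from-to G (ap (to H) x)) i) (from-to H x i) }

  invG : ∀ {k} → GL k → GL k
  invG G = record { to = from G ; from = to G ; to-from = from-to G ; from-to = to-from G }

  transpose-inverse : ∀ {m n} (L : Lin m n) (K : Lin n m) → (∀ x → ap L (ap K x) ≗ x) →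
    ∀ x → ap* K (ap* L x) ≗ x
  transpose-inverse L K h x i = begin
    ap* K (ap* L x) i        ≡⟨ ∙-e _ i ⟨
    ap* K (ap* L x) ∙ e i    ≡⟨ adj (K ᵀ) _ (e i) ⟩
    ap* L x ∙ ap K (e i)     ≡⟨ adj (L ᵀ) x _ ⟩
    x ∙ ap L (ap K (e i))    ≡⟨ ∙-congˡ x (h (e i)) ⟩
    x ∙ e i                  ≡⟨ ∙-e x i ⟩
    x i                      ∎
    where open ≡-Reasoning

  transG : ∀ {k} → GL k → GL k
  transG G = record
    { to = to G ᵀ ; from = from G ᵀ
    ; to-from = transpose-inverse (from G) (to G) (from-to G)
    ; from-to = transpose-inverse (to G) (from G) (to-from G) }

  blockG : ∀ {k} → GL k → GL (suc k)
  blockG G = record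
    { to = blockL (to G) ; from = blockL (from G)
    ; to-from = λ { x zero → refl ; x (suc i) → to-from G (tail x) i }
    ; from-to = λ { x zero → refl ; x (suc i) → from-to G (tail x) i } }

  -- A step of Euclid's algorithm; the matrix and its inverse are symmetric.
  elemG : ∀ {k} → ℤ → GL (suc (suc k))
  elemG q = record
    { to = record { ap = f ; ap* = f
                  ; adj = λ x y → lem₁ q (x zero) (x (suc zero)) (y zero) (y (suc zero)) _ }
    ; from = record { ap = g ; ap* = g
                  ; adj = λ x y → lem₂ q (x zero) (x (suc zero)) (y zero) (y (suc zero)) _ }
    ; to-from = λ { x zero → lem₃ q (x (suc zero)) (x zero) ; x (suc zero) → refl ; x (suc (suc i)) → refl }
    ; from-to = λ { x zero → refl ; x (suc zero) → lem₄ q (x zero) (x (suc zero)) ; x (suc (suc i)) → refl } }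
    where
    f g : ∀ {k} → V (suc (suc k)) → V (suc (suc k))
    f x = q * x zero + x (suc zero) ◅ x zero ◅ λ i → x (suc (suc i))
    g x = x (suc zero) ◅ x zero + - (q * x (suc zero)) ◅ λ i → x (suc (suc i))
    lem₁ : ∀ q a b c d u → (q * a + b) * c + (a * d + u) ≡ a * (q * c + d) + (b * c + u)
    lem₁ = solve-∀
    lem₂ : ∀ q a b c d u → b * c + ((a + - (q * b)) * d + u) ≡ a * d + (b * (c + - (q * d)) + u)
    lem₂ = solve-∀
    lem₃ : ∀ q a b → q * a + (b + - (q * a)) ≡ b
    lem₃ = solve-∀
    lem₄ : ∀ q a b → q * a + b + - (q * a) ≡ b
    lem₄ = solve-∀

  NZ-image : ∀ {m n} (L : Lin m n) {x} → NZ (ap L x) → NZ x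
  NZ-image L {x} (i , q) with zero-or-NZ x
  ... | inj₂ nz = nz
  ... | inj₁ z = ⊥-elim (q (ap-0 L z i))

  NZ-GL : ∀ {k} (G : GL k) {x} → NZ x → NZ (ap (to G) x)
  NZ-GL G {x} (i , q) = NZ-image (from G) (i , λ z → q (trans (sym (from-to G x i)) z))

  euclid₂ : ∀ {k} (x : V (suc (suc k))) → (∀ i → x (suc (suc i)) ≡ + 0) →
    Acc ℕ._<_ ∣ x (suc zero) ∣ →
    Σ (GL (suc (suc k))) λ G → ∀ i → ap (to G) x (suc i) ≡ + 0
  euclid₂ x h _ with x (suc zero) ≟ + 0
  euclid₂ x h _ | yes p = idG , λ { zero → p ; (suc i) → h i }
  euclid₂ {k} x h (acc rs) | no ¬p =
    let (G , hG) = euclid₂ y h (rs smaller) in G ∘G invG (elemG q) , hG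
    where
    d = x (suc zero)
    instance
      nz : NonZero d
      nz = ≢-nonZero ¬p
    q = x zero DM./ d
    y : V (suc (suc k))
    y = ap (from (elemG q)) x
    lem : ∀ r s → r + s + - s ≡ r
    lem = solve-∀
    rem : y (suc zero) ≡ + (x zero DM.% d)
    rem = trans (cong (λ z → z + - (q * d)) (DM.a≡a%n+[a/n]*n (x zero) d)) (lem (+ (x zero DM.% d)) (q * d))
    smaller : ∣ y (suc zero) ∣ ℕ.< ∣ d ∣
    smaller = subst (λ z → ∣ z ∣ ℕ.< ∣ d ∣) (sym rem) (DM.n%d<d (x zero) d)

  -- Recursion first turns the tail into a multiple of its first basis vector, which leaves two
  -- coordinates for `euclid₂`.
  euclid : ∀ {k} (p : V (suc k)) → Σ (GL (suc k)) λ G → ∀ i → ap (to G) p (suc i) ≡ + 0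
  euclid {zero} p = idG , λ ()
  euclid {suc k} p =
    let (G , hG) = euclid (tail p)
        (H , hH) = euclid₂ (ap (to (blockG G)) p) hG (<-wellFounded _)
    in H ∘G blockG G , hH

  -- The column operations `to G ᵀ` bring the first row to the form (g, 0, ..., 0). Every vector
  -- with first coordinate 0 then satisfies the first equation, and one unknown and one equation
  -- have disappeared.
  kernel : ∀ {k} (L : Lin (suc k) k) → Σ (V (suc k)) λ p → NZ p × ap L p ≗ 0v
  kernel {zero} L = e zero , NZ-e zero , λ ()
  kernel {suc k} L =
    let (G , hG) = euclid (ap* L (e zero))
        U = to G ᵀ
        (p , nz , hp) = kernel (inclL ᵀ ∘L L ∘L U ∘L inclL)
        nz' = NZ-GL (transG G) {+ 0 ◅ p} (suc (proj₁ nz) , proj₂ nz)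
        row0 : ap L (ap U (+ 0 ◅ p)) zero ≡ + 0
        row0 = trans (ap-coord L _ zero) (trans (adj U (+ 0 ◅ p) (ap* L (e zero)))
                 (trans (+-identityˡ _) (∙-≗0ʳ p hG)))
    in ap U (+ 0 ◅ p) , nz' , λ { zero → row0 ; (suc i) → hp i }

  -- A substitute for Cramer's rule: a kernel vector of the k × (k + 1) matrix with columns t, S has
  -- first entry - s. If that entry is 0, the rest of the vector shows that S is singular.
  solve : ∀ {k} (S : Lin k k) (t : V k) →
    Σ (V k) λ p → Σ ℤ λ s → ((s ≢ + 0) ⊎ (s ≡ + 0 × NZ p)) × ap S p ≗ s ⊙ t
  solve S t with kernel (t ▹ S)
  ... | x , nz , hx with x zero ≟ + 0
  ...   | no ¬z = tail x , - x zero , inj₁ (λ z → ¬z (trans (sym (neg-involutive (x zero))) (cong -_ z))) ,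
                  λ i → trans (lem (ap S (tail x) i) (x zero) (t i)) (trans (cong (_+ (- x zero) * t i) (hx i)) (+-identityˡ _))
    where
    lem : ∀ a b c → a ≡ (b * c + a) + - b * c
    lem = solve-∀
  ...   | yes z = tail x , + 0 , inj₂ (refl , nz' nz) ,
                  λ i → trans (lem z i) (hx i)
    where
    nz' : NZ x → NZ (tail x)
    nz' (zero , q) = ⊥-elim (q z)
    nz' (suc i , q) = i , q
    lem : ∀ {a} → a ≡ + 0 → ∀ i → ap S (tail x) i ≡ a * t i + ap S (tail x) i
    lem refl i = sym (+-identityˡ _)

  HasKernel : ∀ {k n} → Lin k n → Set
  HasKernel {k} L = Σ (V k) λ p → NZ p × ap L p ≗ 0v

  -- A nonvanishing k × k minor in the rows R, expressed without determinants.
  InjectiveOnRows : ∀ {k n} → Lin k n → Set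
  InjectiveOnRows {k} {n} L =
    Σ (Fin k → Fin n) λ R → Injective _≡_ _≡_ R × (∀ p → (∀ i → ap L p (R i) ≡ + 0) → p ≗ 0v)

  -- Elimination row by row. A zero row is skipped; any other row is selected as a pivot, and
  -- elimination goes on among the vectors on which it vanishes.
  kernel? : ∀ {k n} (L : Lin k n) → HasKernel L ⊎ InjectiveOnRows L
  kernel? {zero} L = inj₂ ((λ ()) , (λ { {()} }) , λ _ _ ())
  kernel? {suc k} {zero} L = inj₁ (e zero , NZ-e zero , λ ())
  kernel? {suc k} {suc n} L with euclid (ap* L (e zero))
  ... | G , hG with ap (to G) (ap* L (e zero)) zero ≟ + 0
  ...   | yes z = skip (kernel? (inclL ᵀ ∘L L))
    where
    row : ap* L (e zero) ≗ 0v
    row i = trans (sym (from-to G _ i)) (ap-0 (from G) (λ { zero → z ; (suc i) → hG i }) i)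
    skip : HasKernel (inclL ᵀ ∘L L) ⊎ InjectiveOnRows (inclL ᵀ ∘L L) → HasKernel L ⊎ InjectiveOnRows L
    skip (inj₁ (p , nz , hp)) = inj₁ (p , nz , λ
      { zero → trans (ap-coord L p zero) (∙-≗0ʳ p row) ; (suc i) → hp i })
    skip (inj₂ (R , inj , h)) = inj₂ ((λ i → suc (R i)) , (λ {_} {_} q → inj (Fin-suc-injective q)) , h)
  ...   | no g≢0 = pivot (kernel? L')
    where
    U = to G ᵀ
    L' = inclL ᵀ ∘L L ∘L U ∘L inclL
    g = ap (to G) (ap* L (e zero)) zero
    row0 : ∀ x → ap L (ap U x) zero ≡ x zero * g
    row0 x = trans (ap-coord L _ zero) (trans (adj U x _)
               (trans (+-congˡ (x zero * g) (∙-≗0ʳ (tail x) hG)) (+-identityʳ _)))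
    pivot : HasKernel L' ⊎ InjectiveOnRows L' → HasKernel L ⊎ InjectiveOnRows L
    pivot (inj₁ (p , nz , hp)) = inj₁ (ap U (+ 0 ◅ p) , NZ-GL (transG G) (suc (proj₁ nz) , proj₂ nz) ,
      λ { zero → row0 (+ 0 ◅ p) ; (suc i) → hp i })
    pivot (inj₂ (R , inj , h)) = inj₂ (R' , inj' , h')
      where
      R' : Fin (suc k) → Fin (suc n)
      R' zero = zero
      R' (suc i) = suc (R i)
      inj' : Injective _≡_ _≡_ R'
      inj' {zero} {zero} _ = refl
      inj' {suc i} {suc j} q = cong suc (inj (Fin-suc-injective q))
      h' : ∀ p → (∀ i → ap L p (R' i) ≡ + 0) → p ≗ 0v
      h' p hp i = trans (sym (to-from (transG G) p i)) (ap-0 U x≗0 i)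
        where
        x = ap* (from G) p
        back : ap L (ap U x) ≗ ap L p
        back = ap-cong L (to-from (transG G) p)
        x0 : x zero ≡ + 0
        x0 with i*j≡0⇒i≡0∨j≡0 (x zero) (trans (sym (row0 x)) (trans (back zero) (hp zero)))
        ... | inj₁ q = q
        ... | inj₂ q = ⊥-elim (g≢0 q)
        x≗ : (+ 0 ◅ tail x) ≗ x
        x≗ zero = sym x0
        x≗ (suc i) = refl
        xt = h (tail x) (λ i → trans (ap-cong L (ap-cong U x≗) (suc (R i)))
                                 (trans (back (suc (R i))) (hp (suc i))))
        x≗0 : x ≗ 0v
        x≗0 zero = x0
        x≗0 (suc i) = xt i

  -- Hermite reduction

  0≤sq : ∀ a → + 0 ≤ a * a
  0≤sq (+ n) = subst (+ 0 ≤_) (pos-* n n) (+≤+ ℕ.z≤n)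
  0≤sq -[1+ n ] = +≤+ ℕ.z≤n

  *-mono-nonNeg : ∀ {a b c} → + 0 ≤ a → b ≤ c → a * b ≤ a * c
  *-mono-nonNeg {a} h = *-monoˡ-≤-nonNeg a {{nonNegative h}}

  *-cancel-pos : ∀ {a b c} → + 0 < a → a * b ≤ a * c → b ≤ c
  *-cancel-pos {a} {b} {c} h = *-cancelˡ-≤-pos b c a {{positive h}}

  0≤* : ∀ {a b} → + 0 ≤ a → + 0 ≤ b → + 0 ≤ a * b
  0≤* {a} {b} h k = subst (_≤ a * b) (*-zeroʳ a) (*-mono-nonNeg h k)

  0≤+ : ∀ {a b} → + 0 ≤ a → + 0 ≤ b → + 0 ≤ a + b
  0≤+ = +-mono-≤

  ≤-diff : ∀ {x y} d → + 0 ≤ d → y ≡ x + d → x ≤ y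
  ≤-diff {x} {y} d h eq = subst₂ _≤_ (+-identityʳ x) (sym eq) (+-monoʳ-≤ x h)

  diff-≥0 : ∀ {x y} → x ≤ y → + 0 ≤ y + - x
  diff-≥0 {x} {y} h = i≤j⇒0≤j-i h

  0≤∙ : ∀ {n} (x : V n) → + 0 ≤ x ∙ x
  0≤∙ {zero} x = ≤-refl
  0≤∙ {suc n} x = 0≤+ (0≤sq (x zero)) (0≤∙ (tail x))

  sq≡0 : ∀ a → a * a ≡ + 0 → a ≡ + 0
  sq≡0 a h with i*j≡0⇒i≡0∨j≡0 a h
  ... | inj₁ p = p
  ... | inj₂ p = p

  sum≡0 : ∀ {a b} → + 0 ≤ a → + 0 ≤ b → a + b ≡ + 0 → a ≡ + 0 × b ≡ + 0
  sum≡0 {+ a} {+ b} _ _ h =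
    cong +_ (ℕP.m+n≡0⇒m≡0 a (+-injective h)) , cong +_ (ℕP.m+n≡0⇒n≡0 a (+-injective h))

  ∙≡0 : ∀ {n} (x : V n) → x ∙ x ≡ + 0 → x ≗ 0v
  ∙≡0 {suc n} x h zero = sq≡0 _ (proj₁ (sum≡0 (0≤sq (x zero)) (0≤∙ (tail x)) h))
  ∙≡0 {suc n} x h (suc i) = ∙≡0 (tail x) (proj₂ (sum≡0 (0≤sq (x zero)) (0≤∙ (tail x)) h)) i

  ∙-bilin : ∀ {n} a b (x y : V n) →
    (a ⊙ x ⊕ b ⊙ y) ∙ (a ⊙ x ⊕ b ⊙ y) ≡ a * a * (x ∙ x) + + 2 * (a * b * (x ∙ y)) + b * b * (y ∙ y)
  ∙-bilin a b x y = begin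
    z ∙ z                                   ≡⟨ ∙-⊕ˡ (a ⊙ x) (b ⊙ y) z ⟩
    (a ⊙ x) ∙ z + (b ⊙ y) ∙ z               ≡⟨ cong₂ _+_ (one a x) (one b y) ⟩
    a * (a * (x ∙ x) + b * (x ∙ y)) + b * (a * (y ∙ x) + b * (y ∙ y))
                                            ≡⟨ cong (λ s → a * (a * (x ∙ x) + b * (x ∙ y)) + b * (a * s + b * (y ∙ y))) (∙-comm y x) ⟩
    a * (a * (x ∙ x) + b * (x ∙ y)) + b * (a * (x ∙ y) + b * (y ∙ y)) ≡⟨ lem a b (x ∙ x) (x ∙ y) (y ∙ y) ⟩
    _ ∎
    where
    open ≡-Reasoning
    z = a ⊙ x ⊕ b ⊙ y
    one : ∀ c w → (c ⊙ w) ∙ z ≡ c * (a * (w ∙ x) + b * (w ∙ y))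
    one c w = trans (∙-⊙ˡ c w z) (cong (c *_)
      (trans (∙-⊕ʳ w (a ⊙ x) (b ⊙ y)) (cong₂ _+_ (∙-⊙ʳ a w x) (∙-⊙ʳ b w y))))
    lem : ∀ a b X S Y → a * (a * X + b * S) + b * (a * S + b * Y) ≡ a * a * X + + 2 * (a * b * S) + b * b * Y
    lem = solve-∀

  ∙-lin : ∀ {n} (w : V n) a b (x y : V n) → w ∙ (a ⊙ x ⊕ b ⊙ y) ≡ a * (w ∙ x) + b * (w ∙ y)
  ∙-lin w a b x y = trans (∙-⊕ʳ w (a ⊙ x) (b ⊙ y)) (cong₂ _+_ (∙-⊙ʳ a w x) (∙-⊙ʳ b w y))

  -- (u ∙ u) times the projection to the orthogonal complement of u.
  projL : ∀ {n} → V n → Lin n n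
  projL u = record { ap = f ; ap* = f ; adj = adj' }
    where
    f : V _ → V _
    f z = (u ∙ u) ⊙ z ⊕ (- (u ∙ z)) ⊙ u
    lem : ∀ E s t p → E * p + - t * s ≡ E * p + - s * t
    lem = solve-∀
    adj' : ∀ x y → f x ∙ y ≡ x ∙ f y
    adj' x y = begin
      f x ∙ y  ≡⟨ ∙-comm (f x) y ⟩
      y ∙ f x  ≡⟨ ∙-lin y (u ∙ u) (- (u ∙ x)) x u ⟩
      (u ∙ u) * (y ∙ x) + - (u ∙ x) * (y ∙ u)
        ≡⟨ cong₂ (λ p s → (u ∙ u) * p + - (u ∙ x) * s) (∙-comm y x) (∙-comm y u) ⟩
      (u ∙ u) * (x ∙ y) + - (u ∙ x) * (u ∙ y) ≡⟨ lem (u ∙ u) (u ∙ y) (u ∙ x) (x ∙ y) ⟩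
      (u ∙ u) * (x ∙ y) + - (u ∙ y) * (u ∙ x) ≡⟨ cong (λ s → (u ∙ u) * (x ∙ y) + - (u ∙ y) * s) (∙-comm u x) ⟩
      (u ∙ u) * (x ∙ y) + - (u ∙ y) * (x ∙ u) ≡⟨ ∙-lin x (u ∙ u) (- (u ∙ y)) y u ⟨
      x ∙ f y  ∎
      where open ≡-Reasoning

  -- The Gram determinant of u and z: |u|² times the squared distance from z to the line of u. Hence
  -- adding a multiple of u to z does not change it.
  gram : ∀ {n} → V n → V n → ℤ
  gram u z = (u ∙ u) * (z ∙ z) + - ((u ∙ z) * (u ∙ z))

  projL-norm : ∀ {n} (u z : V n) → ap (projL u) z ∙ ap (projL u) z ≡ (u ∙ u) * gram u z
  projL-norm u z = trans (∙-bilin (u ∙ u) (- (u ∙ z)) z u)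
    (trans (cong (λ s → (u ∙ u) * (u ∙ u) * (z ∙ z) + + 2 * ((u ∙ u) * - (u ∙ z) * s) + - (u ∙ z) * - (u ∙ z) * (u ∙ u)) (∙-comm z u))
           (lem (u ∙ u) (u ∙ z) (z ∙ z)))
    where
    lem : ∀ E s Z → E * E * Z + + 2 * (E * - s * s) + - s * - s * E ≡ E * (E * Z + - (s * s))
    lem = solve-∀

  gram-shift : ∀ {n} (u z : V n) c → gram u (c ⊙ u ⊕ + 1 ⊙ z) ≡ gram u z
  gram-shift u z c = trans
    (cong₂ (λ p s → (u ∙ u) * p + - (s * s)) (∙-bilin c (+ 1) u z) (∙-lin u c (+ 1) u z))
    (lem (u ∙ u) (u ∙ z) (z ∙ z) c)
    where
    lem : ∀ E s Z c → E * (c * c * E + + 2 * (c * + 1 * s) + + 1 * + 1 * Z) + - ((c * E + + 1 * s) * (c * E + + 1 * s)) ≡ E * Z + - (s * s)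
    lem = solve-∀

  gram-cong : ∀ {n} (u : V n) {z z'} → z ≗ z' → gram u z ≡ gram u z'
  gram-cong u h = cong₂ (λ p s → (u ∙ u) * p + - (s * s)) (∙-cong h h) (∙-congˡ u h)

  0<-of : ∀ {a} → + 0 ≤ a → a ≢ + 0 → + 0 < a
  0<-of h ne = ≤∧≢⇒< h (λ q → ne (sym q))

  cauchy-schwarz : ∀ {n} (x y : V n) → (x ∙ y) * (x ∙ y) ≤ (x ∙ x) * (y ∙ y)
  cauchy-schwarz x y with x ∙ x ≟ + 0
  ... | yes z = ≤-reflexive (trans (cong (λ s → s * s) xy≡0) (sym (trans (cong (_* (y ∙ y)) z) (*-zeroˡ (y ∙ y)))))
    where
    xy≡0 : x ∙ y ≡ + 0
    xy≡0 = trans (∙-comm x y) (∙-≗0ʳ y (∙≡0 x z))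
  ... | no nz = 0≤i-j⇒j≤i (*-cancel-pos {x ∙ x} (0<-of (0≤∙ x) nz)
      (subst₂ _≤_ (sym (*-zeroʳ (x ∙ x))) (projL-norm x y) (0≤∙ (ap (projL x) y))))

  ap-∷ : ∀ {k n} (B : Lin (suc k) n) c z → ap B (c ◅ z) ≗ c ⊙ ap B (e zero) ⊕ + 1 ⊙ ap B (+ 0 ◅ z)
  ap-∷ B c z i = begin
    ap B (c ◅ z) i ≡⟨ ap-cong B split i ⟩
    ap B (c ⊙ e zero ⊕ (+ 1 ⊙ (+ 0 ◅ z))) i ≡⟨ ap-⊕ B (c ⊙ e zero) (+ 1 ⊙ (+ 0 ◅ z)) i ⟩
    ap B (c ⊙ e zero) i + ap B (+ 1 ⊙ (+ 0 ◅ z)) i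
      ≡⟨ cong₂ _+_ (ap-⊙ B c (e zero) i) (ap-⊙ B (+ 1) (+ 0 ◅ z) i) ⟩
    _ ∎
    where
    open ≡-Reasoning
    lem₀ : ∀ c → c ≡ c * + 1 + + 0
    lem₀ = solve-∀
    lem₁ : ∀ c d → d ≡ c * + 0 + + 1 * d
    lem₁ = solve-∀
    split : (c ◅ z) ≗ c ⊙ e zero ⊕ (+ 1 ⊙ (+ 0 ◅ z))
    split zero = lem₀ c
    split (suc j) = lem₁ c (z j)

  -- Rounding - t / E to a nearest integer q: the residue E q + t is r or - (E - r), whichever is
  -- shorter. The stated bound is weaker than |E q + t| ≤ E / 2, but it already gives the factor 2
  -- in `HermiteStep`.
  round : ∀ E t → + 0 < E → ∃ λ q → + 2 * ((E * q + t) * (E * q + t)) ≤ E * E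
  round (+ N) t 0<E = go (2 ℕ.* r ℕP.≤? N)
    where
    instance
      nz : NonZero (+ N)
      nz = ≢-nonZero λ z → <⇒≢ 0<E (sym z)
    r = t DM.% (+ N)
    d = t DM./ (+ N)
    r<N : r ℕ.< N
    r<N = DM.n%d<d t (+ N)
    t≡ : t ≡ + r + d * + N
    t≡ = DM.a≡a%n+[a/n]*n t (+ N)
    lem₁ : ∀ E r d → E * - d + (r + d * E) ≡ r
    lem₁ = solve-∀
    lem₂ : ∀ s r d → (r + s) * (- d + - (+ 1)) + (r + d * (r + s)) ≡ - s
    lem₂ = solve-∀
    lem₃ : ∀ s → - s * - s ≡ s * s
    lem₃ = solve-∀
    bound : ∀ s → 2 ℕ.* s ℕ.≤ N → + 2 * (+ s * + s) ≤ + N * + N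
    bound s h = subst₂ _≤_ (trans (pos-* 2 (s ℕ.* s)) (cong (+ 2 *_) (pos-* s s))) (pos-* N N)
      (+≤+ (begin
        2 ℕ.* (s ℕ.* s)  ≡⟨ ℕP.*-assoc 2 s s ⟨
        2 ℕ.* s ℕ.* s    ≤⟨ ℕP.*-mono-≤ h (ℕP.≤-trans (ℕP.m≤m+n s _) h) ⟩
        N ℕ.* N          ∎))
      where open ℕP.≤-Reasoning
    go : _ → _
    go (yes p) = - d , subst (λ z → + 2 * (z * z) ≤ + N * + N)
      (sym (trans (+-congˡ (+ N * - d) t≡) (lem₁ (+ N) (+ r) d))) (bound r p)
    go (no ¬p) = (- d + - (+ 1)) , subst (λ z → + 2 * z ≤ + N * + N)
      (sym (trans (cong (λ z → z * z) eq) (lem₃ (+ s)))) (bound s 2s≤N)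
      where
      s = N ℕ.∸ r
      N≡ : N ≡ r ℕ.+ s
      N≡ = sym (ℕP.m+[n∸m]≡n (ℕP.<⇒≤ r<N))
      E≡ : + N ≡ + r + + s
      E≡ = trans (cong +_ N≡) (pos-+ r s)
      eq : + N * (- d + - (+ 1)) + t ≡ - + s
      eq = trans (+-congˡ (+ N * (- d + - (+ 1))) t≡) (trans (cong (λ z → z * (- d + - (+ 1)) + (+ r + d * z)) E≡) (lem₂ (+ s) (+ r) d))
      2s≤N : 2 ℕ.* s ℕ.≤ N
      2s≤N = ℕP.+-cancelˡ-≤ (2 ℕ.* r) _ _ (begin
        2 ℕ.* r ℕ.+ 2 ℕ.* s  ≡⟨ ℕP.*-distribˡ-+ 2 r s ⟨
        2 ℕ.* (r ℕ.+ s)      ≡⟨ cong (2 ℕ.*_) N≡ ⟨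
        2 ℕ.* N              ≡⟨ cong (N ℕ.+_) (ℕP.+-identityʳ N) ⟩
        N ℕ.+ N              ≤⟨ ℕP.+-monoˡ-≤ N (ℕP.<⇒≤ (ℕP.≰⇒> ¬p)) ⟩
        2 ℕ.* r ℕ.+ N        ∎)
        where open ℕP.≤-Reasoning

  sqn : ∀ {n} → V n → ℤ
  sqn x = x ∙ x

  -- Geometrically, the length of the first basis vector is at most √C times its distance from the
  -- span of the others. What matters is that C will depend only on the number of vectors.
  Reduced : ∀ {k n} → ℕ → Lin (suc k) n → Set
  Reduced C B = ∀ x → x zero * x zero * sqn (ap B (e zero)) ≤ + C * sqn (ap B x)

  -- Let u be the first basis vector. The others are projected orthogonally to u, scaled by |u|² to
  -- stay integral, and the projections are reduced by `ih`. The first reduced projection is lifted,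
  -- and a multiple q u is added to make its component along u at most |u| / √2. Either this lift is
  -- no shorter than u, and then it is a reduced first vector, or it is shorter and takes the place
  -- of u.
  module HermiteStep {k n : ℕ} (C : ℕ)
    (ih : (B : Lin (suc k) n) → Σ (GL (suc k)) λ G → Reduced C (B ∘L to G)) where

    -- `elemG (+ 0)` exchanges the first two coordinates: the zero vector goes to second place, and
    -- the first vector of the reduced remaining basis leads. The factor 2 is there to match the
    -- general case.
    zero-case : (B : Lin (suc (suc k)) n) → ap B (e zero) ≗ 0v →
      Σ (GL (suc (suc k))) λ G → Reduced (2 ℕ.* C) (B ∘L to G)
    zero-case B z = let (G' , red) = ih (B ∘L inclL) in blockG G' ∘G elemG (+ 0) , λ x →
      let y = ap (to (elemG (+ 0))) x
          val : ∀ x → ap B (ap (to (blockG G')) (ap (to (elemG (+ 0))) x))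
                      ≗ ap (B ∘L inclL ∘L to G') (tail (ap (to (elemG (+ 0))) x))
          val x i = trans (ap-∷ B _ _ i) (cancel (ap (to (elemG (+ 0))) x zero) (z i))
          e≗ : tail (ap (to (elemG (+ 0))) (e zero)) ≗ e zero
          e≗ = λ { zero → refl ; (suc i) → refl }
          val₀ : ap B (ap (to (blockG G')) (ap (to (elemG (+ 0))) (e zero))) ≗ ap (B ∘L inclL ∘L to G') (e zero)
          val₀ i = trans (val (e zero) i) (ap-cong (B ∘L inclL ∘L to G') e≗ i)
          r = red (tail y)
      in subst₂ _≤_ (cong (x zero * x zero *_) (sym (∙-cong val₀ val₀)))
                    (cong (+ (2 ℕ.* C) *_) (sym (∙-cong (val x) (val x))))
                    (≤-trans r (double (sqn (ap (B ∘L inclL ∘L to G') (tail y))) (0≤∙ (ap (B ∘L inclL ∘L to G') (tail y)))))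
      where
      cancel : ∀ c {a b} → a ≡ + 0 → c * a + + 1 * b ≡ b
      cancel c {b = b} refl = lem c b
        where
        lem : ∀ c b → c * + 0 + + 1 * b ≡ b
        lem = solve-∀
      double : ∀ s → + 0 ≤ s → + C * s ≤ + (2 ℕ.* C) * s
      double s h = *-monoʳ-≤-nonNeg s {{nonNegative h}} (+≤+ (ℕP.m≤m+n C _))

    -- Replace the first basis vector by a shorter one as long as the induction hypothesis supplies one.
    descend : (B : Lin (suc (suc k)) n) → Acc ℕ._<_ ∣ sqn (ap B (e zero)) ∣ →
      Σ (GL (suc (suc k))) λ G → Reduced (2 ℕ.* C) (B ∘L to G)
    descend B _ with sqn (ap B (e zero)) ≟ + 0
    descend B _ | yes z = zero-case B (∙≡0 _ z)
    descend B (acc rs) | no nz = go (E ≤? F)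
      where
      u = ap B (e zero)
      E = sqn u
      0<E = 0<-of (0≤∙ u) nz
      IH = ih (projL u ∘L B ∘L inclL)
      G' = proj₁ IH
      f = ap B (ap (to (blockG G')) (e (suc zero)))
      rnd = round E (u ∙ f) 0<E
      q = proj₁ rnd
      G₂ = blockG G' ∘G elemG q
      B₂ = B ∘L to G₂
      F = sqn (ap B₂ (e zero))
      sh : V (suc (suc k)) → V (suc k)
      sh x = tail (ap (to (elemG q)) x)
      val : ∀ x → ap B₂ x ≗ (q * x zero + x (suc zero)) ⊙ u ⊕ + 1 ⊙ ap (B ∘L inclL ∘L to G') (sh x)
      val x = ap-∷ B _ _
      norm : ∀ x → sqn (ap (projL u ∘L B ∘L inclL ∘L to G') (sh x)) ≡ E * gram u (ap B₂ x)
      norm x = trans (projL-norm u (ap (B ∘L inclL ∘L to G') (sh x)))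
        (cong (E *_) (sym (trans (gram-cong u (val x)) (gram-shift u (ap (B ∘L inclL ∘L to G') (sh x)) (q * x zero + x (suc zero))))))
      norm₀ : sqn (ap (projL u ∘L B ∘L inclL ∘L to G') (e zero)) ≡ E * gram u (ap B₂ (e zero))
      norm₀ = trans (∙-cong h h) (norm (e zero))
        where
        h : ap (projL u ∘L B ∘L inclL ∘L to G') (e zero) ≗ ap (projL u ∘L B ∘L inclL ∘L to G') (sh (e zero))
        h = ap-cong (projL u ∘L B ∘L inclL ∘L to G') λ { zero → refl ; (suc i) → refl }
      uF : u ∙ ap B₂ (e zero) ≡ E * q + u ∙ f
      uF = trans (∙-congˡ u (λ i → trans (val (e zero) i) (cong₂ _+_ (cong (_* u i) (q1 q)) (trans (*-identityˡ _) (ap-cong B fe i))))) (trans (∙-⊕ʳ u (q ⊙ u) f)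
             (cong (_+ u ∙ f) (trans (∙-⊙ʳ q u u) (*-comm q E))))
        where
        q1 : ∀ q → q * + 1 + + 0 ≡ q
        q1 = solve-∀
        fe : (+ 0 ◅ ap (to G') (sh (e zero))) ≗ ap (to (blockG G')) (e (suc zero))
        fe zero = refl
        fe (suc i) = ap-cong (to G') (λ { zero → refl ; (suc j) → refl }) i
      h = u ∙ ap B₂ (e zero)
      small : + 2 * (h * h) ≤ E * E
      small = subst (λ z → + 2 * (z * z) ≤ E * E) (sym uF) (proj₂ rnd)
      go : _ → _
      go (no ¬p) = let (G , red) = descend B₂ (rs (drop‿+<+ (subst₂ _<_ (abs (0≤∙ (ap B₂ (e zero)))) (abs (0≤∙ u)) (≰⇒> ¬p)))) in G₂ ∘G G , red
        where
        abs : ∀ {a} → + 0 ≤ a → a ≡ + ∣ a ∣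
        abs h = sym (0≤i⇒+∣i∣≡i h)
      -- E ≤ F and 2 h² ≤ E² give E F - h² ≥ E F / 2: the lift is at most √2 times as long as its
      -- projection, whence the factor 2. The inequality is proved after multiplication by E², since
      -- `projL` carries a factor E.
      go (yes p) = G₂ , λ x → *-cancel-pos (subst (_< E * E) (*-zeroʳ E) (*-monoˡ-<-pos E {{positive 0<E}} 0<E)) (main x)
        where
        main : ∀ x → E * E * (x zero * x zero * F) ≤ E * E * (+ (2 ℕ.* C) * sqn (ap B₂ x))
        main x = begin
          E * E * (a * F) ≤⟨ ≤-diff (a * (E * ((E * F + - (E * E)) + (E * E + - (+ 2 * (h * h))))))
               (0≤* (0≤sq (x zero)) (0≤* (<⇒≤ 0<E) (0≤+ (diff-≥0 (*-mono-nonNeg (<⇒≤ 0<E) p)) (diff-≥0 small)))) (lem₁ E F a h) ⟩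
          + 2 * (a * (E * gram u (ap B₂ (e zero))))
            ≤⟨ *-mono-nonNeg {+ 2} (+≤+ ℕ.z≤n) (subst₂ _≤_ (cong (a *_) norm₀) (cong (+ C *_) (norm x)) (proj₂ IH (sh x))) ⟩
          + 2 * (+ C * (E * gram u (ap B₂ x)))
            ≤⟨ ≤-diff (+ 2 * (+ C * (E * (m * m)))) (0≤* {+ 2} (+≤+ ℕ.z≤n) (0≤* {+ C} (+≤+ ℕ.z≤n) (0≤* (<⇒≤ 0<E) (0≤sq m)))) (lem₂ E (sqn (ap B₂ x)) (+ C) m) ⟩
          E * E * (+ 2 * + C * sqn (ap B₂ x)) ≡⟨ cong (λ c → E * E * (c * sqn (ap B₂ x))) (sym (pos-* 2 C)) ⟩
          E * E * (+ (2 ℕ.* C) * sqn (ap B₂ x)) ∎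
          where
          open ≤-Reasoning
          a = x zero * x zero
          m = u ∙ ap B₂ x
          lem₁ : ∀ E F a h → + 2 * (a * (E * (E * F + - (h * h)))) ≡ E * E * (a * F) + a * (E * ((E * F + - (E * E)) + (E * E + - (+ 2 * (h * h)))))
          lem₁ = solve-∀
          lem₂ : ∀ E G C m → E * E * (+ 2 * C * G) ≡ + 2 * (C * (E * (E * G + - (m * m)))) + + 2 * (C * (E * (m * m)))
          lem₂ = solve-∀

  hermite : ∀ k {n} (B : Lin (suc k) n) → Σ (GL (suc k)) λ G → Reduced (2 ℕ.^ k) (B ∘L to G)
  hermite zero B = idG , λ x → ≤-reflexive (sym (trans (*-identityˡ (sqn (ap B x))) (trans (∙-cong (val x) (val x)) (fin x))))
    where
    val : ∀ x → ap B x ≗ x zero ⊙ ap B (e zero)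
    val x i = trans (ap-cong B (λ { zero → sym (*-identityʳ (x zero)) }) i) (ap-⊙ B (x zero) (e zero) i)
    fin : ∀ x → (x zero ⊙ ap B (e zero)) ∙ (x zero ⊙ ap B (e zero)) ≡ x zero * x zero * sqn (ap B (e zero))
    fin x = let w = ap B (e zero) in trans (∙-⊙ˡ (x zero) w (x zero ⊙ w))
      (trans (cong (x zero *_) (∙-⊙ʳ (x zero) w w)) (sym (*-assoc (x zero) (x zero) (w ∙ w))))
  hermite (suc k) B = HermiteStep.descend (2 ℕ.^ k) (hermite k) B (<-wellFounded _)

  -- Decomposition of alternating forms into wedges

  Alt : ∀ {k} → Lin k k → Set
  Alt a = ∀ x y → x ∙ ap a y ≡ - (y ∙ ap a x)

  conj : ∀ {k n} → Lin k n → Lin k k → Lin n n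
  conj B a = B ∘L a ∘L B ᵀ

  Alt-conj : ∀ {k n} (B : Lin k n) (a : Lin k k) → Alt a → Alt (conj B a)
  Alt-conj B a alt x y = begin
    x ∙ ap B (ap a (ap* B y))      ≡⟨ adj (B ᵀ) x _ ⟨
    ap* B x ∙ ap a (ap* B y)       ≡⟨ alt (ap* B x) (ap* B y) ⟩
    - (ap* B y ∙ ap a (ap* B x))   ≡⟨ cong -_ (adj (B ᵀ) y _) ⟩
    - (y ∙ ap B (ap a (ap* B x)))  ∎
    where open ≡-Reasoning

  self-neg : ∀ a → a ≡ - a → a ≡ + 0
  self-neg (+ zero) _ = refl
  self-neg (+ suc n) ()
  self-neg -[1+ n ] ()

  Alt-diag : ∀ {k} (a : Lin k k) → Alt a → ∀ x → x ∙ ap a x ≡ + 0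
  Alt-diag a alt x = self-neg _ (alt x x)

  Alt-coord : ∀ {k} (a : Lin (suc k) (suc k)) → Alt a → ∀ x → ap a x zero ≡ - (x ∙ ap a (e zero))
  Alt-coord a alt x = trans (sym (∙-e (ap a x) zero)) (trans (∙-comm (ap a x) (e zero)) (alt (e zero) x))

  η-∷ : ∀ {k} (x : V (suc k)) → x ≗ (x zero ◅ tail x)
  η-∷ x zero = refl
  η-∷ x (suc i) = refl

  -- The column of e₀ vanishes by hypothesis and its row by antisymmetry, so the form lives on the
  -- other coordinates.
  dropFirst : ∀ {k} (a : Lin (suc k) (suc k)) → Alt a → ap a (e zero) ≗ 0v →
    ∀ x → ap a x ≗ ap (conj inclL (conj (inclL ᵀ) a)) x
  dropFirst a alt z x i = trans (same i) (first i)
    where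
    y = ap a (+ 0 ◅ tail x)
    lem : ∀ c b {s} → s ≡ + 0 → c * s + + 1 * b ≡ b
    lem c b refl = l c b
      where
      l : ∀ c b → c * + 0 + + 1 * b ≡ b
      l = solve-∀
    same : ap a x ≗ y
    same i = trans (ap-cong a (η-∷ x) i) (trans (ap-∷ a (x zero) (tail x) i) (lem (x zero) (y i) (z i)))
    first : y ≗ (+ 0 ◅ tail y)
    first zero = trans (Alt-coord a alt (+ 0 ◅ tail x)) (cong -_ (∙-≗0ʳ (+ 0 ◅ tail x) z))
    first (suc i) = refl

  conj-GL : ∀ {k} (G : GL k) (a : Lin k k) → ∀ x → ap (conj (to G) (conj (from G) a)) x ≗ ap a x
  conj-GL G a x i = trans (to-from G _ i) (ap-cong a (from-to (transG G) x) i)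

  -- Quotient by the saturation of a radical vector.
  dropKernel : ∀ {k} (a : Lin (suc k) (suc k)) → Alt a → HasKernel a →
    Σ (Lin k (suc k)) λ P → Σ (Lin (suc k) k) λ R →
      (∀ x → ap R (ap P x) ≗ x) × (∀ x → ap a x ≗ ap (conj P (conj R a)) x)
  dropKernel {k} a alt (p , nz , ap≡0) with euclid p
  ... | G , hG = to H ∘L inclL , inclL ᵀ ∘L from H ,
      (λ x i → from-to H (+ 0 ◅ x) (suc i)) ,
      λ x i → trans (sym (conj-GL H a x i)) (ap-cong (to H) (dropFirst a' alt' a'e0 (ap (to G) x)) i)
    where
    H = transG G
    a' = conj (from H) a
    alt' = Alt-conj (from H) a alt
    g = ap (to G) p zero
    Gp : ap (to G) p ≗ g ⊙ e zero
    Gp zero = sym (*-identityʳ g)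
    Gp (suc i) = trans (hG i) (sym (*-zeroʳ g))
    g≢0 : g ≢ + 0
    g≢0 z = let (i , q) = NZ-GL G nz in q (trans (Gp i) (trans (cong (_* e zero i) z) (*-zeroˡ (e zero i))))
    a'Gp : ap a' (ap (to G) p) ≗ 0v
    a'Gp = ap-0 (from H) (λ i → trans (ap-cong a (from-to G p) i) (ap≡0 i))
    a'e0 : ap a' (e zero) ≗ 0v
    a'e0 i with i*j≡0⇒i≡0∨j≡0 g (trans (sym (ap-⊙ a' g (e zero) i)) (trans (sym (ap-cong a' Gp i)) (a'Gp i)))
    ... | inj₁ q = ⊥-elim (g≢0 q)
    ... | inj₂ q = q

  dbl : ℕ → ℕ
  dbl zero = zero
  dbl (suc m) = suc (suc (dbl m))

  zeroL : ∀ {n} → Lin 0 n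
  zeroL = record { ap = λ _ → 0v ; ap* = λ _ () ; adj = λ x y → trans (∙-comm 0v y) (∙-0ʳ y) }

  Pair : ℕ → Set
  Pair n = V n × V n

  pairsL : ∀ {n m} → Vec (Pair n) m → Lin (dbl m) n
  pairsL [] = zeroL
  pairsL ((u , v) ∷ ws) = u ▹ v ▹ pairsL ws

  -- The standard symplectic matrix with m diagonal blocks (0 1; -1 0); with it, `wedges` is the sum
  -- of the u vᵀ - v uᵀ.
  JL : ∀ {m} → Lin (dbl m) (dbl m)
  JL {zero} = idL
  JL {suc m} = record
    { ap = λ x → x (suc zero) ◅ - x zero ◅ ap (JL {m}) (λ i → x (suc (suc i)))
    ; ap* = λ y → - y (suc zero) ◅ y zero ◅ ap* (JL {m}) (λ i → y (suc (suc i)))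
    ; adj = λ x y → trans (cong (λ z → x (suc zero) * y zero + (- x zero * y (suc zero) + z)) (adj (JL {m}) _ (λ i → y (suc (suc i)))))
                      (lem (x zero) (x (suc zero)) (y zero) (y (suc zero)) _) }
    where
    lem : ∀ a b c d u → b * c + (- a * d + u) ≡ a * - d + (b * c + u)
    lem = solve-∀

  wedges : ∀ {n m} → Vec (Pair n) m → Lin n n
  wedges ws = conj (pairsL ws) JL

  -- A bound on the squared operator norm. It can be applied at any vector, such as u in
  -- `split-small`, and mentions no factorisation of the map.
  OpBound : ∀ {m n} → ℕ → Lin m n → Set
  OpBound N L = ∀ y → sqn (ap L y) ≤ + N * sqn y

  Small : ∀ {n} → ℕ → Pair n → Set
  Small M (u , v) = sqn u * sqn v ≤ + M

  WedgeSum : ∀ {n} → ℕ → ℕ → Lin n n → Set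
  WedgeSum {n} m M L = Σ (Vec (Pair n) m) λ ws → All (Small M) ws × (∀ y → ap L y ≗ ap (wedges ws) y)

  WedgeSum-resp : ∀ {n m M} (L L' : Lin n n) → (∀ y → ap L y ≗ ap L' y) → WedgeSum m M L' → WedgeSum m M L
  WedgeSum-resp L L' h (ws , small , eq) = ws , small , λ y i → trans (h y i) (eq y i)

  Small-mono : ∀ {n M M'} → M ℕ.≤ M' → {p : Pair n} → Small M p → Small M' p
  Small-mono h s = ≤-trans s (+≤+ h)

  WedgeSum-mono : ∀ {n m M M'} (L : Lin n n) → M ℕ.≤ M' → WedgeSum m M L → WedgeSum m M' L
  WedgeSum-mono L h (ws , small , eq) = ws , All.map (λ {p} → Small-mono h {p}) small , eq

  zeroWedges : ∀ {n} m → Vec (Pair n) m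
  zeroWedges m = replicate m (0v , 0v)

  zeroWedges-small : ∀ {n} m M → All (Small {n} M) (zeroWedges m)
  zeroWedges-small zero M = []
  zeroWedges-small {n} (suc m) M =
    subst (λ z → z * z ≤ + M) (sym (∙-0ʳ {n} 0v)) (+≤+ ℕ.z≤n) ∷ zeroWedges-small m M

  zeroWedges-pairs : ∀ {n} m x → ap (pairsL (zeroWedges {n} m)) x ≗ 0v
  zeroWedges-pairs zero x i = refl
  zeroWedges-pairs (suc m) x i = trans
    (cong (λ z → x zero * + 0 + (x (suc zero) * + 0 + z)) (zeroWedges-pairs m _ i)) (lem (x zero) (x (suc zero)))
    where
    lem : ∀ a b → a * + 0 + (b * + 0 + + 0) ≡ + 0
    lem = solve-∀

  -- Parallelogram law: the two sides differ by |a x - b y|².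
  sqn-⊕-≤ : ∀ {n} a b (x y : V n) → sqn (a ⊙ x ⊕ b ⊙ y) ≤ + 2 * (a * a * sqn x) + + 2 * (b * b * sqn y)
  sqn-⊕-≤ a b x y = ≤-diff (sqn (a ⊙ x ⊕ (- b) ⊙ y)) (0≤∙ (a ⊙ x ⊕ (- b) ⊙ y))
    (trans (lem a b (x ∙ x) (x ∙ y) (y ∙ y)) (sym (cong₂ _+_ (∙-bilin a b x y) (∙-bilin a (- b) x y))))
    where
    lem : ∀ a b X S Y → + 2 * (a * a * X) + + 2 * (b * b * Y) ≡
      (a * a * X + + 2 * (a * b * S) + b * b * Y) + (a * a * X + + 2 * (a * - b * S) + - b * - b * Y)
    lem = solve-∀

  module SplitOff {k n : ℕ} (B : Lin (suc k) n) (a : Lin (suc k) (suc k)) (alt : Alt a) where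
    w = ap a (e zero)
    u = ap B w
    v = ap B (e zero)
    A = conj B a
    rest = conj (inclL ᵀ) a
    A″ = conj (B ∘L inclL) rest

    -- With x = Bᵀ y, whose first coordinate is v · y, one has a x = x₀ w + z, where z is the image
    -- of x with x₀ replaced by 0. Antisymmetry gives z₀ = - (w · x) = - (u · y), and the other
    -- coordinates of z belong to `rest`.
    decomposition : ∀ y → ap A y ≗ (v ∙ y) ⊙ u ⊕ ((- (u ∙ y)) ⊙ v ⊕ ap A″ y)
    decomposition y i = begin
      ap B (ap a x) i
        ≡⟨ ap-cong B (λ j → trans (ap-cong a (η-∷ x) j) (ap-∷ a (x zero) (tail x) j)) i ⟩
      ap B (x zero ⊙ w ⊕ + 1 ⊙ z) i                         ≡⟨ ap-⊕ B (x zero ⊙ w) (+ 1 ⊙ z) i ⟩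
      ap B (x zero ⊙ w) i + ap B (+ 1 ⊙ z) i
        ≡⟨ cong₂ _+_ (ap-⊙ B (x zero) w i) (trans (ap-⊙ B (+ 1) z i) (*-identityˡ (ap B z i))) ⟩
      x zero * u i + ap B z i
        ≡⟨ cong (λ t → x zero * u i + t) (trans (ap-cong B (η-∷ z) i) (ap-∷ B (z zero) (tail z) i)) ⟩
      x zero * u i + (z zero * v i + + 1 * ap A″ y i)
        ≡⟨ cong₂ (λ s t → s * u i + (t * v i + + 1 * ap A″ y i)) x0 z0 ⟩
      (v ∙ y) * u i + (- (u ∙ y) * v i + + 1 * ap A″ y i)
        ≡⟨ cong (λ t → (v ∙ y) * u i + (- (u ∙ y) * v i + t)) (*-identityˡ (ap A″ y i)) ⟩
      _ ∎
      where
      open ≡-Reasoning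
      x = ap* B y
      z = ap a (+ 0 ◅ tail x)
      x0 : x zero ≡ v ∙ y
      x0 = trans (ap-coord (B ᵀ) y zero) (∙-comm y v)
      w0 : w zero ≡ + 0
      w0 = trans (sym (∙-e w zero)) (trans (∙-comm w (e zero)) (Alt-diag a alt (e zero)))
      xw : (+ 0 ◅ tail x) ∙ w ≡ x ∙ w
      xw = trans (+-identityˡ (tail x ∙ tail w)) (sym (trans (cong (_+ tail x ∙ tail w) (trans (cong (x zero *_) w0) (*-zeroʳ (x zero)))) (+-identityˡ (tail x ∙ tail w))))
      z0 : z zero ≡ - (u ∙ y)
      z0 = trans (Alt-coord a alt (+ 0 ◅ tail x)) (cong -_ (trans xw (trans (∙-comm x w) (sym (adj B w y)))))

    module Bounds (C N : ℕ) (red : Reduced C B) (op : OpBound N A) where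
      0≤CN : ∀ C → + 0 ≤ + C * + N
      0≤CN C = 0≤* {+ C} (+≤+ ℕ.z≤n) (+≤+ ℕ.z≤n)

      -- Reducedness is applied to z = a Bᵀ u, for which z₀ = - |u|² by antisymmetry and B z = A u.
      -- Thus |u|⁴ |v|² ≤ C |A u|² ≤ C N |u|², and |u|² cancels.
      split-small : sqn u * sqn v ≤ + C * + N
      split-small with sqn u ≟ + 0
      ... | yes z = subst (_≤ + C * + N) (sym (trans (cong (_* sqn v) z) (*-zeroˡ (sqn v)))) (0≤CN C)
      ... | no nz = *-cancel-pos (0<-of (0≤∙ u) nz) (begin
          sqn u * (sqn u * sqn v)    ≡⟨ lem (sqn u) (z zero) (sqn v) u²≡ ⟩
          z zero * z zero * sqn v    ≤⟨ red z ⟩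
          + C * sqn (ap A u)         ≤⟨ *-mono-nonNeg {+ C} (+≤+ ℕ.z≤n) (op u) ⟩
          + C * (+ N * sqn u)        ≡⟨ lem₂ (+ C) (+ N) (sqn u) ⟩
          sqn u * (+ C * + N)        ∎)
        where
        open ≤-Reasoning
        z = ap a (ap* B u)
        u²≡ : sqn u ≡ - z zero
        u²≡ = trans (adj B w u) (trans (∙-comm w (ap* B u)) (trans (alt (ap* B u) (e zero))
                (cong -_ (trans (∙-comm (e zero) z) (∙-e z zero)))))
        lem : ∀ U z V → U ≡ - z → U * (U * V) ≡ z * z * V
        lem U z V refl = l z V
          where
          l : ∀ z V → - z * (- z * V) ≡ z * z * V
          l = solve-∀
        lem₂ : ∀ C N U → C * (N * U) ≡ U * (C * N)
        lem₂ = solve-∀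

      -- A″ is A minus the wedge of u and v, and Cauchy-Schwarz bounds the wedge at y by 4 |u|² |v|²
      -- |y|² ≤ 4 C N |y|². Two applications of the parallelogram bound give 2 N + 2 · 4 C N.
      rest-bound : OpBound ((2 ℕ.+ 8 ℕ.* C) ℕ.* N) A″
      rest-bound y = begin
        sqn (ap A″ y)                                              ≡⟨ ∙-cong A″≡ A″≡ ⟩
        sqn (+ 1 ⊙ ap A y ⊕ - + 1 ⊙ wy)                            ≤⟨ sqn-⊕-≤ (+ 1) (- + 1) (ap A y) wy ⟩
        + 2 * (+ 1 * + 1 * sqn (ap A y)) + + 2 * (- + 1 * - + 1 * sqn wy)
                                                                   ≡⟨ lem₁ (sqn (ap A y)) (sqn wy) ⟩
        + 2 * sqn (ap A y) + + 2 * sqn wy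
          ≤⟨ +-mono-≤ (*-mono-nonNeg {+ 2} (+≤+ ℕ.z≤n) (op y)) (*-mono-nonNeg {+ 2} (+≤+ ℕ.z≤n) wy≤) ⟩
        + 2 * (+ N * sqn y) + + 2 * (+ 4 * (+ C * + N * sqn y))    ≡⟨ lem₂ (+ N) (+ C) (sqn y) ⟩
        (+ 2 + + 8 * + C) * + N * sqn y                            ≡⟨ cong (_* sqn y) coef ⟩
        + ((2 ℕ.+ 8 ℕ.* C) ℕ.* N) * sqn y                          ∎
        where
        open ≤-Reasoning
        s = v ∙ y
        t = u ∙ y
        wy = s ⊙ u ⊕ (- t) ⊙ v
        A″≡ : ap A″ y ≗ + 1 ⊙ ap A y ⊕ - + 1 ⊙ wy
        A″≡ i = sym (trans (cong (λ z → + 1 * z + - + 1 * wy i) (decomposition y i)) (l (s * u i) (- t * v i) (ap A″ y i)))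
          where
          l : ∀ p q r → + 1 * (p + (q + r)) + - + 1 * (p + q) ≡ r
          l = solve-∀
        lem₁ : ∀ p q → + 2 * (+ 1 * + 1 * p) + + 2 * (- + 1 * - + 1 * q) ≡ + 2 * p + + 2 * q
        lem₁ = solve-∀
        lem₂ : ∀ N C y → + 2 * (N * y) + + 2 * (+ 4 * (C * N * y)) ≡ (+ 2 + + 8 * C) * N * y
        lem₂ = solve-∀
        coef : (+ 2 + + 8 * + C) * + N ≡ + ((2 ℕ.+ 8 ℕ.* C) ℕ.* N)
        coef = sym (trans (pos-* (2 ℕ.+ 8 ℕ.* C) N) (cong (_* + N) (trans (pos-+ 2 (8 ℕ.* C)) (cong (λ z → + 2 + z) (pos-* 8 C)))))
        half : ∀ c d {x} → (c * c) ≤ x * sqn y → + 0 ≤ d → + 2 * (c * c * d) ≤ + 2 * (x * d * sqn y)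
        half c d {x} h 0≤d = *-mono-nonNeg {+ 2} (+≤+ ℕ.z≤n) (subst₂ _≤_ (*-comm d (c * c)) (l d x (sqn y)) (*-mono-nonNeg 0≤d h))
          where
          l : ∀ d x y → d * (x * y) ≡ x * d * y
          l = solve-∀
        wy≤ : sqn wy ≤ + 4 * (+ C * + N * sqn y)
        wy≤ = begin
          sqn wy                                                   ≤⟨ sqn-⊕-≤ s (- t) u v ⟩
          + 2 * (s * s * sqn u) + + 2 * (- t * - t * sqn v)
            ≤⟨ +-mono-≤ (half s (sqn u) {sqn v} (cauchy-schwarz v y) (0≤∙ u)) (half (- t) (sqn v) {sqn u} (subst (_≤ sqn u * sqn y) (l t) (cauchy-schwarz u y)) (0≤∙ v)) ⟩
          + 2 * (sqn v * sqn u * sqn y) + + 2 * (sqn u * sqn v * sqn y) ≡⟨ l₂ (sqn u) (sqn v) (sqn y) ⟩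
          + 4 * (sqn u * sqn v * sqn y)
            ≤⟨ *-mono-nonNeg {+ 4} (+≤+ ℕ.z≤n) (*-monoʳ-≤-nonNeg (sqn y) {{nonNegative (0≤∙ y)}} split-small) ⟩
          + 4 * (+ C * + N * sqn y) ∎
          where
          l : ∀ t → t * t ≡ - t * - t
          l = solve-∀
          l₂ : ∀ U V Y → + 2 * (V * U * Y) + + 2 * (U * V * Y) ≡ + 4 * (U * V * Y)
          l₂ = solve-∀

  -- A sum in place of a maximum, with one term for each bound that `decompose` meets: a vector
  -- dropped at once, the wedge split off with the Hermite constant C = 2^(k + 1), and the remaining
  -- k vectors, whose norm bound has grown by 2 + 8 C.
  wedgeConst : ℕ → ℕ
  wedgeConst zero = 0
  wedgeConst (suc zero) = 0
  wedgeConst (suc (suc k)) = wedgeConst (suc k) ℕ.+ (2 ℕ.^ suc k ℕ.+ wedgeConst k ℕ.* (2 ℕ.+ 8 ℕ.* 2 ℕ.^ suc k))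

  wedgeConst-mono : ∀ k → wedgeConst k ℕ.≤ wedgeConst (suc k)
  wedgeConst-mono zero = ℕ.z≤n
  wedgeConst-mono (suc k) = ℕP.m≤m+n _ _

  OpBound-resp : ∀ {m n} N (L L' : Lin m n) → (∀ y → ap L' y ≗ ap L y) → OpBound N L → OpBound N L'
  OpBound-resp N L L' h op y = subst (_≤ + N * sqn y) (sym (∙-cong (h y) (h y))) (op y)

  -- After reduction choose (p , s) ≠ 0 with a p = s e₀.  If s = 0, then p is in the radical of a; otherwise
  -- p₀ = 0 and p is in the radical of the form that remains when e₀ is split off.
  decompose : ∀ k m → k ℕ.≤ suc (dbl m) → ∀ {n} (B : Lin k n) (a : Lin k k) → Alt a →
    ∀ N → OpBound N (conj B a) → WedgeSum m (wedgeConst k ℕ.* N) (conj B a)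
  decompose-split : ∀ k m → suc k ℕ.≤ suc (dbl m) → ∀ {n} (B₀ : Lin (suc k) n) (a₀ : Lin (suc k) (suc k)) N
    (red : Σ (GL (suc k)) λ G → Reduced (2 ℕ.^ k) (B₀ ∘L to G)) →
    let G = proj₁ red
        B = B₀ ∘L to G
        a = conj (from G) a₀ in
    (∀ y → ap (conj B₀ a₀) y ≗ ap (conj B a) y) →
    HasKernel (conj (inclL ᵀ) a) → OpBound N (conj B a) → Alt a →
    WedgeSum m (wedgeConst (suc k) ℕ.* N) (conj B₀ a₀)

  decompose zero m _ B a alt N op = zeroWedges m , zeroWedges-small m _ ,
    λ y i → trans (ap-0 B (λ ()) i) (sym (zeroWedges-pairs m _ i))
  decompose (suc k) m h B₀ a₀ alt₀ N op₀ = go (solve a (e zero))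
    where
    red = hermite k B₀
    G = proj₁ red
    B = B₀ ∘L to G
    a = conj (from G) a₀
    alt = Alt-conj (from G) a₀ alt₀
    same : ∀ y → ap (conj B₀ a₀) y ≗ ap (conj B a) y
    same y i = sym (ap-cong B₀ (conj-GL G a₀ (ap* B₀ y)) i)
    op : OpBound N (conj B a)
    op = OpBound-resp N (conj B₀ a₀) (conj B a) (λ y i → sym (same y i)) op₀
    go : _ → _
    go (p , .(+ 0) , inj₂ (refl , nz) , hp) =
      let (P , R , _ , eq) = dropKernel a alt (p , nz , hp)
          eq' = λ y i → ap-cong B (eq (ap* B y)) i
      in WedgeSum-resp (conj B₀ a₀) (conj (B ∘L P) (conj R a))
           (λ y i → trans (same y i) (eq' y i))
           (WedgeSum-mono (conj (B ∘L P) (conj R a)) (ℕP.*-monoˡ-≤ N (wedgeConst-mono k))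
             (decompose k m (ℕP.<⇒≤ h) (B ∘L P) (conj R a) (Alt-conj R a alt) N
               (OpBound-resp N (conj B a) (conj (B ∘L P) (conj R a)) (λ y i → sym (eq' y i)) op)))
    go (p , s , inj₁ s≢0 , hp) = decompose-split k m h B₀ a₀ N red same (p' , nz' , hp') op alt
      where
      -- An alternating form has p · a p = 0, and a p = s e₀ turns this into s p₀ = 0.
      p0 : p zero ≡ + 0
      p0 with i*j≡0⇒i≡0∨j≡0 s (trans (cong (s *_) (sym (∙-e p zero))) (trans (sym (∙-⊙ʳ s p (e zero))) (trans (sym (∙-congˡ p hp)) (Alt-diag a alt p))))
      ... | inj₁ q = ⊥-elim (s≢0 q)
      ... | inj₂ q = q
      p' = tail p
      p≗ : (+ 0 ◅ p') ≗ p
      p≗ zero = sym p0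
      p≗ (suc i) = refl
      nz' : NZ p'
      nz' with zero-or-NZ p'
      ... | inj₂ nz = nz
      ... | inj₁ z = ⊥-elim (s≢0 (trans (sym (*-identityʳ s)) (trans (sym (hp zero)) (ap-0 a (λ { zero → p0 ; (suc i) → z i }) zero))))
      hp' : ap (conj (inclL ᵀ) a) p' ≗ 0v
      hp' i = trans (ap-cong a p≗ (suc i)) (trans (hp (suc i)) (*-zeroʳ s))

  decompose-split zero m _ _ _ _ _ _ (_ , (() , _) , _)
  decompose-split (suc k) zero (ℕ.s≤s ())
  -- One wedge uses up two vectors, e₀ and one from the radical of `rest`, so k + 2 ≤ 2 (m + 1) + 1
  -- descends to k ≤ 2 m + 1.
  decompose-split (suc k) (suc m) (ℕ.s≤s (ℕ.s≤s h)) B₀ a₀ N (G , red) same ker op alt =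
    let open SplitOff (B₀ ∘L to G) (conj (from G) a₀) alt
        open Bounds (2 ℕ.^ suc k) N red op
        C = 2 ℕ.^ suc k
        N″ = (2 ℕ.+ 8 ℕ.* C) ℕ.* N
        alt″ = Alt-conj (inclL ᵀ) (conj (from G) a₀) alt
        (P , R , _ , eq) = dropKernel rest alt″ ker
        B' = B₀ ∘L to G ∘L inclL ∘L P
        a' = conj R rest
        eq' = λ y i → ap-cong (B₀ ∘L to G ∘L inclL) (eq (ap* (B₀ ∘L to G ∘L inclL) y)) i
        (ws , small , ws≡) = decompose k m h B' a' (Alt-conj R rest alt″) N″
                   (OpBound-resp N″ A″ (conj B' a') (λ y i → sym (eq' y i)) rest-bound)
        wc = wedgeConst k
        c₁ : C ℕ.* N ℕ.≤ wedgeConst (suc (suc k)) ℕ.* N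
        c₁ = ℕP.*-monoˡ-≤ N (ℕP.≤-trans (ℕP.m≤m+n C _) (ℕP.m≤n+m _ (wedgeConst (suc k))))
        c₂ : wc ℕ.* ((2 ℕ.+ 8 ℕ.* C) ℕ.* N) ℕ.≤ wedgeConst (suc (suc k)) ℕ.* N
        c₂ = subst (ℕ._≤ wedgeConst (suc (suc k)) ℕ.* N) (ℕP.*-assoc wc _ N)
               (ℕP.*-monoˡ-≤ N (ℕP.≤-trans (ℕP.m≤n+m _ C) (ℕP.m≤n+m _ (wedgeConst (suc k)))))
    in (u , v) ∷ ws ,
       ≤-trans (≤-trans split-small (≤-reflexive (sym (pos-* C N)))) (+≤+ c₁) ∷ All.map (λ {p} → Small-mono c₂ {p}) small ,
       λ y i → trans (same y i) (trans (decomposition y i)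
         (cong (λ z → (v ∙ y) * u i + (- (u ∙ y) * v i + z)) (trans (eq' y i) (ws≡ y i))))

  -- Rank

  -- Quantifying over all X, not only over selections of columns, makes the condition independent of the basis.
  RankLe : ∀ {n} → ℕ → Lin n n → Set
  RankLe {n} r A = (X : Lin (suc r) n) → HasKernel (A ∘L X)

  padL : ∀ j {r} → Lin r (j ℕ.+ r)
  padL zero = idL
  padL (suc j) = inclL ∘L padL j

  padL-retract : ∀ j {r} (x : V r) → ap* (padL j) (ap (padL j) x) ≗ x
  padL-retract zero x i = refl
  padL-retract (suc j) x i = padL-retract j x i

  -- The left inverse C of B gives A Cᵀ x = B a x, and B a x = 0 forces a x = 0. So the kernel
  -- vector that `RankLe` supplies among r + 1 padded coordinates is a radical vector of a, and
  -- `dropKernel` removes one coordinate. C is carried along to keep B injective.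
  reduce-rank : ∀ j {n r} (A : Lin n n) → RankLe r A →
    (B : Lin (j ℕ.+ r) n) (C : Lin n (j ℕ.+ r)) → (∀ x → ap C (ap B x) ≗ x) →
    (a : Lin (j ℕ.+ r) (j ℕ.+ r)) → Alt a → (∀ y → ap A y ≗ ap (conj B a) y) →
    Σ (Lin r n) λ B' → Σ (Lin r r) λ a' → Alt a' × (∀ y → ap A y ≗ ap (conj B' a') y)
  reduce-rank zero A rk B C CB a alt eq = B , a , alt , eq
  reduce-rank (suc j) A rk B C CB a alt eq =
    let P' = blockL (padL j)
        (z , nz , hz) = rk (C ᵀ ∘L P')
        x = ap P' z
        ax : ap a x ≗ 0v
        ax i = trans (sym (CB (ap a x) i)) (ap-0 C (λ t →
                 trans (sym (ap-cong (B ∘L a) (transpose-inverse C B CB x) t)) (trans (sym (eq (ap* C x) t)) (hz t))) i)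
        nzx : NZ x
        nzx = NZ-image (P' ᵀ) (proj₁ nz , λ q → proj₂ nz (trans (sym (retract z (proj₁ nz))) q))
        (P , R , RP , eq') = dropKernel a alt (x , nzx , ax)
    in reduce-rank j A rk (B ∘L P) (R ∘L C)
         (λ x i → trans (ap-cong R (CB (ap P x)) i) (RP x i)) (conj R a) (Alt-conj R a alt)
         (λ y i → trans (eq y i) (ap-cong B (eq' (ap* B y)) i))
    where
    retract : ∀ z → ap* (blockL (padL j)) (ap (blockL (padL j)) z) ≗ z
    retract z zero = refl
    retract z (suc i) = padL-retract j (tail z) i

  rank-decompose : ∀ {n} m → dbl m ℕ.≤ n → (A : Lin n n) → Alt A → RankLe (dbl m) A →
    ∀ N → OpBound N A → WedgeSum m (wedgeConst (dbl m) ℕ.* N) A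
  rank-decompose {n} m h A alt rk N op with n ℕ.∸ dbl m | sym (ℕP.m∸n+n≡m h)
  ... | j | refl =
    let (B , a , alt' , eq) = reduce-rank j A rk idL idL (λ _ _ → refl) A alt (λ _ _ → refl)
    in WedgeSum-resp A (conj B a) eq
         (decompose (dbl m) m (ℕP.n≤1+n _) B a alt' N (OpBound-resp N A (conj B a) (λ y i → sym (eq y i)) op))

  selL : ∀ {k n} → (Fin k → Fin n) → Lin k n
  selL {zero} cols = zeroL
  selL {suc k} cols = e (cols zero) ▹ selL (λ i → cols (suc i))

  selL-ap* : ∀ {k n} (cols : Fin k → Fin n) y j → ap* (selL cols) y j ≡ y (cols j)
  selL-ap* cols y zero = trans (∙-comm (e (cols zero)) y) (∙-e y (cols zero))
  selL-ap* cols y (suc j) = selL-ap* (λ i → cols (suc i)) y j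

  Independent : ∀ {k n} → Lin n n → (Fin k → Fin n) → Set
  Independent A cols = ∀ c → ap (A ∘L selL cols) c ≗ 0v → c ≗ 0v

  RankLe⇒dependent : ∀ {n r} (A : Lin n n) → RankLe r A →
    (cols : Fin (suc r) → Fin n) → ¬ Independent A cols
  RankLe⇒dependent A rk cols ind =
    let (z , (i , q) , hz) = rk (selL cols) in q (ind z hz i)

  -- If A X had no kernel, some rows R of it would form a nonsingular square matrix S. Then the
  -- columns R of A are independent: from A c = 0 with c supported on R, and S p = s eᵢ with s ≠ 0,
  -- antisymmetry gives s cᵢ = c · A X p = - (X p · A c) = 0.
  dependent⇒RankLe : ∀ {n r} (A : Lin n n) → Alt A →
    ((cols : Fin (suc r) → Fin n) → Injective _≡_ _≡_ cols → ¬ Independent A cols) → RankLe r A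
  dependent⇒RankLe {n} {r} A alt dep X with kernel? (A ∘L X)
  ... | inj₁ ker = ker
  ... | inj₂ (R , inj , h) = ⊥-elim (dep R (λ {_} {_} → inj) ind)
    where
    S : Lin (suc r) (suc r)
    S = selL R ᵀ ∘L A ∘L X
    ind : Independent A R
    ind c hc i = go (solve S (e i))
      where
      go : (Σ (V (suc r)) λ p → Σ ℤ λ s → ((s ≢ + 0) ⊎ (s ≡ + 0 × NZ p)) × ap S p ≗ s ⊙ e i) → c i ≡ + 0
      go (p , .(+ 0) , inj₂ (refl , (j , q)) , hp) =
        ⊥-elim (q (h p (λ l → trans (sym (selL-ap* R (ap (A ∘L X) p) l)) (hp l)) j))
      go (p , s , inj₁ s≢0 , hp) with i*j≡0⇒i≡0∨j≡0 s sc≡0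
        where
        open ≡-Reasoning
        sc≡0 : s * c i ≡ + 0
        sc≡0 = begin
          s * c i                            ≡⟨ cong (s *_) (∙-e c i) ⟨
          s * (c ∙ e i)                      ≡⟨ ∙-⊙ʳ s c (e i) ⟨
          c ∙ (s ⊙ e i)                      ≡⟨ ∙-congˡ c hp ⟨
          c ∙ ap S p                         ≡⟨ adj (selL R) c (ap A (ap X p)) ⟨
          ap (selL R) c ∙ ap A (ap X p)      ≡⟨ alt (ap (selL R) c) (ap X p) ⟩
          - (ap X p ∙ ap A (ap (selL R) c))  ≡⟨ cong -_ (∙-≗0ʳ (ap X p) hc) ⟩
          + 0                                ∎
      ... | inj₁ q = ⊥-elim (s≢0 q)
      ... | inj₂ q = q

  conj-RankLe : ∀ {n r} (A : Lin n n) (B : Lin r n) (a : Lin r r) → (∀ y → ap A y ≗ ap (conj B a) y) → RankLe r A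
  conj-RankLe A B a eq X =
    let (p , nz , hp) = kernel (B ᵀ ∘L X)
    in p , nz , λ i → trans (eq (ap X p) i) (ap-0 (B ∘L a) hp i)

  -- Write A = W J Wᵀ and solve J Wᵀ p = s z with p supported on the 2m independent columns. If W z
  -- = 0, then A p = s W z = 0, so p = 0 and s z = 0; moreover p = 0 excludes s = 0.
  wedges-injective : ∀ {n m} (A : Lin n n) (ws : Vec (Pair n) m) → (∀ y → ap A y ≗ ap (wedges ws) y) →
    (cols : Fin (dbl m) → Fin n) → Independent A cols → ∀ z → ap (pairsL ws) z ≗ 0v → z ≗ 0v
  wedges-injective {m = m} A ws eq cols ind z hz = go (solve S z)
    where
    S : Lin (dbl m) (dbl m)
    S = JL {m} ∘L pairsL ws ᵀ ∘L selL cols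
    p≗0 : ∀ p s → ap S p ≗ s ⊙ z → p ≗ 0v
    p≗0 p s hp = ind p λ i → trans (eq (ap (selL cols) p) i) (trans (ap-cong (pairsL ws) hp i)
      (trans (ap-⊙ (pairsL ws) s z i) (trans (cong (s *_) (hz i)) (*-zeroʳ s))))
    go : (Σ (V (dbl m)) λ p → Σ ℤ λ s → ((s ≢ + 0) ⊎ (s ≡ + 0 × NZ p)) × ap S p ≗ s ⊙ z) → z ≗ 0v
    go (p , s , inj₂ (_ , (j , q)) , hp) = ⊥-elim (q (p≗0 p s hp j))
    go (p , s , inj₁ s≢0 , hp) i with i*j≡0⇒i≡0∨j≡0 s (trans (sym (hp i)) (ap-0 S (p≗0 p s hp) i))
    ... | inj₁ q = ⊥-elim (s≢0 q)
    ... | inj₂ q = q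

  -- Matrices of entries, their linear maps and the Frobenius norm

  Matrix : ℕ → Set
  Matrix n = Fin n → Fin n → ℤ

  infix 4 _≋_
  _≋_ : ∀ {n} → Matrix n → Matrix n → Set
  A ≋ B = ∀ i j → A i j ≡ B i j

  AltMatrix : ∀ {n} → Matrix n → Set
  AltMatrix A = ∀ i j → A j i ≡ - A i j

  matL-ap* : ∀ {m n} (A : Fin m → Fin n → ℤ) i j → ap* (matL A) (e i) j ≡ A i j
  matL-ap* A i j = begin
    ap* (matL A) (e i) j        ≡⟨ ap-coord (matL A ᵀ) (e i) j ⟩
    e i ∙ ap (matL A) (e j)     ≡⟨ ∙-comm (e i) _ ⟩
    ap (matL A) (e j) ∙ e i     ≡⟨ ∙-e _ i ⟩
    ap (matL A) (e j) i         ≡⟨ matL-ap A (e j) i ⟩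
    A i ∙ e j                   ≡⟨ ∙-e (A i) j ⟩
    A i j                       ∎
    where open ≡-Reasoning

  matL-entry : ∀ {m n} (A : Fin m → Fin n → ℤ) i j → ap (matL A) (e j) i ≡ A i j
  matL-entry A i j = trans (matL-ap A (e j) i) (∙-e (A i) j)

  matL-sel : ∀ {k n} (A : Matrix n) (cols : Fin k → Fin n) c i →
    ap (matL A ∘L selL cols) c i ≡ c ∙ (λ j → A i (cols j))
  matL-sel A cols c i = trans (ap-coord (matL A ∘L selL cols) c i)
    (∙-congˡ c (λ j → trans (selL-ap* cols (ap* (matL A) (e i)) j) (matL-ap* A i (cols j))))

  neg-∙ : ∀ {n} (x y : V n) → (λ i → - x i) ∙ y ≡ - (x ∙ y)
  neg-∙ {zero} x y = refl
  neg-∙ {suc n} x y = trans (cong₂ _+_ (sym (neg-distribˡ-* (x zero) (y zero))) (neg-∙ (tail x) (tail y)))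
    (sym (neg-distrib-+ (x zero * y zero) (tail x ∙ tail y)))

  Alt-matL : ∀ {n} (A : Matrix n) → AltMatrix A → Alt (matL A)
  Alt-matL A alt x y = begin
    x ∙ ap (matL A) y           ≡⟨ adj (matL A ᵀ) x y ⟨
    ap* (matL A) x ∙ y          ≡⟨ ∙-congʳ y rows ⟩
    (λ i → - ap (matL A) x i) ∙ y ≡⟨ neg-∙ (ap (matL A) x) y ⟩
    - (ap (matL A) x ∙ y)       ≡⟨ cong -_ (∙-comm (ap (matL A) x) y) ⟩
    - (y ∙ ap (matL A) x)       ∎
    where
    open ≡-Reasoning
    rows : ∀ i → ap* (matL A) x i ≡ - ap (matL A) x i
    rows i = begin
      ap* (matL A) x i          ≡⟨ ap-coord (matL A ᵀ) x i ⟩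
      x ∙ ap (matL A) (e i)     ≡⟨ ∙-comm x _ ⟩
      ap (matL A) (e i) ∙ x     ≡⟨ ∙-congʳ x (λ j → trans (matL-entry A j i) (alt i j)) ⟩
      (λ j → - A i j) ∙ x       ≡⟨ neg-∙ (A i) x ⟩
      - (A i ∙ x)               ≡⟨ cong -_ (matL-ap A x i) ⟨
      - ap (matL A) x i         ∎

  frob : ∀ {m n} → (Fin m → Fin n → ℤ) → ℤ
  frob {zero} A = + 0
  frob {suc m} A = sqn (A zero) + frob (λ i → A (suc i))

  frob-OpBound : ∀ {m n} (A : Fin m → Fin n → ℤ) y → sqn (ap (matL A) y) ≤ frob A * sqn y
  frob-OpBound {zero} A y = ≤-reflexive (sym (*-zeroˡ (sqn y)))
  frob-OpBound {suc m} A y = subst (sqn (ap (matL A) y) ≤_) (sym (*-distribʳ-+ (sqn y) (sqn (A zero)) _))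
    (+-mono-≤ (cauchy-schwarz (A zero) y) (frob-OpBound (λ i → A (suc i)) y))

  -- Upper bound

  -- At most N classes of S modulo _~_, witnessed by a separating code.
  infixr 4 _separatedBy_
  record Enc (S : Set) (_~_ : S → S → Set) (N : ℕ) : Set where
    constructor _separatedBy_
    field
      encode : S → Fin N
      separates : ∀ s t → encode s ≡ encode t → s ~ t
  open Enc public

  enc-mono : ∀ {S _~_ M N} → M ℕ.≤ N → Enc S _~_ M → Enc S _~_ N
  enc-mono h (c separatedBy inj) = (λ s → inject≤ (c s) h) separatedBy λ s t q → inj s t (inject≤-injective h h (c s) (c t) q)

  enc-pull : ∀ {S S' : Set} {_~_ _~'_ N} (g : S → S') → (∀ s t → g s ~' g t → s ~ t) → Enc S' _~'_ N → Enc S _~_ N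
  enc-pull g h (c separatedBy inj) = (λ s → c (g s)) separatedBy λ s t q → h s t (inj (g s) (g t) q)

  enc-× : ∀ {S S' _~_ _~'_ M N} → Enc S _~_ M → Enc S' _~'_ N →
    Enc (S × S') (λ s t → (proj₁ s ~ proj₁ t) × (proj₂ s ~' proj₂ t)) (M ℕ.* N)
  enc-× (c separatedBy inj) (c' separatedBy inj') = (λ s → combine (c (proj₁ s)) (c' (proj₂ s))) separatedBy
    λ s t q → let (p , p') = combine-injective (c (proj₁ s)) (c' (proj₂ s)) (c (proj₁ t)) (c' (proj₂ t)) q
              in inj _ _ p , inj' _ _ p'

  vecCode : ∀ {N} k → (Fin k → Fin N) → Fin (N ℕ.^ k)
  vecCode zero f = zero
  vecCode (suc k) f = combine (f zero) (vecCode k (λ i → f (suc i)))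

  vecCode-injective : ∀ {N} k (f g : Fin k → Fin N) → vecCode k f ≡ vecCode k g → f ≗ g
  vecCode-injective (suc k) f g q zero = proj₁ (combine-injective _ _ _ _ q)
  vecCode-injective (suc k) f g q (suc i) =
    vecCode-injective k (λ i → f (suc i)) (λ i → g (suc i)) (proj₂ (combine-injective (f zero) _ (g zero) _ q)) i

  intCode : ℕ → ℤ → ℕ
  intCode b (+ n) = n
  intCode b -[1+ n ] = b ℕ.+ suc n

  intCode-≤ : ∀ b z → ∣ z ∣ ℕ.≤ b → intCode b z ℕ.≤ b ℕ.+ b
  intCode-≤ b (+ n) h = ℕP.≤-trans h (ℕP.m≤m+n b b)
  intCode-≤ b -[1+ n ] h = ℕP.+-monoʳ-≤ b h

  intCode-injective : ∀ b z z' → ∣ z ∣ ℕ.≤ b → ∣ z' ∣ ℕ.≤ b → intCode b z ≡ intCode b z' → z ≡ z'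
  intCode-injective b (+ n) (+ n') h h' q = cong +_ q
  intCode-injective b (+ n) -[1+ n' ] h h' q = ⊥-elim (ℕP.<⇒≱ (ℕP.m<m+n b {suc n'} (ℕ.s≤s ℕ.z≤n)) (subst (ℕ._≤ b) q h))
  intCode-injective b -[1+ n ] (+ n') h h' q = ⊥-elim (ℕP.<⇒≱ (ℕP.m<m+n b {suc n} (ℕ.s≤s ℕ.z≤n)) (subst (ℕ._≤ b) (sym q) h'))
  intCode-injective b -[1+ n ] -[1+ n' ] h h' q = cong -[1+_] (ℕP.suc-injective (ℕP.+-cancelˡ-≡ b _ _ q))

  enc-int : ∀ b → Enc (Σ ℤ λ z → ∣ z ∣ ℕ.≤ b) (λ s t → proj₁ s ≡ proj₁ t) (suc (b ℕ.+ b))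
  enc-int b = (λ (z , h) → fromℕ< (ℕ.s≤s (intCode-≤ b z h))) separatedBy
    λ (z , h) (z' , h') q → intCode-injective b z z' h h'
      (fromℕ<-injective (intCode b z) (intCode b z') (ℕ.s≤s (intCode-≤ b z h)) (ℕ.s≤s (intCode-≤ b z' h')) q)

  maxabs : ∀ {n} → V n → ℕ
  maxabs {zero} x = 0
  maxabs {suc n} x = ∣ x zero ∣ ℕ.⊔ maxabs (tail x)

  ≤-maxabs : ∀ {n} (x : V n) i → ∣ x i ∣ ℕ.≤ maxabs x
  ≤-maxabs x zero = ℕP.m≤m⊔n _ _
  ≤-maxabs x (suc i) = ℕP.≤-trans (≤-maxabs (tail x) i) (ℕP.m≤n⊔m ∣ x zero ∣ _)

  maxabs-attained : ∀ {n} (x : V (suc n)) → ∃ λ i → ∣ x i ∣ ≡ maxabs x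
  maxabs-attained {zero} x = zero , sym (ℕP.⊔-identityʳ _)
  maxabs-attained {suc n} x with ℕP.⊔-sel ∣ x zero ∣ (maxabs (tail x)) | maxabs-attained (tail x)
  ... | inj₁ p | _ = zero , sym p
  ... | inj₂ p | i , q = suc i , trans q (sym p)

  abs-sq : ∀ a → + (∣ a ∣ ℕ.* ∣ a ∣) ≡ a * a
  abs-sq (+ n) = pos-* n n
  abs-sq -[1+ n ] = refl

  coord²≤sqn : ∀ {n} (x : V n) i → + (∣ x i ∣ ℕ.* ∣ x i ∣) ≤ sqn x
  coord²≤sqn {suc n} x zero = ≤-diff (sqn (tail x)) (0≤∙ (tail x)) (cong (_+ sqn (tail x)) (sym (abs-sq (x zero))))
  coord²≤sqn {suc n} x (suc i) = ≤-trans (coord²≤sqn (tail x) i)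
    (≤-diff (x zero * x zero) (0≤sq (x zero)) (+-comm (x zero * x zero) (sqn (tail x))))

  maxabs²≤sqn : ∀ {n} (x : V n) → + (maxabs x ℕ.* maxabs x) ≤ sqn x
  maxabs²≤sqn {zero} x = ≤-refl
  maxabs²≤sqn {suc n} x = let (i , q) = maxabs-attained x in
    subst (λ m → + (m ℕ.* m) ≤ sqn x) q (coord²≤sqn x i)

  sq-≤⇒≤ : ∀ {a b} → a ℕ.* a ℕ.≤ b ℕ.* b → a ℕ.≤ b
  sq-≤⇒≤ {a} {b} h with a ℕP.≤? b
  ... | yes p = p
  ... | no ¬p = ⊥-elim (ℕP.<⇒≱ (ℕP.*-mono-< (ℕP.≰⇒> ¬p) (ℕP.≰⇒> ¬p)) h)

  -- Counting decomposable bivectors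

  MaxSmall : ∀ {n} → ℕ → Pair n → Set
  MaxSmall s (u , v) = maxabs u ℕ.* maxabs v ℕ.≤ s

  Small⇒MaxSmall : ∀ {n M s} → M ℕ.≤ s ℕ.* s → (p : Pair n) → Small M p → MaxSmall s p
  Small⇒MaxSmall {M = M} {s} h (u , v) sm = sq-≤⇒≤ (drop‿+≤+ (begin
    + (α ℕ.* β ℕ.* (α ℕ.* β))      ≡⟨ cong +_ (lem α β) ⟩
    + (α ℕ.* α ℕ.* (β ℕ.* β))      ≡⟨ pos-* (α ℕ.* α) (β ℕ.* β) ⟩
    + (α ℕ.* α) * + (β ℕ.* β)      ≤⟨ *-mono-nonNeg {+ (α ℕ.* α)} (+≤+ ℕ.z≤n) (maxabs²≤sqn v) ⟩
    + (α ℕ.* α) * sqn v            ≤⟨ *-monoʳ-≤-nonNeg (sqn v) {{nonNegative (0≤∙ v)}} (maxabs²≤sqn u) ⟩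
    sqn u * sqn v                  ≤⟨ sm ⟩
    + M                            ≤⟨ +≤+ h ⟩
    + (s ℕ.* s)                    ∎))
    where
    open ≤-Reasoning
    α = maxabs u
    β = maxabs v
    lem : ∀ α β → α ℕ.* β ℕ.* (α ℕ.* β) ≡ α ℕ.* α ℕ.* (β ℕ.* β)
    lem = solveℕ-∀

  wedge : ∀ {n} → V n → V n → Matrix n
  wedge u v i j = v j * u i + - u j * v i

  -- Representatives of decomposable bivectors: u has its largest entry + suc a at position piv,
  -- and v is reduced modulo u there.
  record Normal (n s : ℕ) : Set where
    field
      piv : Fin (suc n)
      a c : ℕ
      u v : V (suc n)
      c<a : c ℕ.< suc a
      a² : suc a ℕ.* suc a ℕ.≤ s
      u-piv : u piv ≡ + suc a
      v-piv : v piv ≡ + c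
      u-≤ : ∀ j → ∣ u j ∣ ℕ.≤ suc a
      v-≤ : ∀ j → ∣ v j ∣ ℕ.* suc a ℕ.≤ 3 ℕ.* s

  -- Subtracting q u from v, where q is the quotient at the pivot, does not change the wedge. There
  -- |q| |u| ≤ |vᵢ| + c ≤ 2 |v|, so the new v is at most 3 |v|; and |u|² ≤ |u| |v| ≤ s.
  normalise-pos : ∀ {n s} a (u v : V (suc n)) i → (∀ j → ∣ u j ∣ ℕ.≤ suc a) → u i ≡ + suc a →
    suc a ℕ.≤ maxabs v → suc a ℕ.* maxabs v ℕ.≤ s →
    Σ (Normal n s) λ N → wedge (Normal.u N) (Normal.v N) ≋ wedge u v
  normalise-pos {n} {s} a u v i hu hi a≤β aβ = record
    { piv = i ; a = a ; c = c ; u = u ; v = v' ; c<a = DM.n%d<d (v i) d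
    ; a² = ℕP.≤-trans (ℕP.*-monoʳ-≤ (suc a) a≤β) aβ
    ; u-piv = hi ; v-piv = v'i ; u-≤ = hu ; v-≤ = v'≤ } , λ j l → lem (u j) (u l) (v j) (v l) q
    where
    d = + suc a
    β = maxabs v
    q = v i DM./ d
    c = v i DM.% d
    v' : V (suc n)
    v' j = v j + - (q * u j)
    vi≡ : v i ≡ + c + q * d
    vi≡ = DM.a≡a%n+[a/n]*n (v i) d
    cancel : ∀ x y → x + y + - y ≡ x
    cancel = solve-∀
    cancel' : ∀ x y → y ≡ x + y + - x
    cancel' = solve-∀
    v'i : v' i ≡ + c
    v'i = trans (cong₂ (λ x y → x + - (q * y)) vi≡ hi) (cancel (+ c) (q * d))
    lem : ∀ uj ul vj vl q → (vl + - (q * ul)) * uj + - ul * (vj + - (q * uj)) ≡ vl * uj + - ul * vj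
    lem = solve-∀
    open ℕP.≤-Reasoning
    qa≤ : ∣ q ∣ ℕ.* suc a ℕ.≤ β ℕ.+ β
    qa≤ = begin
      ∣ q ∣ ℕ.* suc a       ≡⟨ abs-* q d ⟨
      ∣ q * d ∣             ≡⟨ cong ∣_∣ (trans (cancel' (+ c) (q * d)) (cong (_+ - + c) (sym vi≡))) ⟩
      ∣ v i + - + c ∣       ≤⟨ ∣i+j∣≤∣i∣+∣j∣ (v i) (- + c) ⟩
      ∣ v i ∣ ℕ.+ ∣ - + c ∣ ≡⟨ cong (∣ v i ∣ ℕ.+_) (∣-i∣≡∣i∣ (+ c)) ⟩
      ∣ v i ∣ ℕ.+ c         ≤⟨ ℕP.+-mono-≤ (≤-maxabs v i) (ℕP.≤-trans (ℕP.<⇒≤ (DM.n%d<d (v i) d)) a≤β) ⟩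
      β ℕ.+ β               ∎
    v'≤ : ∀ j → ∣ v' j ∣ ℕ.* suc a ℕ.≤ 3 ℕ.* s
    v'≤ j = begin
      ∣ v' j ∣ ℕ.* suc a                        ≤⟨ ℕP.*-monoˡ-≤ (suc a) (∣i+j∣≤∣i∣+∣j∣ (v j) (- (q * u j))) ⟩
      (∣ v j ∣ ℕ.+ ∣ - (q * u j) ∣) ℕ.* suc a
        ≡⟨ cong (λ z → (∣ v j ∣ ℕ.+ z) ℕ.* suc a) (trans (∣-i∣≡∣i∣ (q * u j)) (abs-* q (u j))) ⟩
      (∣ v j ∣ ℕ.+ ∣ q ∣ ℕ.* ∣ u j ∣) ℕ.* suc a
        ≤⟨ ℕP.*-monoˡ-≤ (suc a) (ℕP.+-mono-≤ (≤-maxabs v j) (ℕP.≤-trans (ℕP.*-monoʳ-≤ ∣ q ∣ (hu j)) qa≤)) ⟩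
      (β ℕ.+ (β ℕ.+ β)) ℕ.* suc a               ≡⟨ lem₃ β (suc a) ⟩
      3 ℕ.* (suc a ℕ.* β)                       ≤⟨ ℕP.*-monoʳ-≤ 3 aβ ⟩
      3 ℕ.* s                                   ∎
      where
      lem₃ : ∀ β a → (β ℕ.+ (β ℕ.+ β)) ℕ.* a ≡ 3 ℕ.* (a ℕ.* β)
      lem₃ = solveℕ-∀

  maxabs-neg : ∀ {n} (x : V n) → maxabs (λ i → - x i) ≡ maxabs x
  maxabs-neg {zero} x = refl
  maxabs-neg {suc n} x = cong₂ ℕ._⊔_ (∣-i∣≡∣i∣ (x zero)) (maxabs-neg (tail x))

  NormalForm : ∀ {n} → ℕ → V (suc n) → V (suc n) → Set
  NormalForm {n} s u v = (∀ i j → wedge u v i j ≡ + 0) ⊎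
    Σ (Normal n s) λ N → wedge (Normal.u N) (Normal.v N) ≋ wedge u v

  abs-cases : ∀ z {a} → ∣ z ∣ ≡ suc a → z ≡ + suc a ⊎ z ≡ -[1+ a ]
  abs-cases (+ n) q = inj₁ (cong +_ q)
  abs-cases -[1+ n ] q = inj₂ (cong -[1+_] (ℕP.suc-injective q))

  normalise-≤ : ∀ {n s} (u v : V (suc n)) → maxabs u ℕ.≤ maxabs v → maxabs u ℕ.* maxabs v ℕ.≤ s → NormalForm s u v
  normalise-≤ {n} {s} u v h uv≤s with maxabs u in eq | maxabs-attained u
  ... | zero | _ = inj₁ λ i j → trans (cong₂ (λ x y → v j * x + - y * v i) (u0 i) (u0 j)) (lem (v i) (v j))
    where
    u0 : ∀ i → u i ≡ + 0
    u0 i = ∣i∣≡0⇒i≡0 (ℕP.n≤0⇒n≡0 (subst (∣ u i ∣ ℕ.≤_) eq (≤-maxabs u i)))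
    lem : ∀ x y → y * + 0 + - + 0 * x ≡ + 0
    lem = solve-∀
  ... | suc a | i , q with abs-cases (u i) q
  ...   | inj₁ ui = inj₂ (normalise-pos a u v i (λ j → subst (∣ u j ∣ ℕ.≤_) eq (≤-maxabs u j)) ui h uv≤s)
  -- Changing both signs preserves the wedge and makes the pivot entry positive.
  ...   | inj₂ ui = inj₂ (N , λ j l → trans (w j l) (lem (u j) (u l) (v j) (v l)))
    where
    flipped = normalise-pos a (λ j → - u j) (λ j → - v j) i
      (λ j → subst₂ ℕ._≤_ (sym (∣-i∣≡∣i∣ (u j))) eq (≤-maxabs u j)) (cong -_ ui)
      (subst (suc a ℕ.≤_) (sym (maxabs-neg v)) h) (subst (λ z → suc a ℕ.* z ℕ.≤ s) (sym (maxabs-neg v)) uv≤s)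
    N = proj₁ flipped
    w = proj₂ flipped
    lem : ∀ uj ul vj vl → - vl * - uj + - - ul * - vj ≡ vl * uj + - ul * vj
    lem = solve-∀

  normalise : ∀ {n s} (p : Pair (suc n)) → MaxSmall s p → NormalForm s (proj₁ p) (proj₂ p)
  normalise {n} {s} (u , v) h with ℕP.≤-total (maxabs u) (maxabs v)
  ... | inj₁ le = normalise-≤ u v le h
  -- u ∧ v = v ∧ (- u) puts the shorter vector first.
  ... | inj₂ ge = swap (normalise-≤ v (λ j → - u j) (subst (maxabs v ℕ.≤_) (sym (maxabs-neg u)) ge)
      (subst (ℕ._≤ s) (trans (ℕP.*-comm (maxabs u) (maxabs v)) (cong (maxabs v ℕ.*_) (sym (maxabs-neg u)))) h))
    where
    lem : ∀ uj ul vj vl → - ul * vj + - vl * - uj ≡ vl * uj + - ul * vj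
    lem = solve-∀
    swap : NormalForm s v (λ j → - u j) → NormalForm s u v
    swap (inj₁ z) = inj₁ λ i j → trans (sym (lem (u i) (u j) (v i) (v j))) (z i j)
    swap (inj₂ (N , w)) = inj₂ (N , λ i j → trans (w i j) (lem (u i) (u j) (v i) (v j)))

  -- For c ≤ a the number a(a+1) + c lies in [a(a+1), (a+1)²), and these intervals are disjoint.
  pivotCode : ℕ → ℕ → ℕ
  pivotCode a c = a ℕ.* suc a ℕ.+ c

  pivotCode-< : ∀ {a c} → c ℕ.< suc a → pivotCode a c ℕ.< suc a ℕ.* suc a
  pivotCode-< {a} {c} h = subst (pivotCode a c ℕ.<_) (ℕP.+-comm (a ℕ.* suc a) (suc a)) (ℕP.+-monoʳ-< (a ℕ.* suc a) h)

  pivotCode-mono : ∀ {a c a' c'} → c ℕ.< suc a → a ℕ.< a' → pivotCode a c ℕ.< pivotCode a' c'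
  pivotCode-mono h a<a' = ℕP.<-≤-trans (pivotCode-< h)
    (ℕP.≤-trans (ℕP.*-mono-≤ a<a' (ℕP.≤-trans a<a' (ℕP.n≤1+n _))) (ℕP.m≤m+n _ _))

  pivotCode-injective : ∀ {a c a' c'} → c ℕ.< suc a → c' ℕ.< suc a' → pivotCode a c ≡ pivotCode a' c' → a ≡ a' × c ≡ c'
  pivotCode-injective {a} {c} {a'} {c'} h h' q with ℕP.<-cmp a a'
  ... | tri< lt _ _ = ⊥-elim (ℕP.<⇒≢ (pivotCode-mono h lt) q)
  ... | tri> _ _ gt = ⊥-elim (ℕP.<⇒≢ (pivotCode-mono h' gt) (sym q))
  ... | tri≈ _ refl _ = refl , ℕP.+-cancelˡ-≡ (a ℕ.* suc a) c c' q

  Box : ℕ → ℕ → Set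
  Box s a = suc a ℕ.* suc a ℕ.≤ s × Σ ℤ λ x → Σ ℤ λ y → ∣ x ∣ ℕ.≤ suc a × ∣ y ∣ ℕ.* suc a ℕ.≤ 3 ℕ.* s

  -- The two ranges have lengths proportional to a + 1 and to s / (a + 1), so their product does not
  -- depend on a: at most 3 (a + 1) · 3 b ≤ 9 · 3 s. The bound 2 b + 1 ≤ 3 b needs b ≥ 1, which
  -- comes from (a + 1)² ≤ s.
  box-bound : ∀ s a → suc a ℕ.* suc a ℕ.≤ s →
    let b = 3 ℕ.* s ℕD./ suc a in suc (suc a ℕ.+ suc a) ℕ.* suc (b ℕ.+ b) ℕ.≤ 27 ℕ.* s
  box-bound s a h = begin
    suc (suc a ℕ.+ suc a) ℕ.* suc (b ℕ.+ b)  ≤⟨ ℕP.*-mono-≤ (triple (suc a) (ℕ.s≤s ℕ.z≤n)) (triple b 1≤b) ⟩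
    (3 ℕ.* suc a) ℕ.* (3 ℕ.* b)              ≡⟨ lem (suc a) b ⟩
    9 ℕ.* (b ℕ.* suc a)                      ≤⟨ ℕP.*-monoʳ-≤ 9 (ℕD.m/n*n≤m (3 ℕ.* s) (suc a)) ⟩
    9 ℕ.* (3 ℕ.* s)                          ≡⟨ ℕP.*-assoc 9 3 s ⟨
    27 ℕ.* s                                 ∎
    where
    open ℕP.≤-Reasoning
    b = 3 ℕ.* s ℕD./ suc a
    triple : ∀ x → 1 ℕ.≤ x → suc (x ℕ.+ x) ℕ.≤ 3 ℕ.* x
    triple x h = ℕP.≤-trans (ℕP.+-monoˡ-≤ (x ℕ.+ x) h) (ℕP.≤-reflexive (l x))
      where
      l : ∀ x → x ℕ.+ (x ℕ.+ x) ≡ 3 ℕ.* x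
      l = solveℕ-∀
    lem : ∀ x y → (3 ℕ.* x) ℕ.* (3 ℕ.* y) ≡ 9 ℕ.* (y ℕ.* x)
    lem = solveℕ-∀
    1≤b : 1 ℕ.≤ b
    1≤b = ℕD.m≥n⇒m/n>0 (ℕP.≤-trans (ℕP.m≤m*n (suc a) (suc a)) (ℕP.≤-trans h (ℕP.m≤m+n s _)))

  encBox : ∀ s a → Enc (Box s a) (λ (_ , x , y , _) (_ , x' , y' , _) → x ≡ x' × y ≡ y') (27 ℕ.* s)
  encBox s a = code separatedBy inj
    where
    b = 3 ℕ.* s ℕD./ suc a
    inner = enc-× (enc-int (suc a)) (enc-int b)
    split : Box s a → (Σ ℤ λ z → ∣ z ∣ ℕ.≤ suc a) × (Σ ℤ λ z → ∣ z ∣ ℕ.≤ b)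
    split (_ , x , y , hx , hy) = (x , hx) , (y , subst (ℕ._≤ b) (ℕD.m*n/n≡m ∣ y ∣ (suc a)) (ℕD./-monoˡ-≤ (suc a) hy))
    code : Box s a → Fin (27 ℕ.* s)
    code z@(h , _) = inject≤ (encode inner (split z)) (box-bound s a h)
    inj : ∀ z z' → code z ≡ code z' → _
    inj z@(h , _) z'@(h' , _) q = separates inner (split z) (split z')
      (inject≤-injective (box-bound s a h) (box-bound s a h') (encode inner (split z)) (encode inner (split z')) q)

  wedge-cong : ∀ {n} {u u' v v' : V n} → u ≗ u' → v ≗ v' → wedge u v ≋ wedge u' v'
  wedge-cong hu hv i j = cong₂ _+_ (cong₂ _*_ (hv j) (hu i)) (cong₂ _*_ (cong -_ (hu j)) (hv i))

  -- The code consists of the pivot position, the pair (a, c) as a number below s, and for each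
  -- other position its entries in u and v as a number below 27 s. The boxes depend on a, so they
  -- are compared only once the two values of a are known to agree.
  encNormal : ∀ n s → Enc (Normal n s) (λ N N' → wedge (Normal.u N) (Normal.v N) ≋ wedge (Normal.u N') (Normal.v N'))
    (suc n ℕ.* (s ℕ.* (27 ℕ.* s) ℕ.^ n))
  encNormal n s = code separatedBy inj
    where
    open Normal
    pc : Normal n s → Fin s
    pc N = fromℕ< (ℕP.<-≤-trans (pivotCode-< (c<a N)) (a² N))
    box : (N : Normal n s) → Fin n → Box s (a N)
    box N k = a² N , u N (punchIn (piv N) k) , v N (punchIn (piv N) k) , u-≤ N _ , v-≤ N _
    rest : (N : Normal n s) → Fin n → Fin (27 ℕ.* s)
    rest N k = encode (encBox s (a N)) (box N k)
    code : Normal n s → Fin (suc n ℕ.* (s ℕ.* (27 ℕ.* s) ℕ.^ n))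
    code N = combine (piv N) (combine (pc N) (vecCode n (rest N)))
    sameBox : ∀ {a a'} → a ≡ a' → (z : Box s a) (z' : Box s a') → encode (encBox s a) z ≡ encode (encBox s a') z' →
      (proj₁ (proj₂ z) ≡ proj₁ (proj₂ z')) × (proj₁ (proj₂ (proj₂ z)) ≡ proj₁ (proj₂ (proj₂ z')))
    sameBox {a} refl z z' q = separates (encBox s a) z z' q
    extend : (x x' : V (suc n)) (i i' : Fin (suc n)) → i ≡ i' → x i ≡ x' i' →
      (∀ k → x (punchIn i k) ≡ x' (punchIn i' k)) → x ≗ x'
    extend x x' i .i refl hi hk j with i ≟F j
    ... | yes refl = hi
    ... | no i≢j = subst (λ j → x j ≡ x' j) (punchIn-punchOut i≢j) (hk (punchOut i≢j))
    inj : ∀ N N' → code N ≡ code N' → _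
    inj N N' q = wedge-cong
      (extend (u N) (u N') (piv N) (piv N') p (trans (u-piv N) (trans (cong (λ a → + suc a) (proj₁ ac)) (sym (u-piv N')))) (λ k → proj₁ (bx k)))
      (extend (v N) (v N') (piv N) (piv N') p (trans (v-piv N) (trans (cong +_ (proj₂ ac)) (sym (v-piv N')))) (λ k → proj₂ (bx k)))
      where
      s₁ = combine-injective (piv N) _ (piv N') _ q
      s₂ = combine-injective (pc N) _ (pc N') _ (proj₂ s₁)
      p = proj₁ s₁
      ac = pivotCode-injective (c<a N) (c<a N') (fromℕ<-injective _ _ (ℕP.<-≤-trans (pivotCode-< (c<a N)) (a² N)) (ℕP.<-≤-trans (pivotCode-< (c<a N')) (a² N')) (proj₁ s₂))
      bx = λ k → sameBox (proj₁ ac) (box N k) (box N' k) (vecCode-injective n (rest N) (rest N') (proj₂ s₂) k)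

  -- The outer `suc` is the code of the zero wedge.
  pairCount : ℕ → ℕ → ℕ
  pairCount n s = suc (suc n ℕ.* (s ℕ.* (27 ℕ.* s) ℕ.^ n))

  encPair : ∀ n s → Enc (Σ (Pair (suc n)) (MaxSmall s))
    (λ ((u , v) , _) ((u' , v') , _) → wedge u v ≋ wedge u' v') (pairCount n s)
  encPair n s = (λ ((u , v) , h) → code u v (normalise (u , v) h)) separatedBy
    λ ((u , v) , h) ((u' , v') , h') q → inj u v u' v' (normalise (u , v) h) (normalise (u' , v') h') q
    where
    code : ∀ u v → NormalForm s u v → Fin (pairCount n s)
    code u v (inj₁ _) = zero
    code u v (inj₂ (N , _)) = suc (encode (encNormal n s) N)
    inj : ∀ u v u' v' (f : NormalForm s u v) (f' : NormalForm s u' v') →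
      code u v f ≡ code u' v' f' → wedge u v ≋ wedge u' v'
    inj u v u' v' (inj₁ z) (inj₁ z') q i j = trans (z i j) (sym (z' i j))
    inj u v u' v' (inj₂ (N , w)) (inj₂ (N' , w')) q i j = trans (sym (w i j))
      (trans (separates (encNormal n s) N N' (Fin-suc-injective q) i j) (w' i j))
    inj u v u' v' (inj₁ _) (inj₂ _) ()
    inj u v u' v' (inj₂ _) (inj₁ _) ()

  SmallPairs : ℕ → ℕ → ℕ → Set
  SmallPairs n s m = Σ (Vec (Pair (suc n)) m) (All (MaxSmall s))

  SameWedges : ∀ n s m → SmallPairs n s m → SmallPairs n s m → Set
  SameWedges n s m (ws , _) (ws' , _) = ∀ i j → ap (wedges ws) (e j) i ≡ ap (wedges ws') (e j) i

  encWedges : ∀ n s m → Enc (SmallPairs n s m) (SameWedges n s m) (pairCount n s ℕ.^ m)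
  encWedges n s zero = (λ _ → zero) separatedBy λ { ([] , _) ([] , _) _ i j → refl }
  encWedges n s (suc m) = enc-pull split eq (enc-× (encPair n s) (encWedges n s m))
    where
    split : SmallPairs n s (suc m) → Σ (Pair (suc n)) (MaxSmall s) × SmallPairs n s m
    split (p ∷ ws , h ∷ hs) = (p , h) , (ws , hs)
    entries : ∀ u v (ws : Vec (Pair (suc n)) m) i j →
      ap (wedges ((u , v) ∷ ws)) (e j) i ≡ wedge u v i j + ap (wedges ws) (e j) i
    entries u v ws i j = trans (cong₂ (λ x y → x * u i + (- y * v i + ap (wedges ws) (e j) i)) (∙-e v j) (∙-e u j))
      (sym (+-assoc (v j * u i) (- u j * v i) _))
    eq : ∀ s t → _ → _
    eq ((u , v) ∷ ws , h ∷ hs) ((u' , v') ∷ ws' , h' ∷ hs') (p , q) i j =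
      trans (entries u v ws i j) (trans (cong₂ _+_ (p i j) (q i j)) (sym (entries u' v' ws' i j)))

  -- Counting alternating matrices of bounded rank

  Bounded : ∀ {n} → ℕ → V n → Set
  Bounded b x = ∀ i → ∣ x i ∣ ℕ.≤ b

  sqn-≤ : ∀ {n b} (x : V n) → Bounded b x → sqn x ≤ + (n ℕ.* (b ℕ.* b))
  sqn-≤ {zero} x h = ≤-refl
  sqn-≤ {suc n} {b} x h = subst (sqn x ≤_) (sym (pos-+ (b ℕ.* b) (n ℕ.* (b ℕ.* b))))
    (+-mono-≤ (subst (_≤ + (b ℕ.* b)) (abs-sq (x zero)) (+≤+ (ℕP.*-mono-≤ (h zero) (h zero)))) (sqn-≤ (tail x) (λ i → h (suc i))))

  frob-≤ : ∀ {m n b} (A : Fin m → Fin n → ℤ) → (∀ i → Bounded b (A i)) → frob A ≤ + (m ℕ.* (n ℕ.* (b ℕ.* b)))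
  frob-≤ {zero} A h = ≤-refl
  frob-≤ {suc m} {n} {b} A h = subst (frob A ≤_) (sym (pos-+ (n ℕ.* (b ℕ.* b)) _))
    (+-mono-≤ (sqn-≤ (A zero) (h zero)) (frob-≤ (λ i → A (suc i)) (λ i → h (suc i))))

  OpBound-frob : ∀ {m n} N (A : Fin m → Fin n → ℤ) → frob A ≤ + N → OpBound N (matL A)
  OpBound-frob N A h y = ≤-trans (frob-OpBound A y) (*-monoʳ-≤-nonNeg (sqn y) {{nonNegative (0≤∙ y)}} h)

  ^-distrib-* : ∀ a b k → (a ℕ.* b) ℕ.^ k ≡ a ℕ.^ k ℕ.* b ℕ.^ k
  ^-distrib-* a b zero = refl
  ^-distrib-* a b (suc k) = trans (cong (a ℕ.* b ℕ.*_) (^-distrib-* a b k)) (l a b (a ℕ.^ k) (b ℕ.^ k))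
    where
    l : ∀ a b x y → a ℕ.* b ℕ.* (x ℕ.* y) ≡ a ℕ.* x ℕ.* (b ℕ.* y)
    l = solveℕ-∀

  1≤^ : ∀ {t} k → 1 ℕ.≤ t → 1 ℕ.≤ t ℕ.^ k
  1≤^ {t} k h = subst (ℕ._≤ t ℕ.^ k) (ℕP.^-zeroˡ k) (ℕP.^-monoˡ-≤ k h)

  pairConst : ℕ → ℕ → ℕ
  pairConst n k = suc (suc n ℕ.* (27 ℕ.* k) ℕ.^ suc n)

  -- The single factor s is weakened to 27 s so that it joins the n equal factors in one power; the
  -- summand 1 is absorbed by 1 ≤ tⁿ⁺¹.
  pairCount-≤ : ∀ n k t → 1 ℕ.≤ t → pairCount n (k ℕ.* t) ℕ.≤ pairConst n k ℕ.* t ℕ.^ suc n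
  pairCount-≤ n k t 1≤t = bound (suc n) (k ℕ.* t) (27 ℕ.* (k ℕ.* t)) ((27 ℕ.* (k ℕ.* t)) ℕ.^ n) ((27 ℕ.* k) ℕ.^ suc n) (t ℕ.^ suc n) (ℕP.m≤n*m (k ℕ.* t) 27)
      (trans (cong (ℕ._^ suc n) (sym (ℕP.*-assoc 27 k t))) (^-distrib-* (27 ℕ.* k) t (suc n))) (1≤^ (suc n) 1≤t)
    where
    bound : ∀ n s S R P T → s ℕ.≤ S → S ℕ.* R ≡ P ℕ.* T → 1 ℕ.≤ T → suc (n ℕ.* (s ℕ.* R)) ℕ.≤ suc (n ℕ.* P) ℕ.* T
    bound n s S R P T s≤S eq 1≤T = begin
      suc (n ℕ.* (s ℕ.* R))   ≤⟨ ℕP.+-mono-≤ 1≤T (ℕP.*-monoʳ-≤ n (ℕP.*-monoˡ-≤ R s≤S)) ⟩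
      T ℕ.+ n ℕ.* (S ℕ.* R)   ≡⟨ cong (λ z → T ℕ.+ n ℕ.* z) eq ⟩
      T ℕ.+ n ℕ.* (P ℕ.* T)   ≡⟨ cong (T ℕ.+_) (ℕP.*-assoc n P T) ⟨
      suc (n ℕ.* P) ℕ.* T     ∎
      where open ℕP.≤-Reasoning

  pairCount^-≤ : ∀ n k t m → 1 ℕ.≤ t → pairCount n (k ℕ.* t) ℕ.^ m ℕ.≤ pairConst n k ℕ.^ m ℕ.* t ℕ.^ (suc n ℕ.* m)
  pairCount^-≤ n k t m 1≤t = begin
    pairCount n (k ℕ.* t) ℕ.^ m                     ≤⟨ ℕP.^-monoˡ-≤ m (pairCount-≤ n k t 1≤t) ⟩
    (pairConst n k ℕ.* t ℕ.^ suc n) ℕ.^ m           ≡⟨ ^-distrib-* (pairConst n k) (t ℕ.^ suc n) m ⟩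
    pairConst n k ℕ.^ m ℕ.* (t ℕ.^ suc n) ℕ.^ m
      ≡⟨ cong (pairConst n k ℕ.^ m ℕ.*_) (ℕP.^-*-assoc t (suc n) m) ⟩
    pairConst n k ℕ.^ m ℕ.* t ℕ.^ (suc n ℕ.* m)     ∎
    where open ℕP.≤-Reasoning

  module _ (n m : ℕ) (h : dbl m ℕ.≤ suc n) where
    private
      K = wedgeConst (dbl m)

    upperConst : ℕ
    upperConst = pairConst n (suc K) ℕ.^ m

    LowRank : ℕ → Set
    LowRank t = Σ (Matrix (suc n)) λ A → AltMatrix A × RankLe (dbl m) (matL A) × frob A ≤ + (t ℕ.* t)

    SameMatrix : ∀ t → LowRank t → LowRank t → Set
    SameMatrix t A B = proj₁ A ≋ proj₁ B

    upper : ∀ t → 1 ℕ.≤ t → Enc (LowRank t) (SameMatrix t) (upperConst ℕ.* t ℕ.^ (suc n ℕ.* m))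
    upper t 1≤t = enc-mono (pairCount^-≤ n (suc K) t m 1≤t)
      (enc-pull {_~_ = SameMatrix t} {_~'_ = SameWedges n s m} toWedges same (encWedges n s m))
      where
      -- s² has to dominate |u|² |v|² ≤ K t²; `suc K` stands in for √K.
      s = suc K ℕ.* t
      KN≤s² : K ℕ.* (t ℕ.* t) ℕ.≤ s ℕ.* s
      KN≤s² = ℕP.≤-trans (ℕP.*-monoˡ-≤ (t ℕ.* t) (ℕP.≤-trans (ℕP.n≤1+n K) (ℕP.m≤m*n (suc K) (suc K)))) (ℕP.≤-reflexive (l (suc K) t))
        where
        l : ∀ k t → k ℕ.* k ℕ.* (t ℕ.* t) ≡ k ℕ.* t ℕ.* (k ℕ.* t)
        l = solveℕ-∀
      wsum : (A : LowRank t) → WedgeSum m (K ℕ.* (t ℕ.* t)) (matL (proj₁ A))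
      wsum (A , alt , rk , fr) = rank-decompose m h (matL A) (Alt-matL A alt) rk (t ℕ.* t) (OpBound-frob (t ℕ.* t) A fr)
      toWedges : LowRank t → SmallPairs n s m
      toWedges A = let (ws , small , _) = wsum A in ws , All.map (λ {p} → Small⇒MaxSmall {M = K ℕ.* (t ℕ.* t)} {s = s} KN≤s² p) small
      same : ∀ A B → SameWedges n s m (toWedges A) (toWedges B) → SameMatrix t A B
      same A B q i j = begin
        proj₁ A i j                              ≡⟨ matL-entry (proj₁ A) i j ⟨
        ap (matL (proj₁ A)) (e j) i              ≡⟨ proj₂ (proj₂ (wsum A)) (e j) i ⟩
        ap (wedges (proj₁ (toWedges A))) (e j) i ≡⟨ q i j ⟩
        ap (wedges (proj₁ (toWedges B))) (e j) i ≡⟨ proj₂ (proj₂ (wsum B)) (e j) i ⟨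
        ap (matL (proj₁ B)) (e j) i              ≡⟨ matL-entry (proj₁ B) i j ⟩
        proj₁ B i j                              ∎
        where open ≡-Reasoning

  -- Lower bound

  record AtLeast {X : Set} (_~_ : X → X → Set) (P : X → Set) (N : ℕ) : Set where
    field
      elem : Fin N → X
      holds : ∀ i → P (elem i)
      distinct : ∀ i j → elem i ~ elem j → i ≡ j
  open AtLeast public

  atLeast-mono : ∀ {X : Set} {_~_ : X → X → Set} {P : X → Set} {M N} → M ℕ.≤ N → AtLeast _~_ P N → AtLeast _~_ P M
  atLeast-mono h F = record
    { elem = λ i → elem F (inject≤ i h)
    ; holds = λ i → holds F _
    ; distinct = λ i j q → inject≤-injective h h i j (distinct F _ _ q) }

  atLeast-map : ∀ {X Y : Set} {_~_ : X → X → Set} {_~'_ : Y → Y → Set} {P : X → Set} {Q : Y → Set} {N}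
    (g : X → Y) → (∀ x x' → g x ~' g x' → x ~ x') → (∀ x → P x → Q (g x)) → AtLeast _~_ P N → AtLeast _~'_ Q N
  atLeast-map g g-inj pq F = record
    { elem = λ i → g (elem F i)
    ; holds = λ i → pq _ (holds F i)
    ; distinct = λ i j q → distinct F i j (g-inj _ _ q) }

  atLeast-bind : ∀ {X Y Z : Set} {_~_ : X → X → Set} {_~'_ : Y → Y → Set} {_~″_ : Z → Z → Set}
    {P : X → Set} {Q : X → Y → Set} {R : Z → Set} {M N}
    (g : X → Y → Z) → (∀ x y x' y' → g x y ~″ g x' y' → x ~ x' × y ~' y') →
    (∀ x y → P x → Q x y → R (g x y)) →
    AtLeast _~_ P M → (∀ x → P x → AtLeast _~'_ (Q x) N) → AtLeast _~″_ R (M ℕ.* N)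
  atLeast-bind {_~″_ = _~″_} {M = M} {N} g g-inj pq F fib = record
    { elem = λ k → h (remQuot N k)
    ; holds = λ k → pq _ _ (holds F _) (holds (fib _ (holds F _)) _)
    ; distinct = λ k l q → trans (sym (combine-remQuot {M} N k))
        (trans (cong (λ ij → combine (proj₁ ij) (proj₂ ij)) (h-inj (remQuot N k) (remQuot N l) q)) (combine-remQuot {M} N l)) }
    where
    h : Fin M × Fin N → _
    h (i , j) = g (elem F i) (elem (fib (elem F i) (holds F i)) j)
    h-inj : ∀ a b → h a ~″ h b → a ≡ b
    h-inj (i , j) (i' , j') q with g-inj _ _ _ _ q
    ... | x~ , y~ with distinct F i i' x~
    ...   | refl with distinct (fib (elem F i) (holds F i)) j j' y~
    ...     | refl = refl

  atLeast-ℕ : ∀ N → AtLeast _≡_ (ℕ._< N) N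
  atLeast-ℕ N = record { elem = toℕ ; holds = toℕ<n ; distinct = λ i j → toℕ-injective }

  -- Families of size 2m + 1, controlled modulo 2

  ◅-injective : ∀ {n} {a b : ℤ} {x y : V n} → (a ◅ x) ≗ (b ◅ y) → a ≡ b × x ≗ y
  ◅-injective h = h zero , λ i → h (suc i)

  -- Prescribing the parity of every entry fixes the matrix modulo 2 and costs only a constant
  -- factor in the size of the entries.
  EvenVec : ∀ {n} → ℕ → V n → Set
  EvenVec t x = ∀ i → Σ ℕ λ c → c ℕ.< t × x i ≡ + (2 ℕ.* c)

  atLeast-EvenVec : ∀ n t → AtLeast _≗_ (EvenVec {n} t) (t ℕ.^ n)
  atLeast-EvenVec zero t = record { elem = λ _ () ; holds = λ _ () ; distinct = λ { zero zero _ → refl } }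
  atLeast-EvenVec (suc n) t = atLeast-bind (λ c x → + (2 ℕ.* c) ◅ x)
    (λ c x c' x' q → let (p , r) = ◅-injective q in ℕP.*-cancelˡ-≡ c c' 2 (+-injective p) , r)
    (λ { c x c<t hx zero → c , c<t , refl ; c x c<t hx (suc i) → hx i })
    (atLeast-ℕ t) (λ _ _ → atLeast-EvenVec n t)

  bord : ∀ {n} → V n → Matrix n → Matrix (suc n)
  bord x A zero = + 0 ◅ x
  bord x A (suc i) = - x i ◅ A i

  bord-alt : ∀ {n} (x : V n) (A : Matrix n) → AltMatrix A → AltMatrix (bord x A)
  bord-alt x A alt zero zero = refl
  bord-alt x A alt zero (suc j) = refl
  bord-alt x A alt (suc i) zero = sym (neg-involutive (x i))
  bord-alt x A alt (suc i) (suc j) = alt i j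

  bord-injective : ∀ {n} {x x' : V n} {A A' : Matrix n} → bord x A ≋ bord x' A' → A ≋ A' × x ≗ x'
  bord-injective h = (λ i j → h (suc i) (suc j)) , λ j → h zero (suc j)

  bord-≤ : ∀ {n b} (x : V n) (A : Matrix n) → Bounded b x → (∀ i → Bounded b (A i)) → ∀ i → Bounded b (bord x A i)
  bord-≤ x A hx hA zero zero = ℕ.z≤n
  bord-≤ x A hx hA zero (suc j) = hx j
  bord-≤ {b = b} x A hx hA (suc i) zero = subst (ℕ._≤ b) (sym (∣-i∣≡∣i∣ (x i))) (hx i)
  bord-≤ x A hx hA (suc i) (suc j) = hA i j

  Even : ℤ → Set
  Even z = ∃ λ q → z ≡ + 2 * q

  even-+ : ∀ {a b} → Even a → Even b → Even (a + b)
  even-+ (p , refl) (q , refl) = p + q , sym (*-distribˡ-+ (+ 2) p q)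

  even-neg : ∀ {a} → Even a → Even (- a)
  even-neg (p , refl) = - p , neg-distribʳ-* (+ 2) p

  even-*ʳ : ∀ a {b} → Even b → Even (a * b)
  even-*ʳ a (q , refl) = a * q , lem a q
    where
    lem : ∀ a q → a * (+ 2 * q) ≡ + 2 * (a * q)
    lem = solve-∀

  even-*ˡ : ∀ {a} b → Even a → Even (a * b)
  even-*ˡ {a} b h = subst Even (*-comm b a) (even-*ʳ b h)

  even-cancelʳ : ∀ {a b} → Even (a + b) → Even b → Even a
  even-cancelʳ {a} {b} h k = subst Even (lem a b) (even-+ h (even-neg k))
    where
    lem : ∀ a b → a + b + - b ≡ a
    lem = solve-∀

  even-odd* : ∀ {z} γ → Even (z * + suc (2 ℕ.* γ)) → Even z
  even-odd* {z} γ h = even-cancelʳ (subst Even eq h) (even-*ʳ z (+ γ , pos-* 2 γ))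
    where
    lem : ∀ z w → z * (+ 1 + w) ≡ z + z * w
    lem = solve-∀
    eq : z * + suc (2 ℕ.* γ) ≡ z + z * + (2 ℕ.* γ)
    eq = lem z (+ (2 ℕ.* γ))

  even-∙ : ∀ {n} (c x : V n) → (∀ i → Even (x i)) → Even (c ∙ x)
  even-∙ {zero} c x h = + 0 , refl
  even-∙ {suc n} c x h = even-+ (even-*ʳ (c zero) (h zero)) (even-∙ (tail c) (tail x) (λ i → h (suc i)))

  EvenVec⇒Even : ∀ {n t} (x : V n) → EvenVec t x → ∀ i → Even (x i)
  EvenVec⇒Even x h i = let (c , _ , q) = h i in + c , trans q (pos-* 2 c)

  EvenVec⇒Bounded : ∀ {n t} (x : V n) → EvenVec t x → Bounded (2 ℕ.* t) x
  EvenVec⇒Bounded {t = t} x h i = let (c , c<t , q) = h i in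
    subst (λ z → ∣ z ∣ ℕ.≤ 2 ℕ.* t) (sym q) (ℕP.*-monoʳ-≤ 2 (ℕP.<⇒≤ c<t))

  IndependentMod2 : ∀ {k n} → Matrix n → (Fin k → Fin n) → Set
  IndependentMod2 A cols = ∀ c → (∀ i → Even (c ∙ (λ j → A i (cols j)))) → ∀ j → Even (c j)

  n<2^n : ∀ n → n ℕ.< 2 ℕ.^ n
  n<2^n zero = ℕ.s≤s ℕ.z≤n
  n<2^n (suc n) = ℕP.≤-trans (ℕP.+-mono-≤ (ℕP.≤-trans (ℕ.s≤s ℕ.z≤n) (n<2^n n)) (n<2^n n)) (ℕP.≤-reflexive (cong (2 ℕ.^ n ℕ.+_) (sym (ℕP.+-identityʳ _))))

  -- A nonzero integral relation could be halved indefinitely.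
  mod2⇒Independent : ∀ {k n} (A : Matrix n) (cols : Fin k → Fin n) → IndependentMod2 A cols → Independent (matL A) cols
  mod2⇒Independent {k} A cols ind c hc j = zero-c (divide ∣ c j ∣ c hc j)
    where
    rel : ∀ c → ap (matL A ∘L selL cols) c ≗ 0v → ∀ i → c ∙ (λ j → A i (cols j)) ≡ + 0
    rel c hc i = trans (sym (matL-sel A cols c i)) (hc i)
    halve : ∀ c → ap (matL A ∘L selL cols) c ≗ 0v → Σ (V k) λ d → c ≗ + 2 ⊙ d × ap (matL A ∘L selL cols) d ≗ 0v
    halve c hc = d , (λ j → proj₂ (ev j)) , λ i → nz (trans (sym (ap-⊙ (matL A ∘L selL cols) (+ 2) d i))
        (trans (sym (ap-cong (matL A ∘L selL cols) (λ j → proj₂ (ev j)) i)) (hc i)))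
      where
      ev = ind c (λ i → + 0 , rel c hc i)
      d = λ j → proj₁ (ev j)
      nz : ∀ {z} → + 2 * z ≡ + 0 → z ≡ + 0
      nz {z} q with i*j≡0⇒i≡0∨j≡0 (+ 2) q
      ... | inj₂ r = r
    divide : ∀ N c → ap (matL A ∘L selL cols) c ≗ 0v → ∀ j → ∃ λ q → ∣ c j ∣ ≡ 2 ℕ.^ N ℕ.* q
    divide zero c hc j = ∣ c j ∣ , sym (ℕP.+-identityʳ _)
    divide (suc N) c hc j =
      let (d , c≗ , hd) = halve c hc
          (q , hq) = divide N d hd j
      in q , trans (cong ∣_∣ (c≗ j)) (trans (abs-* (+ 2) (d j)) (trans (cong (2 ℕ.*_) hq) (sym (ℕP.*-assoc 2 (2 ℕ.^ N) q))))
    zero-c : (∃ λ q → ∣ c j ∣ ≡ 2 ℕ.^ ∣ c j ∣ ℕ.* q) → c j ≡ + 0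
    zero-c (zero , h) = ∣i∣≡0⇒i≡0 (trans h (ℕP.*-zeroʳ (2 ℕ.^ ∣ c j ∣)))
    zero-c (suc q , h) = ⊥-elim (ℕP.<⇒≱ (n<2^n ∣ c j ∣) (ℕP.≤-trans (ℕP.m≤m*n (2 ℕ.^ ∣ c j ∣) (suc q)) (ℕP.≤-reflexive (sym h))))

  record Base (m t : ℕ) (A : Matrix (suc (dbl m))) : Set where
    field
      alt : AltMatrix A
      bound : ∀ i → Bounded (2 ℕ.* t) (A i)
      mod2 : IndependentMod2 A inject₁

  OddEvenVec : ∀ {n} → ℕ → V (suc n) → Set
  OddEvenVec {n} t z = Σ ℕ λ γ → γ ℕ.< t × z zero ≡ + suc (2 ℕ.* γ) × EvenVec t (tail z)

  atLeast-OddEvenVec : ∀ n t → AtLeast _≗_ (OddEvenVec {n} t) (t ℕ.* t ℕ.^ n)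
  atLeast-OddEvenVec n t = atLeast-bind (λ γ x → + suc (2 ℕ.* γ) ◅ x)
    (λ c x c' x' q → let (p , r) = ◅-injective q in ℕP.*-cancelˡ-≡ c c' 2 (ℕP.suc-injective (+-injective p)) , r)
    (λ γ x h hx → γ , h , refl , hx)
    (atLeast-ℕ t) (λ _ _ → atLeast-EvenVec n t)

  -- Modulo 2 the new matrix is the direct sum of (0 1; 1 0) and A, the ones coming from the odd
  -- entry z₀. So row 0 shows that c₁ is even, row 1 that c₀ is even, and the other rows reduce to
  -- the relation for A.
  base-step : ∀ m t A y z → Base m t A → EvenVec t y → OddEvenVec t z → Base (suc m) t (bord z (bord y A))
  base-step m t A y z B hy (γ , γ<t , z0 , hx) = record
    { alt = bord-alt z _ (bord-alt y A alt)
    ; bound = bord-≤ z _ zb (bord-≤ y A (EvenVec⇒Bounded y hy) bound)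
    ; mod2 = λ c h → parity c h }
    where
    open Base B
    x = tail z
    zb : Bounded (2 ℕ.* t) z
    zb zero = subst (λ w → ∣ w ∣ ℕ.≤ 2 ℕ.* t) (sym z0) (ℕP.≤-trans (ℕ.s≤s (ℕP.n≤1+n _)) (ℕP.≤-trans (ℕP.≤-reflexive (l γ)) (ℕP.*-monoʳ-≤ 2 γ<t)))
      where
      l : ∀ γ → suc (suc (2 ℕ.* γ)) ≡ 2 ℕ.* suc γ
      l = solveℕ-∀
    zb (suc i) = EvenVec⇒Bounded x hx i
    M = bord z (bord y A)
    parity : ∀ (c : V (dbl (suc m))) → (∀ i → Even (c ∙ (λ j → M i (inject₁ j)))) → ∀ j → Even (c j)
    parity c h = λ { zero → c0 ; (suc zero) → c1 ; (suc (suc j)) → rest j }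
      where
      c″ : V (dbl m)
      c″ j = c (suc (suc j))
      l₁ : ∀ a b w s → a * + 0 + (b * w + s) ≡ b * w + s
      l₁ = solve-∀
      l₂ : ∀ a b w s → a * - w + (b * + 0 + s) ≡ - (a * w) + s
      l₂ = solve-∀
      c1 : Even (c (suc zero))
      c1 = even-odd* γ (subst (λ w → Even (c (suc zero) * w)) z0
        (even-cancelʳ (subst Even (l₁ (c zero) (c (suc zero)) (z zero) _) (h zero))
          (even-∙ c″ (λ j → x (inject₁ j)) (λ j → EvenVec⇒Even x hx (inject₁ j)))))
      c0 : Even (c zero)
      c0 = even-odd* γ (subst (λ w → Even (c zero * w)) z0 (subst Even (neg-involutive _) (even-neg
        (even-cancelʳ (subst Even (l₂ (c zero) (c (suc zero)) (z zero) _) (h (suc zero)))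
          (even-∙ c″ (λ j → y (inject₁ j)) (λ j → EvenVec⇒Even y hy (inject₁ j)))))))
      rest : ∀ j → Even (c″ j)
      rest = mod2 c″ λ i → even-cancelʳ {b = c zero * - x i + c (suc zero) * - y i}
        (subst Even (l₃ (c zero * - x i) (c (suc zero) * - y i) _) (h (suc (suc i))))
        (even-+ (even-*ˡ (- x i) c0) (even-*ˡ (- y i) c1))
        where
        l₃ : ∀ a b s → a + (b + s) ≡ s + (a + b)
        l₃ = solve-∀

  dbl≡ : ∀ m → dbl m ≡ m ℕ.+ m
  dbl≡ zero = refl
  dbl≡ (suc m) = cong suc (trans (cong suc (dbl≡ m)) (sym (ℕP.+-suc m m)))

  -- The exponent (2m + 1) m is the number of entries above the diagonal: each of them has t values.
  atLeast-Base : ∀ m t → AtLeast _≋_ (Base m t) (t ℕ.^ (suc (dbl m) ℕ.* m))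
  atLeast-Base zero t = record
    { elem = λ _ _ _ → + 0
    ; holds = λ _ → record { alt = λ _ _ → refl ; bound = λ _ _ → ℕ.z≤n ; mod2 = λ _ _ () }
    ; distinct = λ { zero zero _ → refl } }
  atLeast-Base (suc m) t = subst (AtLeast _≋_ (Base (suc m) t)) count
    (atLeast-bind {_~'_ = λ p q → proj₁ p ≗ proj₁ q × proj₂ p ≗ proj₂ q} {Q = λ _ p → EvenVec t (proj₁ p) × OddEvenVec t (proj₂ p)}
      (λ A p → bord (proj₂ p) (bord (proj₁ p) A))
      (λ A p A' p' q → let (q₁ , z) = bord-injective q ; (q₂ , y) = bord-injective q₁ in q₂ , y , z)
      (λ A p B (hy , hz) → base-step m t A (proj₁ p) (proj₂ p) B hy hz)
      (atLeast-Base m t)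
      (λ _ _ → atLeast-bind _,_ (λ _ _ _ _ q → q) (λ _ _ hy hz → hy , hz) (atLeast-EvenVec n t) (λ _ _ → atLeast-OddEvenVec n t)))
    where
    n = suc (dbl m)
    exp : n ℕ.* m ℕ.+ (n ℕ.+ suc n) ≡ suc (dbl (suc m)) ℕ.* suc m
    exp = subst (λ d → suc d ℕ.* m ℕ.+ (suc d ℕ.+ suc (suc d)) ≡ suc (suc (suc d)) ℕ.* suc m) (sym (dbl≡ m)) (l m)
      where
      l : ∀ m → suc (m ℕ.+ m) ℕ.* m ℕ.+ (suc (m ℕ.+ m) ℕ.+ suc (suc (m ℕ.+ m))) ≡ suc (suc (suc (m ℕ.+ m))) ℕ.* suc m
      l = solveℕ-∀
    count : t ℕ.^ (n ℕ.* m) ℕ.* (t ℕ.^ n ℕ.* (t ℕ.* t ℕ.^ n)) ≡ t ℕ.^ (suc (dbl (suc m)) ℕ.* suc m)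
    count = trans (cong (t ℕ.^ (n ℕ.* m) ℕ.*_) (sym (ℕP.^-distribˡ-+-* t n (suc n))))
      (trans (sym (ℕP.^-distribˡ-+-* t (n ℕ.* m) (n ℕ.+ suc n))) (cong (t ℕ.^_) exp))

  -- Bordering matrices of rank 2m

  record Good (m b n : ℕ) (A : Matrix n) : Set where
    field
      alt : AltMatrix A
      rank≤ : RankLe (dbl m) (matL A)
      cols : Fin (dbl m) → Fin n
      cols-inj : Injective _≡_ _≡_ cols
      cols-ind : Independent (matL A) cols
      bound : ∀ i → Bounded b (A i)

  -- Odd size alone bounds the rank from above, since `decompose` writes a form on 2m + 1 vectors
  -- with m wedges; parity gives the bound from below.
  base-good : ∀ m t A → Base m t A → Good m (2 ℕ.* t) (suc (dbl m)) A
  base-good m t A B = record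
    { alt = alt ; rank≤ = let (ws , _ , eq) = dec in conj-RankLe (matL A) (pairsL ws) (JL {m}) eq
    ; cols = inject₁ ; cols-inj = inject₁-injective ; cols-ind = mod2⇒Independent A inject₁ mod2 ; bound = bound }
    where
    open Base B
    N = suc (dbl m) ℕ.* (suc (dbl m) ℕ.* (2 ℕ.* t ℕ.* (2 ℕ.* t)))
    dec = decompose (suc (dbl m)) m ℕP.≤-refl idL (matL A) (Alt-matL A alt) N (OpBound-frob N A (frob-≤ A bound))

  Alt-JL : ∀ m → Alt (JL {m})
  Alt-JL zero x y = refl
  Alt-JL (suc m) x y = trans (cong (λ z → x zero * y (suc zero) + (x (suc zero) * - y zero + z)) (Alt-JL m (λ i → x (suc (suc i))) (λ i → y (suc (suc i)))))
    (lem (x zero) (x (suc zero)) (y zero) (y (suc zero)) _)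
    where
    lem : ∀ a b c d u → a * d + (b * - c + - u) ≡ - (c * b + (d * - a + u))
    lem = solve-∀

  JL² : ∀ m c → ap (JL {m}) (ap (JL {m}) c) ≗ - + 1 ⊙ c
  JL² (suc m) c zero = sym (-1*i≡-i (c zero))
  JL² (suc m) c (suc zero) = sym (-1*i≡-i (c (suc zero)))
  JL² (suc m) c (suc (suc i)) = JL² m (λ i → c (suc (suc i))) i

  -- A border vector z = - B a w leaves the rank bounded, since it amounts to the extra row w of B.
  bord-conj : ∀ {n k} (A : Matrix n) (B : Lin k n) (a : Lin k k) → Alt a → (∀ y → ap (matL A) y ≗ ap (conj B a) y) →
    (w : V k) (z : V n) → (∀ j → ap B (ap a w) j ≡ - z j) → ∀ y → ap (matL (bord z A)) y ≗ ap (conj (rowL w B) a) y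
  bord-conj A B a alt eq w z hz y = λ { zero → row₀ ; (suc i) → row i }
    where
    y' = tail y
    c = y zero
    x = c ⊙ w ⊕ ap* B y'
    ax : ap a x ≗ c ⊙ ap a w ⊕ ap a (ap* B y')
    ax i = trans (ap-⊕ a (c ⊙ w) (ap* B y') i) (cong (_+ ap a (ap* B y') i) (ap-⊙ a c w i))
    row₀ : + 0 * y zero + z ∙ y' ≡ w ∙ ap a x
    row₀ = sym (begin
      w ∙ ap a x                                  ≡⟨ ∙-congˡ w ax ⟩
      w ∙ (c ⊙ ap a w ⊕ ap a (ap* B y'))          ≡⟨ ∙-⊕ʳ w (c ⊙ ap a w) _ ⟩
      w ∙ (c ⊙ ap a w) + w ∙ ap a (ap* B y')
        ≡⟨ cong₂ _+_ (trans (∙-⊙ʳ c w (ap a w)) (trans (cong (c *_) (Alt-diag a alt w)) (*-zeroʳ c))) (alt w (ap* B y')) ⟩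
      + 0 + - (ap* B y' ∙ ap a w)
        ≡⟨ cong (λ s → + 0 + - s) (trans (adj (B ᵀ) y' (ap a w)) (trans (∙-congˡ y' hz) (trans (∙-comm y' (λ j → - z j)) (neg-∙ z y')))) ⟩
      + 0 + - - (z ∙ y')                          ≡⟨ cong (λ s → + 0 + s) (neg-involutive (z ∙ y')) ⟩
      + 0 + z ∙ y'                                ∎)
      where open ≡-Reasoning
    row : ∀ i → ap (matL (λ i → bord z A (suc i))) y i ≡ ap B (ap a x) i
    row i = sym (begin
      ap B (ap a x) i                                        ≡⟨ ap-cong B ax i ⟩
      ap B (c ⊙ ap a w ⊕ ap a (ap* B y')) i                  ≡⟨ ap-⊕ B (c ⊙ ap a w) _ i ⟩
      ap B (c ⊙ ap a w) i + ap (conj B a) y' i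
        ≡⟨ cong₂ _+_ (trans (ap-⊙ B c (ap a w) i) (cong (c *_) (hz i))) (trans (sym (eq y' i)) (matL-ap A y' i)) ⟩
      c * - z i + A i ∙ y'                                   ≡⟨ cong (_+ A i ∙ y') (*-comm c (- z i)) ⟩
      - z i * c + A i ∙ y'                                   ≡⟨ matL-ap (λ i → bord z A (suc i)) y i ⟨
      ap (matL (λ i → bord z A (suc i))) y i                 ∎)
      where open ≡-Reasoning

  -- How many coefficients c ≥ 0 to use for a vector of maximum norm α, subject to c α ≤ s. For α =
  -- 0 every c is admissible, and s + 1 of them suffice for `range-*`.
  range : ℕ → ℕ → ℕ
  range zero s = suc s
  range (suc a) s = suc (s ℕD./ suc a)

  range-≤ : ∀ α s {c} → c ℕ.< range α s → c ℕ.* α ℕ.≤ s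
  range-≤ zero s {c} _ = subst (ℕ._≤ s) (sym (ℕP.*-zeroʳ c)) ℕ.z≤n
  range-≤ (suc a) s {c} (ℕ.s≤s h) = ℕP.≤-trans (ℕP.*-monoˡ-≤ (suc a) h) (ℕD.m/n*n≤m s (suc a))

  range-pos : ∀ α s → 1 ℕ.≤ range α s
  range-pos zero s = ℕ.s≤s ℕ.z≤n
  range-pos (suc a) s = ℕ.s≤s ℕ.z≤n

  range-≥ : ∀ a s → s ℕ.≤ range (suc a) s ℕ.* suc a
  range-≥ a s = begin
    s                                             ≡⟨ ℕD.m≡m%n+[m/n]*n s (suc a) ⟩
    s ℕD.% suc a ℕ.+ s ℕD./ suc a ℕ.* suc a       ≤⟨ ℕP.+-monoˡ-≤ _ (ℕP.<⇒≤ (ℕD.m%n<n s (suc a))) ⟩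
    suc a ℕ.+ s ℕD./ suc a ℕ.* suc a              ∎
    where open ℕP.≤-Reasoning

  -- For positive norms the two ranges are at least s / α and s / β, and s² / (α β) ≥ s because α β
  -- ≤ s. If one norm is 0, its range alone exceeds s.
  range-* : ∀ α β s → α ℕ.* β ℕ.≤ s → s ℕ.≤ range α s ℕ.* range β s
  range-* zero β s h = ℕP.≤-trans (ℕP.n≤1+n s) (ℕP.≤-trans (ℕP.≤-reflexive (sym (ℕP.*-identityʳ _))) (ℕP.*-monoʳ-≤ (suc s) (range-pos β s)))
  range-* (suc a) zero s h = ℕP.≤-trans (ℕP.n≤1+n s) (ℕP.m≤n*m (suc s) (range (suc a) s))
  range-* (suc a) (suc b) zero h = ℕ.z≤n
  range-* (suc a) (suc b) s@(suc _) h = ℕP.*-cancelʳ-≤ s _ s (begin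
    s ℕ.* s                                      ≤⟨ ℕP.*-mono-≤ (range-≥ a s) (range-≥ b s) ⟩
    X ℕ.* suc a ℕ.* (Y ℕ.* suc b)                ≡⟨ lem X (suc a) Y (suc b) ⟩
    X ℕ.* Y ℕ.* (suc a ℕ.* suc b)                ≤⟨ ℕP.*-monoʳ-≤ (X ℕ.* Y) h ⟩
    X ℕ.* Y ℕ.* s                                ∎)
    where
    open ℕP.≤-Reasoning
    X = range (suc a) s
    Y = range (suc b) s
    lem : ∀ x a y b → x ℕ.* a ℕ.* (y ℕ.* b) ≡ x ℕ.* y ℕ.* (a ℕ.* b)
    lem = solveℕ-∀

  -- Each wedge supplies at least s pairs of coefficients, however unequal u and v are, and each of
  -- its two terms adds at most s to an entry of the border.
  atLeast-coeffs : ∀ {n m} s (ws : Vec (Pair n) m) → All (MaxSmall s) ws →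
    AtLeast _≗_ (λ c → Bounded (dbl m ℕ.* s) (ap (pairsL ws) c)) (s ℕ.^ m)
  atLeast-coeffs s [] [] = record { elem = λ _ () ; holds = λ _ _ → ℕ.z≤n ; distinct = λ { zero zero _ → refl } }
  atLeast-coeffs {n} {suc m} s ((u , v) ∷ ws) (h ∷ hs) = atLeast-bind
    (λ p c → + proj₁ p ◅ + proj₂ p ◅ c)
    (λ p c p' c' q → cong₂ _,_ (+-injective (q zero)) (+-injective (q (suc zero))) , λ i → q (suc (suc i)))
    (λ p c hp hc i → bound p c hp hc i)
    (atLeast-mono (range-* α β s h)
      (atLeast-bind {P = ℕ._< range α s} {Q = λ _ → ℕ._< range β s} {R = λ p → proj₁ p ℕ.< range α s × proj₂ p ℕ.< range β s}
        _,_ (λ { _ _ _ _ refl → refl , refl }) (λ _ _ a b → a , b) (atLeast-ℕ _) (λ _ _ → atLeast-ℕ _)))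
    (λ _ _ → atLeast-coeffs s ws hs)
    where
    α = maxabs u
    β = maxabs v
    small : ∀ x → ∀ c i → c ℕ.* maxabs x ℕ.≤ s → ∣ + c * x i ∣ ℕ.≤ s
    small x c i hc = ℕP.≤-trans (ℕP.≤-reflexive (abs-* (+ c) (x i))) (ℕP.≤-trans (ℕP.*-monoʳ-≤ c (≤-maxabs {n} x i)) hc)
    bound : ∀ p c → proj₁ p ℕ.< range α s × proj₂ p ℕ.< range β s → Bounded (dbl m ℕ.* s) (ap (pairsL ws) c) →
      Bounded (dbl (suc m) ℕ.* s) (ap (pairsL ((u , v) ∷ ws)) (+ proj₁ p ◅ + proj₂ p ◅ c))
    bound (a , b) c (ha , hb) hc i = ℕP.≤-trans (∣i+j∣≤∣i∣+∣j∣ (+ a * u i) (+ b * v i + ap (pairsL ws) c i))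
      (ℕP.+-mono-≤ (small u a i (range-≤ α s ha)) (ℕP.≤-trans (∣i+j∣≤∣i∣+∣j∣ (+ b * v i) (ap (pairsL ws) c i))
        (ℕP.+-mono-≤ (small v b i (range-≤ β s hb)) (hc i))))

  -- A bound without roots for √(K n² b²): entries at most b give squared norm at most n² b², hence
  -- |u|² |v|² ≤ K n² b² for the wedges of A.
  extSize : ℕ → ℕ → ℕ → ℕ
  extSize m n b = suc (wedgeConst (dbl m)) ℕ.* (suc n ℕ.* b)

  -- The borders are combinations of the vectors in the wedges of A, so `bord-conj` keeps the rank
  -- at most 2m, while the old independent columns, shifted by one, keep it at least 2m. By
  -- `wedges-injective`, different coefficients give different borders.
  extension : ∀ {m b n} (A : Matrix n) → dbl m ℕ.≤ n → Good m b n A →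
    AtLeast _≗_ (λ z → Good m (b ℕ.+ dbl m ℕ.* extSize m n b) (suc n) (bord z A)) (extSize m n b ℕ.^ m)
  extension {m} {b} {n} A m≤n good = atLeast-map (ap (pairsL ws)) inj
      (λ c hc → record
        { alt = bord-alt (ap (pairsL ws) c) A alt
        ; rank≤ = conj-RankLe (matL (bord (ap (pairsL ws) c) A)) (rowL (ap (JL {m}) c) (pairsL ws)) (JL {m})
            (bord-conj A (pairsL ws) (JL {m}) (Alt-JL m) eq (ap (JL {m}) c) (ap (pairsL ws) c) (λ j →
              trans (ap-cong (pairsL ws) (JL² m c) j) (trans (ap-⊙ (pairsL ws) (- + 1) c j) (-1*i≡-i _))))
        ; cols = λ j → suc (cols j)
        ; cols-inj = λ q → cols-inj (Fin-suc-injective q)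
        ; cols-ind = λ d hd → cols-ind d (λ i → trans (matL-sel A cols d i)
            (trans (sym (matL-sel (bord (ap (pairsL ws) c) A) (λ j → suc (cols j)) d (suc i))) (hd (suc i))))
        ; bound = bord-≤ (ap (pairsL ws) c) A (λ i → ℕP.≤-trans (hc i) (ℕP.m≤n+m _ b)) (λ i j → ℕP.≤-trans (bound i j) (ℕP.m≤m+n b _)) })
      (atLeast-coeffs s ws (All.map (λ {p} → Small⇒MaxSmall {M = K ℕ.* N} {s = s} KN≤s² p) small))
    where
    open Good good
    K = wedgeConst (dbl m)
    N = n ℕ.* (n ℕ.* (b ℕ.* b))
    s = extSize m n b
    dec : WedgeSum m (K ℕ.* N) (matL A)
    dec = rank-decompose m m≤n (matL A) (Alt-matL A alt) rank≤ N (OpBound-frob N A (frob-≤ A bound))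
    ws = proj₁ dec
    small = proj₁ (proj₂ dec)
    eq = proj₂ (proj₂ dec)
    KN≤s² : K ℕ.* N ℕ.≤ s ℕ.* s
    KN≤s² = sizes K (suc K) n (suc n) b (ℕP.≤-trans (ℕP.n≤1+n K) (ℕP.m≤m*n (suc K) (suc K))) (ℕP.n≤1+n n)
      where
      sizes : ∀ K k n n' b → K ℕ.≤ k ℕ.* k → n ℕ.≤ n' → K ℕ.* (n ℕ.* (n ℕ.* (b ℕ.* b))) ℕ.≤ k ℕ.* (n' ℕ.* b) ℕ.* (k ℕ.* (n' ℕ.* b))
      sizes K k n n' b hK hn = ℕP.≤-trans (ℕP.*-mono-≤ hK (ℕP.*-mono-≤ hn (ℕP.*-monoˡ-≤ (b ℕ.* b) hn))) (ℕP.≤-reflexive (l k n' b))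
        where
        l : ∀ k n b → k ℕ.* k ℕ.* (n ℕ.* (n ℕ.* (b ℕ.* b))) ≡ k ℕ.* (n ℕ.* b) ℕ.* (k ℕ.* (n ℕ.* b))
        l = solveℕ-∀
    inj : ∀ c c' → ap (pairsL ws) c ≗ ap (pairsL ws) c' → c ≗ c'
    inj c c' q i = diff (wedges-injective (matL A) ws eq cols cols-ind (+ 1 ⊙ c ⊕ - + 1 ⊙ c') zero-diff i)
      where
      W = pairsL ws
      l₀ : ∀ x → + 1 * x + - + 1 * x ≡ + 0
      l₀ = solve-∀
      l₁ : ∀ x y → x ≡ (+ 1 * x + - + 1 * y) + y
      l₁ = solve-∀
      zero-diff : ap W (+ 1 ⊙ c ⊕ - + 1 ⊙ c') ≗ 0v
      zero-diff j = trans (ap-⊕ W (+ 1 ⊙ c) (- + 1 ⊙ c') j) (trans (cong₂ _+_ (ap-⊙ W (+ 1) c j) (trans (ap-⊙ W (- + 1) c' j) (cong (- + 1 *_) (sym (q j))))) (l₀ (ap W c j)))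
      diff : + 1 * c i + - + 1 * c' i ≡ + 0 → c i ≡ c' i
      diff h = trans (l₁ (c i) (c' i)) (trans (cong (_+ c' i) h) (+-identityˡ (c' i)))

  -- Each border multiplies the count by t^m, raising the exponent from n m to (n + 1) m, and
  -- enlarges the entries by a factor depending only on m, n and the previous κ.
  lower : ∀ m j → Σ ℕ λ κ → 1 ℕ.≤ κ × ∀ t →
    AtLeast _≋_ (Good m (κ ℕ.* t) (j ℕ.+ suc (dbl m))) (t ℕ.^ ((j ℕ.+ suc (dbl m)) ℕ.* m))
  lower m zero = 2 , ℕ.s≤s ℕ.z≤n , λ t → atLeast-map (λ A → A) (λ _ _ q → q) (base-good m t) (atLeast-Base m t)
  lower m (suc j) = κ' , ℕP.≤-trans 1≤κ (ℕP.m≤m+n κ _) , λ t →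
      subst (AtLeast _≋_ (Good m (κ' ℕ.* t) (suc n))) (count t)
        (subst (λ b → AtLeast _≋_ (Good m b (suc n)) (t ℕ.^ (n ℕ.* m) ℕ.* t ℕ.^ m)) (bounds κ (dbl m) (suc (wedgeConst (dbl m))) (suc n) t)
        (atLeast-bind {_~'_ = _≗_} {P = Good m (κ ℕ.* t) n} {Q = λ A z → Good m (κ ℕ.* t ℕ.+ dbl m ℕ.* extSize m n (κ ℕ.* t)) (suc n) (bord z A)}
          (λ A z → bord z A) (λ A z A' z' → bord-injective) (λ A z _ g → g) (fam t)
          (λ A g → atLeast-mono (ℕP.^-monoˡ-≤ m (t≤s t)) (extension A m≤n g))))
    where
    n = j ℕ.+ suc (dbl m)
    rec = lower m j
    κ = proj₁ rec
    1≤κ = proj₁ (proj₂ rec)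
    fam = proj₂ (proj₂ rec)
    κ' = κ ℕ.+ dbl m ℕ.* (suc (wedgeConst (dbl m)) ℕ.* (suc n ℕ.* κ))
    m≤n : dbl m ℕ.≤ n
    m≤n = ℕP.≤-trans (ℕP.n≤1+n _) (ℕP.m≤n+m _ j)
    count : ∀ t → t ℕ.^ (n ℕ.* m) ℕ.* t ℕ.^ m ≡ t ℕ.^ (suc n ℕ.* m)
    count t = trans (sym (ℕP.^-distribˡ-+-* t (n ℕ.* m) m)) (cong (t ℕ.^_) (ℕP.+-comm (n ℕ.* m) m))
    bounds : ∀ κ d k n t → κ ℕ.* t ℕ.+ d ℕ.* (k ℕ.* (n ℕ.* (κ ℕ.* t))) ≡ (κ ℕ.+ d ℕ.* (k ℕ.* (n ℕ.* κ))) ℕ.* t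
    bounds = solveℕ-∀
    t≤s : ∀ t → t ℕ.≤ extSize m n (κ ℕ.* t)
    t≤s t = grow (wedgeConst (dbl m)) n κ t 1≤κ
      where
      grow : ∀ k n κ t → 1 ℕ.≤ κ → t ℕ.≤ suc k ℕ.* (suc n ℕ.* (κ ℕ.* t))
      grow k n (suc κ) t _ = ℕP.≤-trans (ℕP.m≤n*m t (suc κ)) (ℕP.≤-trans (ℕP.m≤n*m (suc κ ℕ.* t) (suc n)) (ℕP.m≤n*m _ (suc k)))

  -- Lists of matrices and rational bounds

  lookup-unique : ∀ {X : Set} {xs : List X} → Unique xs → Injective _≡_ _≡_ (List.lookup xs)
  lookup-unique (_ ∷ _) {zero} {zero} q = refl
  lookup-unique {xs = _ ∷ xs} (x∉ ∷ _) {zero} {suc j} q = ⊥-elim (ListAll.lookup x∉ (∈-lookup {xs = xs} j) q)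
  lookup-unique {xs = _ ∷ xs} (x∉ ∷ _) {suc i} {zero} q = ⊥-elim (ListAll.lookup x∉ (∈-lookup {xs = xs} i) (sym q))
  lookup-unique (_ ∷ u) {suc i} {suc j} q = cong suc (lookup-unique u q)

  length-≤ : ∀ {X S : Set} {_~_ : S → S → Set} {N} {L : List X} → Unique L → (g : ∀ x → x ∈ L → S) →
    (∀ x y p q → g x p ~ g y q → x ≡ y) → Enc S _~_ N → length L ℕ.≤ N
  length-≤ {L = L} u g g-inj E = injective⇒≤ {f = λ i → encode E (g (List.lookup L i) (∈-lookup i))}
    λ {i} {j} q → lookup-unique u (g-inj _ _ _ _ (separates E _ _ q))

  ≤-length : ∀ {X Y : Set} {_~_ : Y → Y → Set} {P : Y → Set} {N} (L : List X) (g : Y → X) →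
    (∀ y y' → g y ≡ g y' → y ~ y') → (∀ y → P y → g y ∈ L) → AtLeast _~_ P N → N ℕ.≤ length L
  ≤-length L g g-inj g∈ F = injective⇒≤ {f = λ i → Any.index (mem i)} λ {i} {j} q → distinct F i j (g-inj _ _
      (trans (lookup-index (mem i)) (trans (cong (List.lookup L) q) (sym (lookup-index (mem j))))))
    where
    mem : ∀ i → g (elem F i) ∈ L
    mem i = g∈ _ (holds F i)

  toMat : ∀ {n} → Matrix n → Mat n
  toMat A = tabulate (λ i → tabulate (A i))

  entry-toMat : ∀ {n} (A : Matrix n) → entry (toMat A) ≋ A
  entry-toMat A i j = trans (cong (λ row → lookup row j) (lookup∘tabulate (λ i → tabulate (A i)) i)) (lookup∘tabulate (A i) j)

  entry-injective : ∀ {n} (A B : Mat n) → entry A ≋ entry B → A ≡ B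
  entry-injective A B h = trans (sym (tabulate∘lookup A)) (trans (tabulate-cong (λ i →
    trans (sym (tabulate∘lookup (lookup A i))) (trans (tabulate-cong (h i)) (tabulate∘lookup (lookup B i))))) (tabulate∘lookup B))

  toMat-injective : ∀ {n} (A B : Matrix n) → toMat A ≡ toMat B → A ≋ B
  toMat-injective A B q i j = trans (sym (entry-toMat A i j)) (trans (cong (λ M → entry M i j) q) (entry-toMat B i j))

  sumList : ∀ {n} → V n → ℤ
  sumList f = List.foldr ℤ._+_ (+ 0) (List.tabulate f)

  ΣFin≡ : ∀ n (f : V n) → ΣFin n f ≡ sumList f
  ΣFin≡ n f = cong (List.foldr ℤ._+_ (+ 0)) (map-tabulate (λ i → i) f)

  sumList-∙ : ∀ {n} (x y : V n) → sumList (λ i → x i ℤ.* y i) ≡ x ∙ y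
  sumList-∙ {zero} x y = refl
  sumList-∙ {suc n} x y = +-congˡ (x zero ℤ.* y zero) (sumList-∙ (λ i → x (suc i)) (λ i → y (suc i)))

  sumList-cong : ∀ {n} {f g : V n} → f ≗ g → sumList f ≡ sumList g
  sumList-cong {zero} h = refl
  sumList-cong {suc n} h = cong₂ ℤ._+_ (h zero) (sumList-cong (λ i → h (suc i)))

  sumList-frob : ∀ {m n} (A : Fin m → Fin n → ℤ) → sumList (λ i → sqn (A i)) ≡ frob A
  sumList-frob {zero} A = refl
  sumList-frob {suc m} A = +-congˡ (sqn (A zero)) (sumList-frob (λ i → A (suc i)))

  normSq≡frob : ∀ {n} (A : Mat n) → normSq A ≡ frob (entry A)
  normSq≡frob {n} A = trans (ΣFin≡ n _) (trans (sumList-cong (λ i →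
    trans (ΣFin≡ n _) (sumList-∙ (entry A i) (entry A i)))) (sumList-frob (entry A)))

  combo≡∙ : ∀ {n k} (A : Mat n) (cols : Fin k → Fin n) c i → combo A cols c i ≡ c ∙ (λ j → entry A i (cols j))
  combo≡∙ {k = k} A cols c i = trans (ΣFin≡ k _) (sumList-∙ c (λ j → entry A i (cols j)))

  frob-cong : ∀ {m n} {A B : Fin m → Fin n → ℤ} → (∀ i j → A i j ≡ B i j) → frob A ≡ frob B
  frob-cong {zero} h = refl
  frob-cong {suc m} h = cong₂ ℤ._+_ (∙-cong (h zero) (h zero)) (frob-cong (λ i → h (suc i)))

  rank⇒RankLe : ∀ {n r} (A : Mat n) → IsAlt A → HasRank A r → RankLe r (matL (entry A))
  rank⇒RankLe A (alt , _) (_ , dep) = dependent⇒RankLe (matL (entry A)) (Alt-matL (entry A) alt)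
    λ cols inj ind → dep cols inj λ c hc → ind c λ i →
      trans (matL-sel (entry A) cols c i) (trans (sym (combo≡∙ A cols c i)) (hc i))

  good-alt : ∀ {m b n} (A : Matrix n) → Good m b n A → IsAlt (toMat A)
  good-alt A good = (λ i j → trans (entry-toMat A j i) (trans (alt i j) (cong ℤ.-_ (sym (entry-toMat A i j))))) ,
    λ i → trans (entry-toMat A i i) (self-neg (A i i) (alt i i))
    where open Good good

  good-rank : ∀ {m b n} (A : Matrix n) → Good m b n A → HasRank (toMat A) (dbl m)
  good-rank A good = (cols , cols-inj , λ c hc → cols-ind c (λ i → trans (sym (combo-sel cols c i)) (hc i))) ,
    λ cols' _ ind → RankLe⇒dependent (matL A) rank≤ cols' (λ c hc → ind c (λ i → trans (combo-sel cols' c i) (hc i)))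
    where
    open Good good
    combo-sel : ∀ {k} (cols : Fin k → Fin _) c i → combo (toMat A) cols c i ≡ ap (matL A ∘L selL cols) c i
    combo-sel cols c i = trans (combo≡∙ (toMat A) cols c i)
      (trans (∙-congˡ c (λ j → entry-toMat A i (cols j))) (sym (matL-sel A cols c i)))

  ι : ℤ → ℚ
  ι z = z ℚ./ 1

  ι≡ : ∀ z → ι z ≡ mkℚ z 0 (Coprime.sym (Coprime.1-coprimeTo _))
  ι≡ z = ℚP.↥p/↧p≡p (mkℚ z 0 (Coprime.sym (Coprime.1-coprimeTo _)))

  ι-* : ∀ a b → ι a ℚ.* ι b ≡ ι (a ℤ.* b)
  ι-* a b = cong₂ ℚ._*_ (ι≡ a) (ι≡ b)

  ι-mono : ∀ {a b} → a ℤ.≤ b → ι a ℚ.≤ ι b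
  ι-mono {a} {b} h = subst₂ ℚ._≤_ (sym (ι≡ a)) (sym (ι≡ b)) (*≤* (ℤP.*-monoʳ-≤-nonNeg (+ 1) h))

  ι-mono-< : ∀ {a b} → a ℤ.< b → ι a ℚ.< ι b
  ι-mono-< {a} {b} h = subst₂ ℚ._<_ (sym (ι≡ a)) (sym (ι≡ b)) (*<* (ℤP.*-monoʳ-<-pos (+ 1) h))

  ι-cancel-< : ∀ {a b} → ι a ℚ.< ι b → a ℤ.< b
  ι-cancel-< {a} {b} h with subst₂ ℚ._<_ (ι≡ a) (ι≡ b) h
  ... | *<* p = subst₂ ℤ._<_ (ℤP.*-identityʳ a) (ℤP.*-identityʳ b) p

  0≤ι : ∀ a → 0ℚ ℚ.≤ ι (+ a)
  0≤ι a = ι-mono {+ 0} {+ a} (ℤ.+≤+ ℕ.z≤n)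

  ι-^ : ∀ a k → ι (+ a) ^ℚ k ≡ ι (+ (a ℕ.^ k))
  ι-^ a zero = refl
  ι-^ a (suc k) = trans (cong (ι (+ a) ℚ.*_) (ι-^ a k)) (trans (ι-* (+ a) (+ (a ℕ.^ k))) (cong ι (sym (ℤP.pos-* a (a ℕ.^ k)))))

  *-mono-≤ℚ : ∀ {a b c d} → 0ℚ ℚ.≤ a → 0ℚ ℚ.≤ c → a ℚ.≤ b → c ℚ.≤ d → a ℚ.* c ℚ.≤ b ℚ.* d
  *-mono-≤ℚ {a} {b} {c} {d} ha hc ab cd = ℚP.≤-trans (ℚP.*-monoʳ-≤-nonNeg c {{ℚ.nonNegative hc}} ab)
    (ℚP.*-monoˡ-≤-nonNeg b {{ℚ.nonNegative (ℚP.≤-trans ha ab)}} cd)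

  0≤^ : ∀ {x} k → 0ℚ ℚ.≤ x → 0ℚ ℚ.≤ x ^ℚ k
  0≤^ zero h = *≤* (ℤ.+≤+ ℕ.z≤n)
  0≤^ {x} (suc k) h = *-mono-≤ℚ {0ℚ} {x} {0ℚ} {x ^ℚ k} ℚP.≤-refl ℚP.≤-refl h (0≤^ k h)

  ^-mono : ∀ {x y} k → 0ℚ ℚ.≤ x → x ℚ.≤ y → x ^ℚ k ℚ.≤ y ^ℚ k
  ^-mono zero h hxy = ℚP.≤-refl
  ^-mono (suc k) h hxy = *-mono-≤ℚ h (0≤^ k h) hxy (^-mono k h hxy)

  -- t is the integer part of T / D, positive because D < T, so T < D (t + 1) ≤ 2 D t.
  floor : ∀ D T → 1 ℕ.≤ D → ι (+ D) ℚ.< T → ∃ λ t → 1 ℕ.≤ t × ι (+ (D ℕ.* t)) ℚ.≤ T × T ℚ.≤ ι (+ (2 ℕ.* (D ℕ.* t)))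
  floor D T 1≤D h with subst (ℚ._< T) (ι≡ (+ D)) h
  floor (suc D') (mkℚ -[1+ p ] d-1 _) 1≤D h | *<* ()
  floor (suc D') T@(mkℚ (+ p) d-1 _) 1≤D h | *<* lt =
    t , 1≤t , subst (ℚ._≤ T) (sym (ι≡ (+ (D ℕ.* t)))) (*≤* (subst₂ ℤ._≤_ (ℤP.pos-* (D ℕ.* t) d) (sym (ℤP.*-identityʳ (+ p))) (ℤ.+≤+ low))) ,
    subst (T ℚ.≤_) (sym (ι≡ (+ (2 ℕ.* (D ℕ.* t))))) (*≤* (subst₂ ℤ._≤_ (sym (ℤP.*-identityʳ (+ p))) (ℤP.pos-* (2 ℕ.* (D ℕ.* t)) d) (ℤ.+≤+ high)))
    where
    D = suc D'
    d = suc d-1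
    t = p ℕD./ (D ℕ.* d)
    Dd≤p : D ℕ.* d ℕ.≤ p
    Dd≤p = ℕP.<⇒≤ (ℤP.drop‿+<+ (subst₂ ℤ._<_ (sym (ℤP.pos-* D d)) (ℤP.*-identityʳ (+ p)) lt))
    1≤t : 1 ℕ.≤ t
    1≤t = ℕD.m≥n⇒m/n>0 Dd≤p
    open ℕP.≤-Reasoning
    swap : ∀ D t d → D ℕ.* t ℕ.* d ≡ t ℕ.* (D ℕ.* d)
    swap = solveℕ-∀
    low : D ℕ.* t ℕ.* d ℕ.≤ p
    low = begin
      D ℕ.* t ℕ.* d    ≡⟨ swap D t d ⟩
      t ℕ.* (D ℕ.* d)  ≤⟨ ℕD.m/n*n≤m p (D ℕ.* d) ⟩
      p                ∎
    high : p ℕ.≤ 2 ℕ.* (D ℕ.* t) ℕ.* d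
    high = begin
      p                                              ≡⟨ ℕD.m≡m%n+[m/n]*n p (D ℕ.* d) ⟩
      p ℕD.% (D ℕ.* d) ℕ.+ t ℕ.* (D ℕ.* d)
        ≤⟨ ℕP.+-monoˡ-≤ (t ℕ.* (D ℕ.* d)) (ℕP.<⇒≤ (ℕD.m%n<n p (D ℕ.* d))) ⟩
      D ℕ.* d ℕ.+ t ℕ.* (D ℕ.* d)
        ≤⟨ ℕP.+-monoˡ-≤ (t ℕ.* (D ℕ.* d)) (ℕP.≤-trans (ℕP.≤-reflexive (sym (ℕP.*-identityˡ (D ℕ.* d)))) (ℕP.*-monoˡ-≤ (D ℕ.* d) 1≤t)) ⟩
      t ℕ.* (D ℕ.* d) ℕ.+ t ℕ.* (D ℕ.* d)            ≡⟨ twice D t d ⟩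
      2 ℕ.* (D ℕ.* t) ℕ.* d                          ∎
      where
      twice : ∀ D t d → t ℕ.* (D ℕ.* d) ℕ.+ t ℕ.* (D ℕ.* d) ≡ 2 ℕ.* (D ℕ.* t) ℕ.* d
      twice = solveℕ-∀

  module _ (n m : ℕ) (L : List (Mat n)) (T : ℚ) (mem : ∀ A → (A ∈ L) ⇔ InN n (dbl m) T A) where

    lower-length : ∀ κ t → 1 ℕ.≤ t → ι (+ (suc (n ℕ.* κ) ℕ.* t)) ℚ.≤ T →
      ∀ {N} → AtLeast _≋_ (Good m (κ ℕ.* t) n) N → N ℕ.≤ length L
    lower-length κ t 1≤t Dt≤T = ≤-length L toMat toMat-injective λ A good →
      Equivalence.from (mem (toMat A)) (good-alt A good , good-rank A good , norm A good)
      where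
      -- Entries at most κ t give norm at most n κ t; the `suc` makes the norm strictly smaller than
      -- D t ≤ T.
      D = suc (n ℕ.* κ)
      nat : n ℕ.* (n ℕ.* (κ ℕ.* t ℕ.* (κ ℕ.* t))) ℕ.< D ℕ.* t ℕ.* (D ℕ.* t)
      nat = ℕP.≤-<-trans (ℕP.≤-reflexive (l n κ t)) (ℕP.*-mono-< lt lt)
        where
        l : ∀ n κ t → n ℕ.* (n ℕ.* (κ ℕ.* t ℕ.* (κ ℕ.* t))) ≡ n ℕ.* κ ℕ.* t ℕ.* (n ℕ.* κ ℕ.* t)
        l = solveℕ-∀
        lt : n ℕ.* κ ℕ.* t ℕ.< D ℕ.* t
        lt = ℕP.+-monoˡ-≤ (n ℕ.* κ ℕ.* t) 1≤t
      norm : ∀ A → Good m (κ ℕ.* t) n A → normSq (toMat A) ℚ./ 1 ℚ.< T ℚ.* T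
      norm A good = ℚP.<-≤-trans (ι-mono-< (ℤP.≤-<-trans (ℤP.≤-trans
          (ℤP.≤-reflexive (trans (normSq≡frob (toMat A)) (frob-cong (entry-toMat A)))) (frob-≤ A (Good.bound good))) (ℤ.+<+ nat)))
        (subst (ℚ._≤ T ℚ.* T) (trans (ι-* (+ (D ℕ.* t)) (+ (D ℕ.* t))) (cong ι (sym (ℤP.pos-* (D ℕ.* t) (D ℕ.* t)))))
          (*-mono-≤ℚ (0≤ι (D ℕ.* t)) (0≤ι (D ℕ.* t)) Dt≤T Dt≤T))

  upper-length : ∀ n m (h : dbl m ℕ.≤ suc n) (L : List (Mat (suc n))) T → (∀ A → (A ∈ L) ⇔ InN (suc n) (dbl m) T A) → Unique L →
    ∀ s → 1 ℕ.≤ s → 0ℚ ℚ.≤ T → T ℚ.≤ ι (+ s) → length L ℕ.≤ upperConst n m h ℕ.* s ℕ.^ (suc n ℕ.* m)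
  upper-length n m h L T mem u s 1≤s 0≤T T≤s = length-≤ u low (λ A B _ _ q → entry-injective A B q) (upper n m h s 1≤s)
    where
    low : ∀ A → A ∈ L → LowRank n m h s
    low A A∈ = let (alt , rk , nrm) = Equivalence.to (mem A) A∈ in
      entry A , proj₁ alt , rank⇒RankLe A alt rk , subst (ℤ._≤ + (s ℕ.* s)) (normSq≡frob A) (ℤP.<⇒≤ (ι-cancel-<
        (ℚP.<-≤-trans nrm (subst (T ℚ.* T ℚ.≤_) (trans (ι-* (+ s) (+ s)) (cong ι (sym (ℤP.pos-* s s)))) (*-mono-≤ℚ 0≤T 0≤T T≤s T≤s)))))

  Bounds : (n r k : ℕ) → Set
  Bounds n r k = Σ ℚ λ c₁ → Σ ℚ λ c₂ → Σ ℚ λ T₀ → 0ℚ ℚ.< c₁ × 0ℚ ℚ.< c₂ ×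
    ((T : ℚ) → T₀ ℚ.< T → 0ℚ ℚ.< T → (L : List (Mat n)) → Unique L → ((A : Mat n) → (A ∈ L) ⇔ InN n r T A) →
      (c₁ ℚ.* (T ^ℚ k) ℚ.≤ (+ length L) ℚ./ 1) × ((+ length L) ℚ./ 1 ℚ.≤ c₂ ℚ.* (T ^ℚ k)))

  -- Take t with D t ≤ T ≤ 2 D t. Then T^k ≤ (2 D t)^k = Q t^k, while the family has t^k members
  -- inside the ball: this gives 1 / Q. The upper count at s = 2 D t is C Q t^k, and t ≤ T; the
  -- `suc` in the second constant keeps it positive.
  bounds : ∀ n m → dbl m ℕ.≤ suc n → ∀ κ →
    (∀ t → AtLeast _≋_ (Good m (κ ℕ.* t) (suc n)) (t ℕ.^ (suc n ℕ.* m))) → Bounds (suc n) (dbl m) (suc n ℕ.* m)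
  bounds n m h κ family = (ℚ.1/ ι (+ Q)) {{nz}} , ι (+ suc (C ℕ.* Q)) , ι (+ D) ,
      ℚP.positive⁻¹ _ {{ℚP.1/pos⇒pos (ι (+ Q)) {{pos}}}} , ι-mono-< {+ 0} {+ suc (C ℕ.* Q)} (ℤ.+<+ (ℕ.s≤s ℕ.z≤n)) , main
    where
    k = suc n ℕ.* m
    C = upperConst n m h
    D = suc (suc n ℕ.* κ)
    Q = (2 ℕ.* D) ℕ.^ k
    pos : ℚ.Positive (ι (+ Q))
    pos = ℚ.positive (ι-mono-< {+ 0} {+ Q} (ℤ.+<+ (1≤^ k (ℕ.s≤s ℕ.z≤n))))
    nz : ℚ.NonZero (ι (+ Q))
    nz = ℚP.pos⇒nonZero (ι (+ Q)) {{pos}}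
    c₁ = (ℚ.1/ ι (+ Q)) {{nz}}
    power : ∀ t → (2 ℕ.* (D ℕ.* t)) ℕ.^ k ≡ Q ℕ.* t ℕ.^ k
    power t = trans (cong (ℕ._^ k) (sym (ℕP.*-assoc 2 D t))) (^-distrib-* (2 ℕ.* D) t k)
    main : (T : ℚ) → ι (+ D) ℚ.< T → 0ℚ ℚ.< T → (L : List (Mat (suc n))) → Unique L →
      ((A : Mat (suc n)) → (A ∈ L) ⇔ InN (suc n) (dbl m) T A) →
      (c₁ ℚ.* (T ^ℚ k) ℚ.≤ ι (+ length L)) × (ι (+ length L) ℚ.≤ ι (+ suc (C ℕ.* Q)) ℚ.* (T ^ℚ k))
    main T D<T 0<T L uniq mem = low , high
      where
      approx = floor D T (ℕ.s≤s ℕ.z≤n) D<T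
      t = proj₁ approx
      1≤t = proj₁ (proj₂ approx)
      Dt≤T = proj₁ (proj₂ (proj₂ approx))
      T≤2Dt = proj₂ (proj₂ (proj₂ approx))
      open ℚP.≤-Reasoning
      0≤T = ℚP.<⇒≤ 0<T
      low : c₁ ℚ.* (T ^ℚ k) ℚ.≤ ι (+ length L)
      low = begin
        c₁ ℚ.* (T ^ℚ k)
          ≤⟨ ℚP.*-monoˡ-≤-nonNeg c₁ {{ℚP.pos⇒nonNeg c₁ {{ℚP.1/pos⇒pos (ι (+ Q)) {{pos}}}}}} (^-mono k 0≤T T≤2Dt) ⟩
        c₁ ℚ.* (ι (+ (2 ℕ.* (D ℕ.* t))) ^ℚ k)
          ≡⟨ cong (c₁ ℚ.*_) (trans (ι-^ (2 ℕ.* (D ℕ.* t)) k) (trans (cong (λ z → ι (+ z)) (power t)) (trans (cong ι (ℤP.pos-* Q (t ℕ.^ k))) (sym (ι-* (+ Q) (+ (t ℕ.^ k))))))) ⟩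
        c₁ ℚ.* (ι (+ Q) ℚ.* ι (+ (t ℕ.^ k)))   ≡⟨ ℚP.*-assoc c₁ (ι (+ Q)) (ι (+ (t ℕ.^ k))) ⟨
        c₁ ℚ.* ι (+ Q) ℚ.* ι (+ (t ℕ.^ k))     ≡⟨ cong (ℚ._* ι (+ (t ℕ.^ k))) (ℚP.*-inverseˡ (ι (+ Q)) {{nz}}) ⟩
        1ℚ ℚ.* ι (+ (t ℕ.^ k))                 ≡⟨ ℚP.*-identityˡ (ι (+ (t ℕ.^ k))) ⟩
        ι (+ (t ℕ.^ k))
          ≤⟨ ι-mono (ℤ.+≤+ (lower-length (suc n) m L T mem κ t 1≤t Dt≤T (family t))) ⟩
        ι (+ length L)                         ∎
      t≤T : ι (+ t) ℚ.≤ T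
      t≤T = ℚP.≤-trans (ι-mono {+ t} {+ (D ℕ.* t)} (ℤ.+≤+ (ℕP.m≤n*m t D))) Dt≤T
      count : length L ℕ.≤ suc (C ℕ.* Q) ℕ.* t ℕ.^ k
      count = ℕP.≤-trans (upper-length n m h L T mem uniq (2 ℕ.* (D ℕ.* t)) (ℕP.≤-trans 1≤t (ℕP.≤-trans (ℕP.m≤n*m t D) (ℕP.m≤n*m (D ℕ.* t) 2))) 0≤T T≤2Dt)
        (ℕP.≤-trans (ℕP.≤-reflexive (trans (cong (C ℕ.*_) (power t)) (sym (ℕP.*-assoc C Q (t ℕ.^ k))))) (ℕP.*-monoˡ-≤ (t ℕ.^ k) (ℕP.n≤1+n (C ℕ.* Q))))
      high : ι (+ length L) ℚ.≤ ι (+ suc (C ℕ.* Q)) ℚ.* (T ^ℚ k)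
      high = begin
        ι (+ length L)                                  ≤⟨ ι-mono (ℤ.+≤+ count) ⟩
        ι (+ (suc (C ℕ.* Q) ℕ.* t ℕ.^ k))
          ≡⟨ trans (cong ι (ℤP.pos-* (suc (C ℕ.* Q)) (t ℕ.^ k))) (sym (ι-* (+ suc (C ℕ.* Q)) (+ (t ℕ.^ k)))) ⟩
        ι (+ suc (C ℕ.* Q)) ℚ.* ι (+ (t ℕ.^ k))
          ≤⟨ ℚP.*-monoˡ-≤-nonNeg (ι (+ suc (C ℕ.* Q))) {{ℚ.nonNegative (0≤ι (suc (C ℕ.* Q)))}} (subst (ℚ._≤ T ^ℚ k) (ι-^ t k) (^-mono k (0≤ι t) t≤T)) ⟩
        ι (+ suc (C ℕ.* Q)) ℚ.* (T ^ℚ k)                ∎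

  dbl≡*2 : ∀ m → dbl m ≡ m ℕ.* 2
  dbl≡*2 zero = refl
  dbl≡*2 (suc m) = cong (λ d → suc (suc d)) (dbl≡*2 m)

  rank-bounds : ∀ n m → dbl m ℕ.≤ n → Bounds (suc n) (dbl m) (suc n ℕ.* m)
  rank-bounds n m h =
    let (κ , _ , family) = lower m (n ℕ.∸ dbl m)
        size = trans (ℕP.+-suc (n ℕ.∸ dbl m) (dbl m)) (cong suc (ℕP.m∸n+n≡m h))
    in bounds n m (ℕP.≤-trans h (ℕP.n≤1+n n)) κ
         (λ t → subst (λ k → AtLeast _≋_ (Good m (κ ℕ.* t) k) (t ℕ.^ (k ℕ.* m))) size (family t))

open import Data.Nat using (ℕ; _∸_) renaming (_≤_ to _≤ℕ_; _*_ to _*ℕ_; _/_ to _/ℕ_)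
open import Data.Nat.Divisibility using (_∣_)
open import Data.Integer using (+_)
open import Data.Rational using (ℚ; _<_; _≤_; _*_; 0ℚ; _/_)
open import Data.List using (List; length)
open import Data.List.Relation.Unary.Unique.Propositional using (Unique)
open import Data.List.Membership.Propositional using (_∈_)
open import Data.Product using (Σ; _×_)
open import Function.Bundles using (_⇔_)
open import Data.Nat using (suc)
open import Data.Nat.Divisibility using (divides)
open import Data.Nat.DivMod using (m*n/n≡m)
open import Data.Nat.Properties using (*-assoc)
open import Relation.Binary.PropositionalEquality using (refl; sym; trans; cong; subst; subst₂)
open AlternatingMatrices using (Bounds; rank-bounds; dbl≡*2)

theorem9p1p2 : (n r : ℕ) → 1 ≤ℕ n → 2 ∣ r → r ≤ℕ n ∸ 1 →
    Σ ℚ λ c₁ → Σ ℚ λ c₂ → Σ ℚ λ T₀ →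
    0ℚ < c₁ × 0ℚ < c₂ ×
    ((T : ℚ) → T₀ < T → 0ℚ < T →
    (L : List (Mat n)) → Unique L → ((A : Mat n) → (A ∈ L) ⇔ InN n r T A) →
    (c₁ * (T ^ℚ ((n *ℕ r) /ℕ 2)) ≤ (+ length L) / 1)
    × ((+ length L) / 1 ≤ c₂ * (T ^ℚ ((n *ℕ r) /ℕ 2))))
theorem9p1p2 (suc n) .(m *ℕ 2) _ (divides m refl) h = subst₂ (Bounds (suc n)) (dbl≡*2 m)
  (sym (trans (cong (_/ℕ 2) (sym (*-assoc (suc n) m 2))) (m*n/n≡m (suc n *ℕ m) 2)))
  (rank-bounds n m (subst (_≤ℕ n) (sym (dbl≡*2 m)) h))
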